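{- For every $n\ge 2$ the genus distribution of ${\cal S}_9^n$ is unimodal, and its peak $p_9(n)$ is $$p_9(n)=\begin{cases}\Big[\dfrac{n+1}{2}\Big], & 2\le n\le 8,\\[2mm] 4, & n=9,\\[1mm] \Big[\dfrac{n}{3}\Big]+2, & n\ge 10.\end{cases}$$
   Context: $[x]$ denotes the largest integer not exceeding $x$. A surface is represented by a cyclic word in which every occurring letter $x$ appears exactly once as $x$ and exactly once as $x^-$; it is the closed orientable surface obtained from a polygon with boundary labelled by the word by identifying each side $x$ with the side $x^-$ (orientation reversed), and its genus is the genus of that surface. Let $a,b,a_1,a_2,\dots$ be distinct letters. For $n\ge 1$ and subsets $K,T\subseteq\{1,\dots,n\}$ put: $R_1^n$ = product of the letters $a_k$, $k\in K$, in decreasing order of index; $R_2^n$ = product of the $a_k$, $k\notin K$, in increasing order of index; $R_3^n$ = product of the $a_t^-$, $t\in T$, in decreasing order of index; $R_4^n$ = product of the $a_t^-$, $t\notin T$, in increasing order of index. The set of ladder surfaces considered is ${\cal S}_9^n=\{R_1^nR_3^naR_2^na^-bR_4^nb^-\}$, where $(K,T)$ runs over all $4^n$ pairs of subsets and surfaces are counted with multiplicity (one for each pair). $g_{i_9}(n)$ is the number of surfaces of genus $i$ in ${\cal S}_9^n$, and the genus distribution of ${\cal S}_9^n$ is the sequence $(g_{i_9}(n))_i$, with $i$ running from the minimum to the maximum genus of surfaces in ${\cal S}_9^n$. A finite sequence of nonnegative numbers $\{a_i\}_{i=q}^n$ is unimodal if $a_q\le\cdots\le a_{l-1}<a_l=\cdots=a_m>a_{m+1}\ge\cdots\ge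 a_n$ for some $q\le l\le m\le n$; $l,\dots,m$ are its modes, and if $l=m$ then $m$ is called the peak (indices are genera). -}

module Defs where

open import Data.Bool using (if_then_else_)
open import Data.Empty using (⊥-elim)
open import Data.Fin using (Fin; toℕ)
import Data.Fin as Fin
open import Data.Fin.Properties using (any?; toℕ-injective)
open import Data.Fin.Subset using (Subset; inside; outside)
open import Data.Fin.Subset.Properties using (_∈?_)
open import Data.List using (List; []; _∷_; [_]; _++_; map; filter; reverse; length; lookup; allFin; cartesianProduct; deduplicate)
open import Data.List.Properties using (map-++; map-∘)
open import Data.List.Membership.Propositional using (_∈_)
open import Data.List.Membership.Propositional.Properties using (∈-filter⁺; ∈-cartesianProduct⁺; ∈-allFin)
open import Data.List.Relation.Unary.All using ([]; _∷_)
import Data.List.Relation.Unary.All as All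
import Data.List.Relation.Unary.All.Properties as All
open import Data.List.Relation.Unary.Any using (here; there)
open import Data.List.Relation.Unary.Unique.Propositional using (Unique)
import Data.List.Relation.Unary.Unique.Propositional.Properties as Unique
open import Data.List.Relation.Unary.AllPairs using ([]; _∷_)
open import Data.List.Relation.Binary.Permutation.Propositional
  using (_↭_; ↭-refl; ↭-prep; ↭-trans; ↭-reflexive)
open import Data.List.Relation.Binary.Permutation.Propositional.Properties
  using (map⁺; ++⁺; ++⁺ʳ; shift; ↭-reverse; ++-commutativeMonoid)
open import Data.Nat using (ℕ; zero; suc; _+_; _*_; _/_; _≤_; _<_; _≤ᵇ_; _≡ᵇ_; _≟_)
open import Data.Nat.DivMod using (_mod_)
open import Data.Nat.Properties using (suc-injective)
open import Data.Product using (Σ; ∃; ∃₂; _×_; _,_; proj₁; proj₂; map₂)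
open import Data.Product.Properties using (≡-dec)
open import Data.Sign using (Sign; opposite)
import Data.Sign as Sign
import Data.Sign.Properties as Sign
open import Data.Vec using (Vec)
import Data.Vec as Vec
import Data.Vec.Properties as Vec
import Algebra.Solver.CommutativeMonoid as CommutativeMonoidSolver
open import Function using (_∘_)
open import Level using (Level; 0ℓ)
open import Relation.Binary using (Rel; Decidable; DecidableEquality)
open import Relation.Binary.Construct.Closure.Equivalence using (EqClosure)
import Relation.Binary.Construct.Closure.Equivalence as EqC
import Relation.Binary.Construct.Closure.ReflexiveTransitive as Star
import Relation.Binary.Construct.Closure.Symmetric as Sym
import Relation.Binary.Construct.On as On
open import Relation.Binary.PropositionalEquality
  using (_≡_; refl; sym; trans; cong; subst; isEquivalence)
open import Relation.Nullary using (yes; no; ¬?; does)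
open import Relation.Nullary.Decidable using (map′; _×-dec_)
import Relation.Unary as U

------------------------------------------------------------------------
-- Words

data Letter : Set where
  𝐚 𝐛  : Letter
  𝐚[_] : ℕ → Letter

𝐚[]-injective : ∀ {i j} → 𝐚[ i ] ≡ 𝐚[ j ] → i ≡ j
𝐚[]-injective refl = refl

_≟ᴸ_ : DecidableEquality Letter
𝐚      ≟ᴸ 𝐚      = yes refl
𝐚      ≟ᴸ 𝐛      = no λ ()
𝐚      ≟ᴸ 𝐚[ _ ] = no λ ()
𝐛      ≟ᴸ 𝐚      = no λ ()
𝐛      ≟ᴸ 𝐛      = yes refl
𝐛      ≟ᴸ 𝐚[ _ ] = no λ ()
𝐚[ _ ] ≟ᴸ 𝐚      = no λ ()
𝐚[ _ ] ≟ᴸ 𝐛      = no λ ()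
𝐚[ i ] ≟ᴸ 𝐚[ j ] = map′ (cong 𝐚[_]) 𝐚[]-injective (i ≟ j)

Side : Set
Side = Letter × Sign

infix 8 _⁺ _⁻

_⁺ _⁻ : Letter → Side
x ⁺ = x , Sign.+
x ⁻ = x , Sign.-

inverse : Side → Side
inverse = map₂ opposite

_≟ˢ_ : DecidableEquality Side
_≟ˢ_ = ≡-dec _≟ᴸ_ Sign._≟_

-- A list of sides stands for the cyclic word obtained by reading it around
-- the polygon; `next` below closes it up, so nothing depends on where the
-- reading starts.
Word : Set
Word = List Side

-- The permutation says that each occurring letter x contributes exactly one
-- side x and exactly one side x⁻.
record Surface : Set where
  field
    word    : Word
    letters : List Letter
    unique  : Unique letters
    paired  : word ↭ map _⁺ letters ++ map _⁻ letters

open Surface public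

------------------------------------------------------------------------
-- Equivalence classes of a generated equivalence relation on Fin m

module _ {m : ℕ} {ℓ : Level} {R : Rel (Fin m) ℓ} where

  private
    _≈_ : Rel (Fin m) ℓ
    _≈_ = EqClosure R

  -- A representative of the class of each point, for the equivalence relation
  -- generated by a list of pairs.
  Representatives : List (Fin m × Fin m) → Set ℓ
  Representatives ps = Σ (Vec (Fin m) m) λ reps → let f = Vec.lookup reps in
    (∀ i → i ≈ f i) × (∀ {u v} → (u , v) ∈ ps → f u ≡ f v)

  -- Move the class of p onto that of q.
  glue : ∀ {p q ps} → R p q → Representatives ps → Representatives ((p , q) ∷ ps)
  glue {p} {q} {ps} Rpq (reps , ≈f , f-glues) = Vec.map move reps , sound , glues
    where
    f : Fin m → Fin m
    f = Vec.lookup reps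

    move : Fin m → Fin m
    move j = if does (j Fin.≟ f p) then f q else j

    lookup-move : ∀ i → Vec.lookup (Vec.map move reps) i ≡ move (f i)
    lookup-move i = Vec.lookup-map i move reps

    sound′ : ∀ i → i ≈ move (f i)
    sound′ i with f i Fin.≟ f p
    ... | no  _     = ≈f i
    ... | yes fi≡fp = EqC.transitive R
      (subst (i ≈_) fi≡fp (≈f i))
      (EqC.transitive R (EqC.symmetric R (≈f p)) (Sym.fwd Rpq Star.◅ ≈f q))

    sound : ∀ i → i ≈ Vec.lookup (Vec.map move reps) i
    sound i = subst (i ≈_) (sym (lookup-move i)) (sound′ i)

    move-p : move (f p) ≡ f q
    move-p with f p Fin.≟ f p
    ... | yes _ = refl
    ... | no ≢  = ⊥-elim (≢ refl)

    move-q : move (f q) ≡ f q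
    move-q with f q Fin.≟ f p
    ... | yes _ = refl
    ... | no  _ = refl

    glues′ : ∀ {u v} → (u , v) ∈ ((p , q) ∷ ps) → move (f u) ≡ move (f v)
    glues′ (here refl) = trans move-p (sym move-q)
    glues′ (there uv∈) = cong move (f-glues uv∈)

    glues : ∀ {u v} → (u , v) ∈ ((p , q) ∷ ps) →
            Vec.lookup (Vec.map move reps) u ≡ Vec.lookup (Vec.map move reps) v
    glues {u} {v} uv∈ =
      trans (lookup-move u) (trans (glues′ uv∈) (sym (lookup-move v)))

  representatives : ∀ ps → All.All (λ (u , v) → R u v) ps → Representatives ps
  representatives []       []         = Vec.allFin m
    , (λ i → subst (i ≈_) (sym (Vec.lookup-allFin i)) (EqC.reflexive R))
    , λ ()
  representatives (_ ∷ ps) (Rpq ∷ Rs) = glue Rpq (representatives ps Rs)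

  closure? : Decidable R → Decidable (EqClosure R)
  closure? R? = compare (representatives pairs (All.all-filter R?′ allPairs))
    where
    R?′ : U.Decidable (λ (u , v) → R u v)
    R?′ (u , v) = R? u v

    allPairs pairs : List (Fin m × Fin m)
    allPairs = cartesianProduct (allFin m) (allFin m)
    pairs    = filter R?′ allPairs

    compare : Representatives pairs → Decidable (EqClosure R)
    compare (reps , ≈f , f-glues) i j = map′ from to (f i Fin.≟ f j)
      where
      f : Fin m → Fin m
      f = Vec.lookup reps

      from : f i ≡ f j → i ≈ j
      from fi≡fj = EqC.transitive R (≈f i)
        (subst (_≈ j) (sym fi≡fj) (EqC.symmetric R (≈f j)))

      to : i ≈ j → f i ≡ f j
      to = EqC.fold (On.isEquivalence f isEquivalence) λ Ruv →
        f-glues (∈-filter⁺ R?′ (∈-cartesianProduct⁺ (∈-allFin _) (∈-allFin _)) Ruv)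

  classCount : Decidable R → ℕ
  classCount R? = length (deduplicate (closure? R?) (allFin m))

------------------------------------------------------------------------
-- Genus

-- The corners of the polygon are indexed like its sides: side i runs from
-- corner i to corner `next i`.
next : ∀ {m} → Fin m → Fin m
next {suc m} i = suc (toℕ i) mod suc m

-- Side j is to be identified, orientation reversed, with the side u whose
-- label is inverse to its own; this puts the start u of side u on the end
-- `next j` of side j. The other identification made by this pair of sides
-- (end of u, start of j) arises with the roles of u and j exchanged.
Glued : (w : Word) → Rel (Fin (length w)) 0ℓ
Glued w u v = ∃ λ j → lookup w j ≡ inverse (lookup w u) × v ≡ next j

glued? : (w : Word) → Decidable (Glued w)
glued? w u v = any? λ j → (lookup w j ≟ˢ inverse (lookup w u)) ×-dec (v Fin.≟ next j)

vertexCount : Surface → ℕ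
vertexCount s = classCount (glued? (word s))

edgeCount : Surface → ℕ
edgeCount s = length (letters s)

-- Euler's formula V - E + F = 2 - 2g with one face F = 1, arranged to avoid
-- subtraction.
HasGenus : ℕ → Surface → Set
HasGenus g s = vertexCount s + 1 + 2 * g ≡ edgeCount s + 2

hasGenus? : ∀ g → U.Decidable (HasGenus g)
hasGenus? g s = (vertexCount s + 1 + 2 * g) ≟ (edgeCount s + 2)

genusCount : List Surface → ℕ → ℕ
genusCount 𝒮 i = length (filter (hasGenus? i) 𝒮)

record GenusRange (𝒮 : List Surface) (q N : ℕ) : Set where
  field
    min-attained : 0 < genusCount 𝒮 q
    max-attained : 0 < genusCount 𝒮 N
    bounds       : ∀ i → 0 < genusCount 𝒮 i → q ≤ i × i ≤ N

------------------------------------------------------------------------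
-- The ladder surfaces

-- The element k of Fin n plays the role of the index k + 1.
letter : ∀ {n} → Fin n → Letter
letter k = 𝐚[ suc (toℕ k) ]

members nonmembers : ∀ {n} → Subset n → List (Fin n)
members    K = filter (_∈? K) (allFin _)
nonmembers K = filter (¬? ∘ (_∈? K)) (allFin _)

module _ {n : ℕ} where

  R₁ R₂ R₃ R₄ : Subset n → Word
  R₁ K = map (_⁺ ∘ letter) (reverse (members K))
  R₂ K = map (_⁺ ∘ letter) (nonmembers K)
  R₃ T = map (_⁻ ∘ letter) (reverse (members T))
  R₄ T = map (_⁻ ∘ letter) (nonmembers T)

  ladderWord : Subset n → Subset n → Word
  ladderWord K T =
    R₁ K ++ R₃ T ++ [ 𝐚 ⁺ ] ++ R₂ K ++ [ 𝐚 ⁻ ] ++ [ 𝐛 ⁺ ] ++ R₄ T ++ [ 𝐛 ⁻ ]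

ladderLetters : ℕ → List Letter
ladderLetters n = 𝐚 ∷ 𝐛 ∷ map letter (allFin n)

private
  unique-letters : ∀ n → Unique (ladderLetters n)
  unique-letters n =
    ((λ ()) ∷ All.map⁺ (All.universal (λ _ ()) _)) ∷
    All.map⁺ (All.universal (λ _ ()) _) ∷
    Unique.map⁺ (toℕ-injective ∘ suc-injective ∘ 𝐚[]-injective) (Unique.allFin⁺ n)

  split-↭ : ∀ {A : Set} {P : A → Set} (P? : U.Decidable P) xs →
            filter P? xs ++ filter (¬? ∘ P?) xs ↭ xs
  split-↭ P? [] = ↭-refl
  split-↭ P? (x ∷ xs) with P? x
  ... | yes _ = ↭-prep x (split-↭ P? xs)
  ... | no  _ = ↭-trans (shift x (filter P? xs) _) (↭-prep x (split-↭ P? xs))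

  rungs-↭ : ∀ {n} (K : Subset n) (h : Fin n → Side) →
            map h (reverse (members K)) ++ map h (nonmembers K) ↭ map h (allFin n)
  rungs-↭ K h = ↭-trans (++⁺ʳ _ (map⁺ h (↭-reverse (members K))))
    (↭-trans (↭-reflexive (sym (map-++ h (members K) (nonmembers K))))
      (map⁺ h (split-↭ (_∈? K) (allFin _))))

  open CommutativeMonoidSolver (++-commutativeMonoid {A = Side}) using (solve; _⊕_; _⊜_)

  blocks-↭ : ∀ (r₁ r₂ r₃ r₄ p p′ q q′ : Word) →
    r₁ ++ r₃ ++ p ++ r₂ ++ p′ ++ q ++ r₄ ++ q′ ↭
    (p ++ q ++ r₁ ++ r₂) ++ (p′ ++ q′ ++ r₃ ++ r₄)
  blocks-↭ = solve 8
    (λ r₁ r₂ r₃ r₄ p p′ q q′ →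
      (r₁ ⊕ (r₃ ⊕ (p ⊕ (r₂ ⊕ (p′ ⊕ (q ⊕ (r₄ ⊕ q′)))))))
      ⊜ ((p ⊕ (q ⊕ (r₁ ⊕ r₂))) ⊕ (p′ ⊕ (q′ ⊕ (r₃ ⊕ r₄))))) ↭-refl

  paired-ladder : ∀ {n} (K T : Subset n) →
    ladderWord K T ↭ map _⁺ (ladderLetters n) ++ map _⁻ (ladderLetters n)
  paired-ladder {n} K T =
    ↭-trans (blocks-↭ (R₁ K) (R₂ K) (R₃ T) (R₄ T) [ 𝐚 ⁺ ] [ 𝐚 ⁻ ] [ 𝐛 ⁺ ] [ 𝐛 ⁻ ])
      (++⁺ (↭-prep _ (↭-prep _ (rungs _⁺ K))) (↭-prep _ (↭-prep _ (rungs _⁻ T))))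
    where
    rungs : ∀ (h : Letter → Side) (S : Subset n) →
            map (h ∘ letter) (reverse (members S)) ++ map (h ∘ letter) (nonmembers S)
              ↭ map h (map letter (allFin n))
    rungs h S = ↭-trans (rungs-↭ S (h ∘ letter)) (↭-reflexive (map-∘ (allFin n)))

ladder : ∀ {n} → Subset n → Subset n → Surface
ladder {n} K T = record
  { word    = ladderWord K T
  ; letters = ladderLetters n
  ; unique  = unique-letters n
  ; paired  = paired-ladder K T
  }

subsets : ∀ n → List (Subset n)
subsets zero    = [ Vec.[] ]
subsets (suc n) = map (inside Vec.∷_) (subsets n) ++ map (outside Vec.∷_) (subsets n)

-- A list, so that each pair (K , T) is counted.
𝒮₉ : ℕ → List Surface
𝒮₉ n = map (λ (K , T) → ladder K T) (cartesianProduct (subsets n) (subsets n))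

g₉ : ℕ → ℕ → ℕ
g₉ n = genusCount (𝒮₉ n)

------------------------------------------------------------------------
-- Unimodality

-- The modes of the finite sequence α q, …, α N are l, …, m.  The strict
-- inequalities are void when l ≡ q, respectively m ≡ N.
record Modes (α : ℕ → ℕ) (q N l m : ℕ) : Set where
  field
    q≤l        : q ≤ l
    l≤m        : l ≤ m
    m≤N        : m ≤ N
    increasing : ∀ i → q ≤ i → suc i < l → α i ≤ α (suc i)
    rise       : ∀ i → q ≤ i → suc i ≡ l → α i < α l
    plateau    : ∀ i → l ≤ i → i < m → α i ≡ α (suc i)
    fall       : m < N → α (suc m) < α m
    decreasing : ∀ i → m < i → i < N → α (suc i) ≤ α i

Unimodal : (ℕ → ℕ) → ℕ → ℕ → Set
Unimodal α q N = ∃₂ λ l m → Modes α q N l m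

Peak : (ℕ → ℕ) → ℕ → ℕ → ℕ → Set
Peak α q N p = Modes α q N p p

p₉ : ℕ → ℕ
p₉ n = if n ≤ᵇ 8 then (n + 1) / 2 else
       if n ≡ᵇ 9 then 4           else
       n / 3 + 2

{-# OPTIONS --safe #-}
module Submission where

-- The letters a₁, a₂, … are inserted one at a time.  Each of the two sides of
-- a new letter has two possible places, so all insertions happen at four
-- markers of the cyclic word.  Cutting the vertices of the glued polygon at
-- the markers leaves four arcs; the permutation sending the marker where an arc
-- starts to the marker where it ends determines whether an insertion splits a
-- vertex or merges two, i.e. whether the genus stays or grows.  The genus
-- polynomials are therefore given by a transfer matrix on 24 permutations,
-- which solves to
--   Σₙ g₉ n Tⁿ = 6x²T U + 6x(1 - x)T W + (1 + (1 - 3x) T) / (1 - 4xT²),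
--   U = 1 / (1 - 2T - 8xT²),   W = 1 / (1 - T - 8xT²).
-- With n = 1 + 2j + r and c = (r + j) C j, the coefficient at genus j + 2 is,
-- up to the last fraction, 6 · 8ʲ ((2ʳ - 1) c + 8 c′), where c′ = (r + j - 1) C (j + 1).
-- Comparing consecutive coefficients reduces to the sign of
-- (r + j) (j + 1) - 2 r (r - 1), which changes at j = n / 3, and the remaining
-- terms are negligible for n ≥ 16; smaller n are computed.

open import Data.Bool using (Bool; true; false; if_then_else_; T)
open import Data.Bool.Properties using (T?)
open import Data.Empty using (⊥-elim)
open import Data.Fin using (Fin; zero; suc; _≟_; toℕ)
open import Data.Fin.Patterns using (0F; 1F; 2F; 3F)
open import Data.Fin.Properties using (all?; suc-injective; toℕ-injective; toℕ-fromℕ<; toℕ<n)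
open import Data.Fin.Subset using (Subset)
open import Data.Fin.Subset.Properties using (_∈?_; drop-there)
open import Data.List as List
  using (List; []; _∷_; [_]; _++_; map; concat; length; tabulate; filter; reverse;
         allFin; deduplicate; cartesianProduct)
open import Data.List.Membership.Propositional using (_∈_)
open import Data.List.Membership.Propositional.Properties
  using (∈-map⁻; ∈-lookup; ∈-++⁺ʳ; ∈-concat⁺′; ∈-concat⁻; ∈-allFin)
open import Data.List.Membership.Propositional.Properties.WithK using (unique∧set⇒bag)
open import Data.List.Properties
  using (map-++; map-∘; map-cong; ++-assoc; ++-identityʳ; length-++; length-map; length-tabulate;
         map-tabulate; unfold-reverse; reverse-map; concat-++)
open import Data.List.Relation.Binary.BagAndSetEquality using (∼bag⇒↭)
open import Data.List.Relation.Binary.Permutation.Propositional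
  using (_↭_; ↭-refl; ↭-sym; ↭-trans; ↭-prep; ↭-swap; ↭-reflexive; ↭⇒↭ₛ; module PermutationReasoning)
open import Data.List.Relation.Binary.Permutation.Propositional.Properties
  using (↭-length; ∈-resp-↭; map⁺; ++⁺; ++⁺ˡ; shift; shifts; drop-∷; ++-comm; ++-commutativeMonoid)
import Data.List.Relation.Binary.Permutation.Setoid.Properties as Permutationₛ
open import Data.List.Relation.Unary.All using (All; []; _∷_)
import Data.List.Relation.Unary.All as All
import Data.List.Relation.Unary.All.Properties as All
open import Data.List.Relation.Unary.AllPairs using ([]; _∷_)
import Data.List.Relation.Unary.AllPairs as AllPairs
import Data.List.Relation.Unary.AllPairs.Properties as AllPairs
open import Data.List.Relation.Unary.Any using (Any; here; there)
import Data.List.Relation.Unary.Any as Any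
import Data.List.Relation.Unary.Any.Properties as Any
open import Data.List.Relation.Unary.Unique.Propositional using (Unique)
import Data.List.Relation.Unary.Unique.DecSetoid.Properties as UniqueDec
import Data.List.Relation.Unary.Unique.Propositional.Properties as Unique
open import Data.Maybe using (Maybe; just; nothing; is-just; to-witness-T)
open import Data.Nat
  using (ℕ; zero; suc; pred; _+_; _*_; _∸_; _^_; _/_; _%_; ⌊_/2⌋; _≤_; _<_; z≤n; s≤s; z<s; s<s; s≤s⁻¹;
         NonZero; >-nonZero; >-nonZero⁻¹)
import Data.Nat as ℕ
open import Data.Nat.DivMod using (m≡m%n+[m/n]*n; m%n<n; m/n*n≤m; m<n⇒m%n≡m; n%n≡0)
open import Data.Nat.ListAction using (sum)
open import Data.Nat.ListAction.Properties using (sum-++; sum-↭)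
open import Data.Nat.Properties
  using (_≤?_; _<?_; allUpTo?; +-assoc; +-comm; +-suc; +-identityʳ; +-cancelˡ-≡; +-cancelʳ-≡; +-cancelˡ-≤;
         +-monoˡ-≤; +-monoʳ-≤; +-monoˡ-<; +-monoʳ-<; +-mono-≤-<; *-assoc; *-comm; *-zeroʳ; *-identityˡ;
         *-identityʳ; *-distribˡ-+; *-distribʳ-+; *-cancelˡ-≡; *-cancelʳ-<; *-mono-≤; *-monoˡ-≤; *-monoʳ-≤;
         *-monoˡ-<; *-monoʳ-<; ^-monoˡ-≤; m^n≢0; m*n≢0; m+n≡0⇒m≡0; m+n∸n≡m; m+[n∸m]≡n; m≤m+n; m≤n+m;
         m<m+n; m≤n*m; n<1+n; n≤1+n; pred[n]≤n; n≢0⇒n>0; m<n⇒m<1+n; m≤n⇒m≤1+n; m≤n⇒m<n∨m≡n; ≤-refl;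
         ≤-reflexive; ≤-trans; ≤-antisym; <-trans; <-irrefl; <⇒≤; <⇒≢; <⇒≱; ≮⇒≥; module ≤-Reasoning)
open import Data.Nat.Tactic.RingSolver using (solve-∀)
open import Data.Product using (∃; ∃₂; _×_; _,_; proj₁; proj₂; uncurry)
open import Data.Product.Properties using (≡-dec)
open import Data.Sum using (_⊎_; inj₁; inj₂)
open import Data.Vec using (Vec; []; _∷_; lookup; there; _[_]≔_)
import Data.Vec.Properties as Vec
open import Data.Vec.Properties using (lookup∘update; lookup∘update′; []≔-idempotent; []≔-lookup)
import Algebra.Solver.CommutativeMonoid as CommutativeMonoidSolver
open import Function using (_∘_; _⇔_; mk⇔; Equivalence)
open import Level using (0ℓ)
open import Relation.Binary using (Rel; Decidable; DecidableEquality; DecSetoid)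
open import Relation.Binary.Construct.Closure.Equivalence using (EqClosure)
import Relation.Binary.Construct.Closure.Equivalence as EqC
import Relation.Binary.Construct.Closure.ReflexiveTransitive as Star
import Relation.Binary.Construct.Closure.Symmetric as Sym
import Relation.Binary.Construct.On as On
open import Relation.Binary.PropositionalEquality
  using (_≡_; _≢_; refl; sym; trans; cong; cong₂; subst; subst₂; isEquivalence; setoid; module ≡-Reasoning)
open import Relation.Nullary using (¬_; Dec; yes; no; does; ¬?)
open import Relation.Nullary.Decidable using (from-yes; _→-dec_; _×-dec_; map′)
import Relation.Unary as U
open import Defs

-- Four markers suffice because of the orders in the definition: `R₁` and `R₃` are decreasing, so in
-- the order of increasing index they grow only at their left ends, while `R₂` and `R₄` grow only at
-- their right ends. The obstacle is that gluing is defined on the positions of a finished word, and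
-- these shift with every insertion. Vertices are therefore traced by a relation between tokens,
-- sides and markers; positions enter only when the markers are deleted at the end. A letter adds
-- one edge, so by Euler's formula the number of vertices plus twice the genus grows by one. Its
-- effect depends only on how the arcs join the markers, not on what the arcs contain, which leaves
-- a finite set of states. The transfer matrix can be solved by hand because merging equivalent
-- states leaves 13, and these fall into five blocks in triangular form: two blocks give the
-- denominator of U, two that of W, and the block of the initial state gives 1 - 4xT². As all
-- coefficients are natural numbers, every identity is written with its negative terms moved to the
-- other side.

private variable
  Elem Elem′ : Set
  n : ℕ

-- Vertices as cycles of sides
unique-↭ : {xs ys : List Elem} → xs ↭ ys → Unique xs → Unique ys
unique-↭ xs↭ys = Permutationₛ.Unique-resp-↭ (setoid _) (↭⇒↭ₛ xs↭ys)

lookup-injective : {xs : List Elem} → Unique xs → ∀ {i j} → List.lookup xs i ≡ List.lookup xs j → i ≡ j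
lookup-injective (_ ∷ _)   {zero}  {zero}  _  = refl
lookup-injective (x∉ ∷ _)  {zero}  {suc j} eq = ⊥-elim (All.lookup x∉ (∈-lookup j) eq)
lookup-injective (x∉ ∷ _)  {suc i} {zero}  eq = ⊥-elim (All.lookup x∉ (∈-lookup i) (sym eq))
lookup-injective (_ ∷ !xs) {suc i} {suc j} eq = cong suc (lookup-injective !xs eq)

unique-++⁻ : (xs : List Elem) {ys : List Elem} {x : Elem} → Unique (xs ++ ys) → x ∈ xs → ¬ x ∈ ys
unique-++⁻ (_ ∷ xs) (x∉ ∷ _) (here refl) x∈ys = All.lookup x∉ (∈-++⁺ʳ xs x∈ys) refl
unique-++⁻ (_ ∷ xs) (_ ∷ !)  (there x∈)  x∈ys = unique-++⁻ xs ! x∈ x∈ys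

unique-++⁻ʳ : (xs : List Elem) {ys : List Elem} → Unique (xs ++ ys) → Unique ys
unique-++⁻ʳ []       !       = !
unique-++⁻ʳ (_ ∷ xs) (_ ∷ !) = unique-++⁻ʳ xs !

block-unique : (xss : List (List Elem)) → Unique (concat xss) → ∀ {i j x} →
               x ∈ List.lookup xss i → x ∈ List.lookup xss j → i ≡ j
block-unique (xs ∷ xss) ! {zero}  {zero}  p q = refl
block-unique (xs ∷ xss) ! {zero}  {suc j} p q =
  ⊥-elim (unique-++⁻ xs ! p (∈-concat⁺′ q (∈-lookup {xs = xss} j)))
block-unique (xs ∷ xss) ! {suc i} {zero}  p q =
  ⊥-elim (unique-++⁻ xs ! q (∈-concat⁺′ p (∈-lookup {xs = xss} i)))
block-unique (xs ∷ xss) ! {suc i} {suc j} p q =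
  cong suc (block-unique xss (unique-++⁻ʳ xs !) p q)

-- The labels of the representatives are pairwise distinct by completeness and exhaust `Fin k` by
-- surjectivity, so they are a rearrangement of `allFin k`.
classCount-≡ : ∀ {m k} {R : Rel (Fin m) 0ℓ} (R? : Decidable R) (label : Fin m → Fin k) →
  (∀ l → ∃ λ u → label u ≡ l) →
  (∀ {u v} → R u v → label u ≡ label v) →
  (∀ {u v} → label u ≡ label v → EqClosure R u v) →
  classCount R? ≡ k
classCount-≡ {m} {k} {R} R? label surjective sound complete =
  trans (sym (length-map label reps))
    (trans (↭-length (∼bag⇒↭ (unique∧set⇒bag unique-labels (Unique.allFin⁺ k)
      (mk⇔ (λ _ → ∈-allFin _) (λ _ → all-labels _)))))
    (length-tabulate {n = k} (λ i → i)))
  where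
  decSetoid : DecSetoid 0ℓ 0ℓ
  decSetoid = record { Carrier = Fin m ; _≈_ = EqClosure R ; isDecEquivalence = record
    { isEquivalence = EqC.isEquivalence R ; _≟_ = closure? R? } }

  reps : List (Fin m)
  reps = deduplicate (closure? R?) (allFin m)

  unique-labels : Unique (map label reps)
  unique-labels = AllPairs.map⁺ (AllPairs.map (λ ¬≈ eq → ¬≈ (complete eq))
    (UniqueDec.deduplicate-! decSetoid (allFin m)))

  all-labels : ∀ l → l ∈ map label reps
  all-labels l with surjective l
  ... | u , refl = Any.map⁺ (Any.deduplicate⁺ (closure? R?)
    (λ v≈u eq → trans eq (sym (EqC.fold (On.isEquivalence label isEquivalence) sound v≈u)))
    (Any.map (cong label) (∈-allFin u)))

-- A marker is a place for later insertions.  Tracing a vertex leads from a side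
-- to whatever follows the inverse side, and from a marker to whatever follows
-- the marker itself.
data Token : Set where
  side : Side → Token
  mark : Fin 4 → Token

-- The sides traced from the place after the token p to the token q, where R p q
-- means that q follows p in the cyclic word.
Chain : Rel Token 0ℓ → Token → List Side → Token → Set
Chain R p []      q = R p q
Chain R p (s ∷ A) q = R p (side s) × Chain R (side (inverse s)) A q

-- The first side is kept apart, so that a cycle is never empty: a vertex must have a side starting
-- at it.
Cycle : Set
Cycle = Side × List Side

sides : Cycle → List Side
sides (s , A) = s ∷ A

Cyclic : Rel Token 0ℓ → Cycle → Set
Cyclic R (s , A) = Chain R (side (inverse s)) A (side s)

-- Thus Glued w u v means Follows w (inverse s) t for the labels s, t of u, v.
Follows : Word → Side → Side → Set
Follows w p q = ∃ λ j → List.lookup w j ≡ p × List.lookup w (next j) ≡ q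

module _ {w : Word} (!w : Unique w) {R : Rel Token 0ℓ}
         (follows : ∀ {p q} → R (side p) (side q) → Follows w p q) where

  private
    Step : Rel Side 0ℓ
    -- The membership provides a position of s when a step is traversed backwards.
    Step s t = s ∈ w × Follows w (inverse s) t

    step⇒glued : ∀ {s t} → EqClosure Step s t → ∀ {u v} → List.lookup w u ≡ s → List.lookup w v ≡ t →
                 EqClosure (Glued w) u v
    step⇒glued Star.ε refl eq with lookup-injective !w eq
    ... | refl = EqC.reflexive (Glued w)
    step⇒glued (Sym.fwd (_ , j , j≡ , n≡) Star.◅ s) refl eq =
      Sym.fwd (j , j≡ , refl) Star.◅ step⇒glued s n≡ eq
    step⇒glued (Sym.bwd (s∈ , j , j≡ , n≡) Star.◅ s) refl eq =
      Sym.bwd (j , trans j≡ (cong inverse (Any.lookup-index s∈)) , lookup-injective !w (sym n≡))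
        Star.◅ step⇒glued s (sym (Any.lookup-index s∈)) eq

    chain-connected : ∀ {s} A {q} → s ∈ w → All (_∈ w) A →
      Chain R (side (inverse s)) A (side q) → All (λ t → EqClosure Step t q) (s ∷ A)
    chain-connected []      s∈ []        r       = EqC.return (s∈ , follows r) ∷ []
    chain-connected (a ∷ A) s∈ (a∈ ∷ A∈) (r , c) with chain-connected A a∈ A∈ c
    ... | a≈ ∷ A≈ = (Sym.fwd (s∈ , follows r) Star.◅ a≈) ∷ a≈ ∷ A≈

    chain-head : ∀ {p} A {q} → Chain R (side p) A (side q) → ∃ λ t → t ∈ q ∷ A × Follows w p t
    chain-head []      r       = _ , here refl , follows r
    chain-head (a ∷ A) (r , _) = a , there (here refl) , follows r

    weaken : ∀ {a : Side} {A q t} → t ∈ q ∷ A → t ∈ q ∷ a ∷ A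
    weaken (here eq)  = here eq
    weaken (there t∈) = there (there t∈)

    -- When q is s this says that tracing never leaves a cycle. The endpoint is a separate variable
    -- so that the induction can drop sides from the front of the chain.
    chain-successor : ∀ {s} A {q t} → Chain R (side (inverse s)) A (side q) → t ∈ s ∷ A →
                      ∃ λ t′ → t′ ∈ q ∷ A × Follows w (inverse t) t′
    chain-successor A       c       (here refl) = chain-head A c
    chain-successor (a ∷ A) (_ , c) (there t∈)  with chain-successor A c t∈
    ... | t′ , t′∈ , f = t′ , weaken t′∈ , f

  -- A corner is labelled by the cycle that contains the side starting there. Gluing moves one step
  -- along a cycle and so preserves the label; conversely every side of a cycle is joined to its
  -- head.
  vertexCount-cycles : (cs : List Cycle) → All (Cyclic R) cs → concat (map sides cs) ↭ w →
                       classCount (glued? w) ≡ length cs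
  vertexCount-cycles cs cyclic covers = trans
    (classCount-≡ (glued? w) label surjective sound complete) (length-map sides cs)
    where
    blocks : List (List Side)
    blocks = map sides cs

    cyclic-at : ∀ xs → All (Cyclic R) xs → (i : Fin (length (map sides xs))) → ∃ λ c →
                List.lookup (map sides xs) i ≡ sides c × Cyclic R c
    cyclic-at (c ∷ xs) (p ∷ ps) zero    = c , refl , p
    cyclic-at (c ∷ xs) (p ∷ ps) (suc i) = cyclic-at xs ps i

    located : ∀ u → Any (List.lookup w u ∈_) blocks
    located u = ∈-concat⁻ blocks (∈-resp-↭ (↭-sym covers) (∈-lookup u))

    label : Fin (length w) → Fin (length blocks)
    label u = Any.index (located u)

    in-block : ∀ u → List.lookup w u ∈ List.lookup blocks (label u)
    in-block u = Any.lookup-index (located u)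

    same-block : ∀ {u i s} → List.lookup w u ≡ s → s ∈ List.lookup blocks i → label u ≡ i
    same-block {u} refl s∈ = block-unique blocks (unique-↭ (↭-sym covers) !w) (in-block u) s∈

    block⊆w : ∀ {i s} → s ∈ List.lookup blocks i → s ∈ w
    block⊆w {i} s∈ = ∈-resp-↭ covers (∈-concat⁺′ s∈ (∈-lookup {xs = blocks} i))

    surjective : ∀ l → ∃ λ u → label u ≡ l
    surjective l with cyclic-at cs cyclic l
    ... | (s , A) , eq , _ = Any.index s∈w , same-block (sym (Any.lookup-index s∈w)) s∈
      where
      s∈ : s ∈ List.lookup blocks l
      s∈ = subst (s ∈_) (sym eq) (here refl)
      s∈w : s ∈ w
      s∈w = block⊆w s∈

    sound : ∀ {u v} → Glued w u v → label u ≡ label v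
    sound {u} (j , j≡ , refl) with cyclic-at cs cyclic (label u)
    ... | (s , A) , eq , c with chain-successor A c (subst (List.lookup w u ∈_) eq (in-block u))
    ... | t , t∈ , j′ , j′≡ , n≡ with lookup-injective !w {j} {j′} (trans j≡ (sym j′≡))
    ... | refl = sym (same-block n≡ (subst (t ∈_) (sym eq) t∈))

    complete : ∀ {u v} → label u ≡ label v → EqClosure (Glued w) u v
    complete {u} {v} eq with cyclic-at cs cyclic (label u)
    ... | (s , A) , ≡c , c = step⇒glued
      (EqC.transitive Step (All.lookup connected (subst (_ ∈_) ≡c (in-block u)))
        (EqC.symmetric Step (All.lookup connected
          (subst (_ ∈_) (trans (cong (List.lookup blocks) (sym eq)) ≡c) (in-block v))))) refl refl
      where
      ∈w : All (_∈ w) (s ∷ A)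
      ∈w = All.tabulate λ t∈ → block⊆w (subst (_ ∈_) (sym ≡c) t∈)
      connected : All (λ t → EqClosure Step t s) (s ∷ A)
      connected with ∈w
      ... | s∈ ∷ A∈ = chain-connected A s∈ A∈ c

-- Inserting a pair of sides
open CommutativeMonoidSolver (++-commutativeMonoid {A = Side}) using (solve; _⊕_; _⊜_)

-- Only what follows marker i changes: it is now z, and z inherits the former successor. Stated for
-- abstract relations, the surgery on arcs below can be carried out without knowing the word.
record After (i : Fin 4) (z : Side) (R R′ : Rel Token 0ℓ) : Set where
  field
    keep  : ∀ {p q} → p ≢ mark i → R p q → R′ p q
    enter : R′ (mark i) (side z)
    leave : ∀ {q} → R (mark i) q → R′ (side z) q

  keep-chain : ∀ {p} A {q} → p ≢ mark i → Chain R p A q → Chain R′ p A q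
  keep-chain []      p≢ r       = keep p≢ r
  keep-chain (s ∷ A) p≢ (r , c) = keep p≢ r , keep-chain A (λ ()) c

  leave-chain : ∀ A {q} → Chain R (mark i) A q → Chain R′ (side z) A q
  leave-chain []      r       = leave r
  leave-chain (s ∷ A) (r , c) = leave r , keep-chain A (λ ()) c

-- The mirror image, for blocks that grow at their right end: the marker stays to the right of the
-- new side.
record Before (j : Fin 4) (z : Side) (R R′ : Rel Token 0ℓ) : Set where
  field
    keep  : ∀ {p q} → q ≢ mark j → R p q → R′ p q
    enter : ∀ {p} → R p (mark j) → R′ p (side z)
    leave : R′ (side z) (mark j)

  keep-chain : ∀ {p} A {q} → q ≢ mark j → Chain R p A q → Chain R′ p A q
  keep-chain []      q≢ r       = keep q≢ r
  keep-chain (s ∷ A) q≢ (r , c) = keep (λ ()) r , keep-chain A q≢ c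

  enter-chain : ∀ {p} A → Chain R p A (mark j) → Chain R′ p A (side z)
  enter-chain []      r       = enter r
  enter-chain (s ∷ A) (r , c) = keep (λ ()) r , enter-chain A c

cyclic-after : ∀ {i z R R′} → After i z R R′ → ∀ {c} → Cyclic R c → Cyclic R′ c
cyclic-after a {_ , A} = After.keep-chain a A (λ ())

cyclic-before : ∀ {j z R R′} → Before j z R R′ → ∀ {c} → Cyclic R c → Cyclic R′ c
cyclic-before b {_ , A} = Before.keep-chain b A (λ ())

chain-++ : ∀ {R p} A {s} B {q} → Chain R p A (side s) → Chain R (side (inverse s)) B q →
           Chain R p (A ++ s ∷ B) q
chain-++ []      B r       d = r , d
chain-++ (_ ∷ A) B (r , c) d = r , chain-++ A B c d

-- Concatenations in which one entry is replaced

++-cancelˡ-↭ : ∀ (zs : List Elem) {xs ys} → zs ++ xs ↭ zs ++ ys → xs ↭ ys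
++-cancelˡ-↭ []       p = p
++-cancelˡ-↭ (_ ∷ zs) p = ++-cancelˡ-↭ zs (drop-∷ p)

flat : (Fin n → List Elem) → List Elem
flat f = concat (tabulate f)

flat-cong : {f g : Fin n → List Elem} → (∀ k → f k ≡ g k) → flat f ≡ flat g
flat-cong {n = zero}  eq = refl
flat-cong {n = suc n} eq = cong₂ _++_ (eq zero) (flat-cong (eq ∘ suc))

flat-splice : ∀ {f g : Fin n → List Side} {z} s → g s ↭ z ++ f s → (∀ k → k ≢ s → g k ≡ f k) →
              flat g ↭ z ++ flat f
flat-splice {f = f} {g} {z} zero gs eq = ↭-trans
  (++⁺ gs (↭-reflexive (flat-cong λ k → eq (suc k) λ ())))
  (↭-reflexive (++-assoc z (f zero) _))
flat-splice {f = f} {g} {z} (suc s) gs eq = ↭-trans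
  (++⁺ (↭-reflexive (eq zero λ ()))
    (flat-splice {f = f ∘ suc} {g ∘ suc} s gs λ k k≢ → eq (suc k) (k≢ ∘ suc-injective)))
  (shifts (f zero) z)

flat-extend : ∀ (xs : Vec (List Side) n) i {y z} → y ↭ z ++ lookup xs i →
              flat (lookup (xs [ i ]≔ y)) ↭ z ++ flat (lookup xs)
flat-extend xs i y↭ = flat-splice i (↭-trans (↭-reflexive (lookup∘update i xs _)) y↭)
  λ k k≢ → lookup∘update′ k≢ xs _

-- The old entry stands on the left instead of being removed on the right. Emptying the entry
-- reduces both sides to `flat-extend`.
flat-update : ∀ (xs : Vec (List Side) n) i y →
              lookup xs i ++ flat (lookup (xs [ i ]≔ y)) ↭ y ++ flat (lookup xs)
flat-update xs i y = begin
  lookup xs i ++ flat (lookup (xs [ i ]≔ y))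
    ≡⟨ cong (λ zs → lookup xs i ++ flat (lookup zs)) (sym ([]≔-idempotent xs i)) ⟩
  lookup xs i ++ flat (lookup (xs₀ [ i ]≔ y))
    ↭⟨ ++⁺ˡ (lookup xs i) (flat-extend xs₀ i (nil y)) ⟩
  lookup xs i ++ y ++ flat (lookup xs₀)                   ↭⟨ shifts (lookup xs i) y ⟩
  y ++ lookup xs i ++ flat (lookup xs₀)
    ↭⟨ ++⁺ˡ y (flat-extend xs₀ i (nil (lookup xs i))) ⟨
  y ++ flat (lookup (xs₀ [ i ]≔ lookup xs i))
    ≡⟨ cong (λ zs → y ++ flat (lookup zs)) (trans ([]≔-idempotent xs i) ([]≔-lookup xs i)) ⟩
  y ++ flat (lookup xs) ∎
  where
  open PermutationReasoning
  xs₀ = xs [ i ]≔ []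
  nil : ∀ y → y ↭ y ++ lookup xs₀ i
  nil y = ↭-reflexive (sym (trans (cong (y ++_) (lookup∘update i xs [])) (++-identityʳ y)))

lookup-update-elim : ∀ {A B : Set} (P : Fin n → A → B → Set) xs ys i x y → P i x y →
  (∀ k → k ≢ i → P k (lookup xs k) (lookup ys k)) →
  ∀ k → P k (lookup (xs [ i ]≔ x) k) (lookup (ys [ i ]≔ y) k)
lookup-update-elim P xs ys i x y Pi Pk k with k ≟ i
... | yes refl = subst₂ (P k) (sym (lookup∘update i xs x)) (sym (lookup∘update i ys y)) Pi
... | no  k≢i  = subst₂ (P k) (sym (lookup∘update′ k≢i xs x)) (sym (lookup∘update′ k≢i ys y)) (Pk k k≢i)

-- The component k is the marker at which the arc from the marker k ends.
Targets : Set
Targets = Vec (Fin 4) 4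

-- The inverse permutation. When the first three entries differ from j, a bijection leaves only `3F`
-- as preimage, so the last case is a default.
source : Targets → Fin 4 → Fin 4
source (a ∷ b ∷ c ∷ _) j =
  if does (a ≟ j) then 0F else if does (b ≟ j) then 1F else if does (c ≟ j) then 2F else 3F

record Bijective (t : Targets) : Set where
  constructor bijective
  field
    target-source : ∀ j → lookup t (source t j) ≡ j
    source-target : ∀ k → source t (lookup t k) ≡ k

  target≢ : ∀ {j k} → k ≢ source t j → lookup t k ≢ j
  target≢ k≢ refl = k≢ (sym (source-target _))

-- The vertices cut at the markers; c is the number of those without a marker.
record Tracing (R : Rel Token 0ℓ) (content : List Side) (t : Targets) (c : ℕ) : Set where
  field
    arcs   : Vec (List Side) 4
    arc    : ∀ k → Chain R (mark k) (lookup arcs k) (mark (lookup t k))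
    cycles : List Cycle
    cyclic : All (Cyclic R) cycles
    covers : concat (map sides cycles) ++ flat (lookup arcs) ↭ content
    count  : length cycles ≡ c

  arc-source : Bijective t → ∀ j →
               Chain R (mark (source t j)) (lookup arcs (source t j)) (mark j)
  arc-source bij j = subst (λ l → Chain R (mark k) (lookup arcs k) (mark l))
      (Bijective.target-source bij j) (arc k)
    where k = source t j

swapTargets : Fin 4 → Fin 4 → Targets → Targets
swapTargets i j t = (t [ i ]≔ lookup t j) [ j ]≔ lookup t i

swapSources : Fin 4 → Fin 4 → Targets → Targets
swapSources i j t = (t [ source t i ]≔ j) [ source t j ]≔ i

mark-injective : ∀ {i j} → mark i ≡ mark j → i ≡ j
mark-injective refl = refl

module _ {R R₁ R₂ : Rel Token 0ℓ} {C C₂ : List Side} {t : Targets} {c : ℕ}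
         (T : Tracing R C t c) (bij : Bijective t)
         {z y : Side} (z⁻¹ : inverse z ≡ y) (y⁻¹ : inverse y ≡ z) (C₂↭ : C₂ ↭ z ∷ y ∷ C) where

  open Tracing T hiding (arc-source)
  open PermutationReasoning
  open Bijective bij

  private
    arc-source : ∀ j → Chain R (mark (source t j)) (lookup arcs (source t j)) (mark j)
    arc-source = Tracing.arc-source T bij

    K : List Side
    K = concat (map sides cycles)

    from-z : ∀ R A {q} → Chain R (side y) A q → Chain R (side (inverse z)) A q
    from-z R A = subst (λ p → Chain R (side p) A _) (sym z⁻¹)

    from-y : ∀ R A {q} → Chain R (side z) A q → Chain R (side (inverse y)) A q
    from-y R A = subst (λ p → Chain R (side p) A _) (sym y⁻¹)

    covers-by : ∀ {F} → F ↭ z ∷ y ∷ K ++ flat (lookup arcs) → F ↭ C₂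
    covers-by p = ↭-trans p (↭-trans (↭-prep z (↭-prep y covers)) (↭-sym C₂↭))

  -- The arc from i now reads z and continues with whatever follows y, which is the old arc from j;
  -- symmetrically for j. Hence the two arcs exchange their contents and their ends.
  insert-after-after : ∀ {i j} → i ≢ j → After i z R R₁ → After j y R₁ R₂ →
                       Tracing R₂ C₂ (swapTargets i j t) c
  insert-after-after {i} {j} i≢j ins₁ ins₂ = record
    { arcs   = arcs₂
    ; arc    = lookup-update-elim P arcs₁ (t [ i ]≔ _) j _ _
        (S₂.enter , from-y R₂ Aᵢ (S₂.keep-chain Aᵢ (λ ()) (S₁.leave-chain Aᵢ (arc i))))
        λ k k≢j → lookup-update-elim (λ k A l → k ≢ j → P k A l) arcs t i _ _
          (λ _ → S₂.keep (i≢j ∘ mark-injective) S₁.enter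
               , from-z R₂ Aⱼ (S₂.leave-chain Aⱼ (S₁.keep-chain Aⱼ (i≢j ∘ sym ∘ mark-injective) (arc j))))
          (λ k k≢i k≢j → S₂.keep-chain (lookup arcs k) (k≢j ∘ mark-injective)
            (S₁.keep-chain (lookup arcs k) (k≢i ∘ mark-injective) (arc k))) k k≢j
    ; cycles = cycles
    ; cyclic = All.map (λ {c} → cyclic-after ins₂ {c} ∘ cyclic-after ins₁ {c}) cyclic
    ; covers = covers-by (↭-trans (++⁺ˡ K flat₂) (shifts K (z ∷ y ∷ [])))
    ; count  = count }
    where
    module S₁ = After ins₁
    module S₂ = After ins₂
    Aᵢ    = lookup arcs i
    Aⱼ    = lookup arcs j
    arcs₁ = arcs  [ i ]≔ (z ∷ Aⱼ)
    arcs₂ = arcs₁ [ j ]≔ (y ∷ Aᵢ)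

    P : Fin 4 → List Side → Fin 4 → Set
    P k A l = Chain R₂ (mark k) A (mark l)

    flat₂ : flat (lookup arcs₂) ↭ z ∷ y ∷ flat (lookup arcs)
    flat₂ = ++-cancelˡ-↭ Aⱼ (begin
      Aⱼ ++ flat (lookup arcs₂)
        ≡⟨ cong (_++ flat (lookup arcs₂)) (sym (lookup∘update′ (i≢j ∘ sym) arcs _)) ⟩
      lookup arcs₁ j ++ flat (lookup arcs₂)    ↭⟨ flat-update arcs₁ j _ ⟩
      y ∷ Aᵢ ++ flat (lookup arcs₁)            ↭⟨ ↭-prep y (flat-update arcs i _) ⟩
      y ∷ z ∷ Aⱼ ++ flat (lookup arcs)         ↭⟨ ↭-swap y z ↭-refl ⟩
      z ∷ y ∷ Aⱼ ++ flat (lookup arcs)         ↭⟨ shifts (z ∷ y ∷ []) Aⱼ ⟩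
      Aⱼ ++ z ∷ y ∷ flat (lookup arcs)         ∎)

  -- The arc that ended at i now meets z, and after z comes what follows y, namely marker j. Hence
  -- the two arcs keep their contents but exchange their ends.
  insert-before-before : ∀ {i j} → i ≢ j → Before i z R R₁ → Before j y R₁ R₂ →
                         Tracing R₂ C₂ (swapSources i j t) c
  insert-before-before {i} {j} i≢j ins₁ ins₂ = record
    { arcs   = arcs₂
    ; arc    = lookup-update-elim P arcs₁ (t [ s ]≔ _) s′ _ _
        (chain-++ A′ [] (S₂.enter-chain A′ (S₁.keep-chain A′ (i≢j ∘ sym ∘ mark-injective) (arc-source j)))
          (from-y R₂ [] (S₂.keep (i≢j ∘ mark-injective) S₁.leave)))
        λ k k≢s′ → lookup-update-elim (λ k A l → k ≢ s′ → P k A l) arcs t s _ _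
          (λ _ → chain-++ A [] (S₂.keep-chain A (λ ()) (S₁.enter-chain A (arc-source i)))
            (from-z R₂ [] S₂.leave))
          (λ k k≢s k≢s′ → S₂.keep-chain (lookup arcs k) (target≢ k≢s′ ∘ mark-injective)
            (S₁.keep-chain (lookup arcs k) (target≢ k≢s ∘ mark-injective) (arc k))) k k≢s′
    ; cycles = cycles
    ; cyclic = All.map (λ {c} → cyclic-before ins₂ {c} ∘ cyclic-before ins₁ {c}) cyclic
    ; covers = covers-by (↭-trans (++⁺ˡ K flat₂) (shifts K (z ∷ y ∷ [])))
    ; count  = count }
    where
    module S₁ = Before ins₁
    module S₂ = Before ins₂
    s     = source t i
    s′    = source t j
    A     = lookup arcs s
    A′    = lookup arcs s′
    arcs₁ = arcs  [ s ]≔ (A ++ [ z ])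
    arcs₂ = arcs₁ [ s′ ]≔ (A′ ++ [ y ])

    P : Fin 4 → List Side → Fin 4 → Set
    P k A l = Chain R₂ (mark k) A (mark l)

    s′≢s : s′ ≢ s
    s′≢s eq = i≢j (trans (sym (target-source i)) (trans (cong (lookup t) (sym eq)) (target-source j)))

    flat₂ : flat (lookup arcs₂) ↭ z ∷ y ∷ flat (lookup arcs)
    flat₂ = begin
      flat (lookup arcs₂)
        ↭⟨ flat-extend arcs₁ s′ (↭-trans (++-comm A′ [ y ])
             (↭-reflexive (cong (y ∷_) (sym (lookup∘update′ s′≢s arcs _))))) ⟩
      y ∷ flat (lookup arcs₁)      ↭⟨ ↭-prep y (flat-extend arcs s (++-comm A [ z ])) ⟩
      y ∷ z ∷ flat (lookup arcs)   ↭⟨ ↭-swap y z ↭-refl ⟩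
      z ∷ y ∷ flat (lookup arcs)   ∎

  module _ {i j} (ins₁ : After i z R R₁) (ins₂ : Before j y R₁ R₂) where

    private
      module S₁ = After ins₁
      module S₂ = Before ins₂
      s  = source t j
      Aᵢ = lookup arcs i

      P : Fin 4 → List Side → Fin 4 → Set
      P k A l = Chain R₂ (mark k) A (mark l)

      new-arc : P i [ z ] j
      new-arc = S₂.keep (λ ()) S₁.enter , from-z R₂ [] S₂.leave

      other-arc : ∀ k → k ≢ i → k ≢ s → P k (lookup arcs k) (lookup t k)
      other-arc k k≢i k≢s = S₂.keep-chain (lookup arcs k) (target≢ k≢s ∘ mark-injective)
        (S₁.keep-chain (lookup arcs k) (k≢i ∘ mark-injective) (arc k))

      cyclic₂ : All (Cyclic R₂) cycles
      cyclic₂ = All.map (λ {c} → cyclic-before ins₂ {c} ∘ cyclic-after ins₁ {c}) cyclic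

    -- The old arc from i ran to j. It now runs into y, after which comes its own beginning, so it
    -- closes up to a vertex without markers; z alone forms the new arc from i to j.
    insert-across-closed : s ≡ i → Tracing R₂ C₂ t (suc c)
    insert-across-closed s≡i = record
      { arcs   = arcs₁
      ; arc    = λ k → subst (P k (lookup arcs₁ k)) (unchanged k)
          (lookup-update-elim P arcs t i _ _ new-arc (λ k k≢i → other-arc k k≢i (k≢i ∘ λ k≡s → trans k≡s s≡i)) k)
      ; cycles = (y , Aᵢ) ∷ cycles
      ; cyclic = from-y R₂ Aᵢ (S₂.enter-chain Aᵢ (S₁.leave-chain Aᵢ
          (subst (λ l → Chain R (mark i) Aᵢ (mark l)) tᵢ≡j (arc i))))
          ∷ cyclic₂
      ; covers = covers-by (begin
          y ∷ (Aᵢ ++ K) ++ flat (lookup arcs₁)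
            ↭⟨ solve 4 (λ y a k f → y ⊕ ((a ⊕ k) ⊕ f) ⊜ y ⊕ (k ⊕ (a ⊕ f))) ↭-refl
                 [ y ] Aᵢ K (flat (lookup arcs₁)) ⟩
          y ∷ K ++ Aᵢ ++ flat (lookup arcs₁)   ↭⟨ ↭-prep y (++⁺ˡ K (flat-update arcs i [ z ])) ⟩
          y ∷ K ++ z ∷ flat (lookup arcs)      ↭⟨ ↭-prep y (shift z K _) ⟩
          y ∷ z ∷ K ++ flat (lookup arcs)      ↭⟨ ↭-swap y z ↭-refl ⟩
          z ∷ y ∷ K ++ flat (lookup arcs)      ∎)
      ; count  = cong suc count }
      where
      arcs₁ = arcs [ i ]≔ [ z ]

      tᵢ≡j : lookup t i ≡ j
      tᵢ≡j = trans (cong (lookup t) (sym s≡i)) (target-source j)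

      unchanged : ∀ k → lookup (t [ i ]≔ j) k ≡ lookup t k
      unchanged k = cong (λ u → lookup u k) (trans (cong (t [ i ]≔_) (sym tᵢ≡j)) ([]≔-lookup t i))

    -- The arc into j runs into y and continues along the old arc from i, which is replaced by the
    -- one-sided arc z to j.
    insert-across-open : s ≢ i → Tracing R₂ C₂ ((t [ s ]≔ lookup t i) [ i ]≔ j) c
    insert-across-open s≢i = record
      { arcs   = arcs₂
      ; arc    = lookup-update-elim P arcs₁ (t [ s ]≔ _) i _ _ new-arc
          λ k k≢i → lookup-update-elim (λ k A l → k ≢ i → P k A l) arcs t s _ _
            (λ s≢i → chain-++ A Aᵢ (S₂.enter-chain A (S₁.keep-chain A (s≢i ∘ mark-injective) (arc-source j)))
              (from-y R₂ Aᵢ (S₂.keep-chain Aᵢ (target≢ (s≢i ∘ sym) ∘ mark-injective)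
                (S₁.leave-chain Aᵢ (arc i)))))
            (λ k k≢s k≢i → other-arc k k≢i k≢s) k k≢i
      ; cycles = cycles
      ; cyclic = cyclic₂
      ; covers = covers-by (↭-trans (++⁺ˡ K flat₂) (shifts K (z ∷ y ∷ [])))
      ; count  = count }
      where
      A     = lookup arcs s
      arcs₁ = arcs  [ s ]≔ (A ++ y ∷ Aᵢ)
      arcs₂ = arcs₁ [ i ]≔ [ z ]

      flat₂ : flat (lookup arcs₂) ↭ z ∷ y ∷ flat (lookup arcs)
      flat₂ = ++-cancelˡ-↭ Aᵢ (begin
        Aᵢ ++ flat (lookup arcs₂)
          ≡⟨ cong (_++ flat (lookup arcs₂)) (sym (lookup∘update′ (s≢i ∘ sym) arcs _)) ⟩
        lookup arcs₁ i ++ flat (lookup arcs₂)    ↭⟨ flat-update arcs₁ i _ ⟩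
        z ∷ flat (lookup arcs₁)                  ↭⟨ ↭-prep z (flat-extend arcs s (++-comm A (y ∷ Aᵢ))) ⟩
        z ∷ y ∷ Aᵢ ++ flat (lookup arcs)         ↭⟨ shifts (z ∷ y ∷ []) Aᵢ ⟩
        Aᵢ ++ z ∷ y ∷ flat (lookup arcs)         ∎)

-- Segments and markers
data Head {X : Set} : List X → X → Set where
  head : ∀ {x xs} → Head (x ∷ xs) x

data Neighbours {X : Set} : List X → X → X → Set where
  here  : ∀ {x xs y} → Head xs y → Neighbours (x ∷ xs) x y
  there : ∀ {x xs p q} → Neighbours xs p q → Neighbours (x ∷ xs) p q

-- The first token is arbitrary, so that what remains after passing a side is again a stretch.
stretch : Token → List Side → Fin 4 → List Token
stretch p xs l = p ∷ map side xs ++ [ mark l ]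

stretch-target : ∀ {p xs l s j} → Neighbours (stretch p xs l) s (mark j) → j ≡ l
stretch-target {xs = []}     (here head) = refl
stretch-target {xs = []}     (there (here ()))
stretch-target {xs = _ ∷ xs} (here ())
stretch-target {xs = x ∷ xs} (there nb)  = stretch-target {side x} {xs} nb

stretch-source : ∀ {p xs l i t} → Neighbours (stretch p xs l) (mark i) t →
                 p ≡ mark i × Head (map side xs ++ [ mark l ]) t
stretch-source {xs = []}     (here h)   = refl , h
stretch-source {xs = []}     (there (here ()))
stretch-source {xs = _ ∷ xs} (here h)   = refl , h
stretch-source {xs = x ∷ xs} (there nb) with stretch-source {side x} {xs} nb
... | () , _

stretch-snoc-keep : ∀ {p} xs {l z s t} → t ≢ mark l → Neighbours (stretch p xs l) s t →
                    Neighbours (stretch p (xs ++ [ z ]) l) s t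
stretch-snoc-keep []       t≢ (here head)       = ⊥-elim (t≢ refl)
stretch-snoc-keep []       t≢ (there (here ()))
stretch-snoc-keep (x ∷ xs) t≢ (here head)       = here head
stretch-snoc-keep (x ∷ xs) t≢ (there nb)        = there (stretch-snoc-keep xs t≢ nb)

stretch-snoc-enter : ∀ {p} xs {l z s} → Neighbours (stretch p xs l) s (mark l) →
                     Neighbours (stretch p (xs ++ [ z ]) l) s (side z)
stretch-snoc-enter []       (here head)       = here head
stretch-snoc-enter []       (there (here ()))
stretch-snoc-enter (x ∷ xs) (there nb)        = there (stretch-snoc-enter xs nb)

stretch-snoc-leave : ∀ {p} xs {l z} → Neighbours (stretch p (xs ++ [ z ]) l) (side z) (mark l)
stretch-snoc-leave []       = there (here head)
stretch-snoc-leave (x ∷ xs) = there (stretch-snoc-leave xs)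

-- The cyclic word mark 0, segment 0, mark 1, segment 1, mark 2, segment 2,
-- mark 3, segment 3.
Segments : Set
Segments = Vec (List Side) 4

segment : Segments → Fin 4 → List Token
segment σ k = stretch (mark k) (lookup σ k) (next k)

Adjacent : Segments → Rel Token 0ℓ
Adjacent σ p q = ∃ λ k → Neighbours (segment σ k) p q

next-injective : ∀ (i k : Fin 4) → next i ≡ next k → i ≡ k
next-injective = from-yes (all? {n = 4} λ i → all? {n = 4} λ k → (next i ≟ next k) →-dec (i ≟ k))

private
  replaced : ∀ σ i y {p q} → Neighbours (stretch (mark i) y (next i)) p q → Adjacent (σ [ i ]≔ y) p q
  replaced σ i y {p} {q} nb = i , subst (λ xs → Neighbours (stretch (mark i) xs (next i)) p q)
    (sym (lookup∘update i σ y)) nb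

  untouched : ∀ σ i y {k p q} → k ≢ i → Neighbours (segment σ k) p q → Adjacent (σ [ i ]≔ y) p q
  untouched σ i y {k} {p} {q} k≢i nb = k , subst (λ xs → Neighbours (stretch (mark k) xs (next k)) p q)
    (sym (lookup∘update′ k≢i σ y)) nb

prepend append : Fin 4 → Side → Segments → Segments
prepend i z σ = σ [ i ]≔ (z ∷ lookup σ i)
append  i z σ = σ [ i ]≔ (lookup σ i ++ [ z ])

prepend-after : ∀ i z σ → After i z (Adjacent σ) (Adjacent (prepend i z σ))
prepend-after i z σ = record
  { keep  = λ p≢ (k , nb) → keep p≢ k nb
  ; enter = replaced σ i _ (here head)
  ; leave = λ (k , nb) → leave k nb }
  where
  keep : ∀ {p q} → p ≢ mark i → ∀ k → Neighbours (segment σ k) p q → Adjacent (prepend i z σ) p q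
  keep p≢ k nb with k ≟ i
  ... | no k≢i = untouched σ i _ k≢i nb
  keep p≢ k (here h)   | yes refl = ⊥-elim (p≢ refl)
  keep p≢ k (there nb) | yes refl = replaced σ i _ (there (there nb))

  leave : ∀ {q} k → Neighbours (segment σ k) (mark i) q → Adjacent (prepend i z σ) (side z) q
  leave k nb with stretch-source {xs = lookup σ k} nb
  ... | refl , h = replaced σ i _ (there (here h))

append-before : ∀ i z σ → Before (next i) z (Adjacent σ) (Adjacent (append i z σ))
append-before i z σ = record
  { keep  = λ q≢ (k , nb) → keep q≢ k nb
  ; enter = λ (k , nb) → enter k nb
  ; leave = replaced σ i _ (stretch-snoc-leave (lookup σ i)) }
  where
  keep : ∀ {p q} → q ≢ mark (next i) → ∀ k → Neighbours (segment σ k) p q → Adjacent (append i z σ) p q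
  keep q≢ k nb with k ≟ i
  ... | no k≢i   = untouched σ i _ k≢i nb
  ... | yes refl = replaced σ i _ (stretch-snoc-keep (lookup σ i) q≢ nb)

  enter : ∀ {p} k → Neighbours (segment σ k) p (mark (next i)) → Adjacent (append i z σ) p (side z)
  enter k nb with next-injective i k (stretch-target {xs = lookup σ k} nb)
  ... | refl = replaced σ i _ (stretch-snoc-enter (lookup σ i) nb)

-- Deleting the markers and closing the arcs

-- R once the markers are deleted from the word.
data Pass (R : Rel Token 0ℓ) : Rel Token 0ℓ where
  direct  : ∀ {p q} → R p q → Pass R p q
  through : ∀ {p q} k → Pass R p (mark k) → Pass R (mark k) q → Pass R p q

pass-chain : ∀ {R p} A {q} → Chain R p A q → Chain (Pass R) p A q
pass-chain []      r       = direct r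
pass-chain (_ ∷ A) (r , c) = direct r , pass-chain A c

private
  through-chain : ∀ {R p k} B {q} → Pass R p (mark k) → Chain (Pass R) (mark k) B q → Chain (Pass R) p B q
  through-chain []      r r′       = through _ r r′
  through-chain (_ ∷ B) r (r′ , c) = through _ r r′ , c

join-chain : ∀ {R p k} A B {q} → Chain (Pass R) p A (mark k) → Chain (Pass R) (mark k) B q →
             Chain (Pass R) p (A ++ B) q
join-chain []      B r       d = through-chain B r d
join-chain (_ ∷ A) B (r , c) d = r , join-chain A B c d

end-chain : ∀ {R p k} A {q} → Chain (Pass R) p A (mark k) → Pass R (mark k) q → Chain (Pass R) p A q
end-chain []      r       r′ = through _ r r′
end-chain (_ ∷ A) (r , c) r′ = r , end-chain A c r′

-- Deletes zero from its orbit under a permutation, by redirecting to d.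
route : Fin (suc n) → Fin n → Fin n
route zero    d = d
route (suc j) d = j

-- A fixed point completes an orbit; any other point is bypassed, which leaves the number of orbits
-- unchanged. In the first case the default i only makes the map total: a permutation fixing zero
-- sends no other point there. The recursion is shaped to run parallel to `close`.
orbitCount : (Fin n → Fin n) → ℕ
orbitCount {zero}  t = 0
orbitCount {suc n} t with t zero
... | zero  = suc (orbitCount λ i → route (t (suc i)) i)
... | suc d = orbitCount λ i → route (t (suc i)) d

private
  route-inverse : ∀ {t s : Fin (suc n) → Fin (suc n)} {d e} → t zero ≡ suc d → s zero ≡ suc e →
    (∀ j → t (s j) ≡ j) → ∀ j → route (t (suc (route (s (suc j)) e))) d ≡ j
  route-inverse {t = t} {s} {d} {e} t₀ s₀ ts j with s (suc j) in sj
  ... | suc i = cong (λ x → route x d) (trans (cong t (sym sj)) (ts (suc j)))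
  ... | zero  = trans (cong (λ x → route x d) (trans (cong t (sym s₀)) (ts zero)))
                  (suc-injective (trans (sym t₀) (trans (cong t (sym sj)) (ts (suc j)))))

  route-inverse₀ : ∀ {t s : Fin (suc n) → Fin (suc n)} → t zero ≡ zero →
    (∀ j → t (s j) ≡ j) → ∀ j → route (t (suc (route (s (suc j)) j))) (route (s (suc j)) j) ≡ j
  route-inverse₀ {t = t} {s} t₀ ts j with s (suc j) in sj
  ... | suc i = cong (λ x → route x i) (trans (cong t (sym sj)) (ts (suc j)))
  ... | zero with trans (sym t₀) (trans (cong t (sym sj)) (ts (suc j)))
  ... | ()

module _ {R : Rel Token 0ℓ} (no-loop : ∀ {k} → ¬ Pass R (mark k) (mark k)) where

  -- An arc that returns to its own marker becomes a cycle; any other arc is appended to the one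
  -- that ends where it starts, found by means of the inverse s. `name` remembers the original
  -- markers while the indices shrink. An empty returning arc would be a vertex without sides, which
  -- `no-loop` excludes.
  close : ∀ (name : Fin n → Fin 4) (t s : Fin n → Fin n) →
    (∀ j → t (s j) ≡ j) → (∀ j → s (t j) ≡ j) → (A : Vec (List Side) n) →
    (∀ k → Chain (Pass R) (mark (name k)) (lookup A k) (mark (name (t k)))) →
    ∃ λ cs → length cs ≡ orbitCount t × All (Cyclic (Pass R)) cs ×
             concat (map sides cs) ↭ flat (lookup A)
  close {zero}  name t s ts st []      arc = [] , refl , [] , ↭-refl
  close {suc n} name t s ts st (A ∷ As) arc with t zero in t₀
  ... | zero with close (name ∘ suc) (λ i → route (t (suc i)) i) (λ i → route (s (suc i)) i)
                    (route-inverse₀ {t = t} {s} t₀ ts) (route-inverse₀ {t = s} {t} s₀ st) As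
                    (λ k → subst (λ l → Chain (Pass R) (mark (name (suc k))) (lookup As k) (mark (name l)))
                      (stays k) (arc (suc k)))
    where
    s₀ : s zero ≡ zero
    s₀ = trans (cong s (sym t₀)) (st zero)

    stays : ∀ k → t (suc k) ≡ suc (route (t (suc k)) k)
    stays k with t (suc k) in tk
    ... | suc _ = refl
    ... | zero with trans (sym (st (suc k))) (trans (cong s tk) s₀)
    ... | ()
  ... | cs , len , cyc , cov
    with A | subst (λ l → Chain (Pass R) (mark (name zero)) A (mark (name l))) t₀ (arc zero)
  ...   | []     | c     = ⊥-elim (no-loop c)
  ...   | a ∷ A′ | r , c = (a , A′) ∷ cs , cong suc len , end-chain A′ c r ∷ cyc , ++⁺ˡ (a ∷ A′) cov
  close {suc n} name t s ts st (A ∷ As) arc | suc d with s zero in s₀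
  ... | zero with trans (sym (ts zero)) (trans (cong t s₀) t₀)
  ... | ()
  close {suc n} name t s ts st (A ∷ As) arc | suc d | suc e
    with close (name ∘ suc) (λ i → route (t (suc i)) d) (λ i → route (s (suc i)) e)
           (route-inverse {t = t} {s} t₀ s₀ ts) (route-inverse {t = s} {t} s₀ t₀ st)
           (As [ e ]≔ (lookup As e ++ A)) arc′
    where
    t-e : t (suc e) ≡ zero
    t-e = trans (cong t (sym s₀)) (ts zero)

    leaves : ∀ k → k ≢ e → t (suc k) ≡ suc (route (t (suc k)) d)
    leaves k k≢e with t (suc k) in tk
    ... | suc _ = refl
    ... | zero  = ⊥-elim (k≢e (suc-injective (trans (sym (st (suc k))) (trans (cong s tk) s₀))))

    arc′ : ∀ k → Chain (Pass R) (mark (name (suc k))) (lookup (As [ e ]≔ (lookup As e ++ A)) k)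
                   (mark (name (suc (route (t (suc k)) d))))
    arc′ k with k ≟ e
    ... | no k≢e = subst₂ (λ xs l → Chain (Pass R) (mark (name (suc k))) xs (mark (name l)))
      (sym (lookup∘update′ k≢e As _)) (leaves k k≢e) (arc (suc k))
    ... | yes refl = subst₂ (λ xs l → Chain (Pass R) (mark (name (suc k))) xs (mark (name l)))
      (sym (lookup∘update k As _)) (trans t₀ (cong (λ l → suc (route l d)) (sym t-e)))
      (join-chain (lookup As k) A
        (subst (λ l → Chain (Pass R) (mark (name (suc k))) (lookup As k) (mark (name l))) t-e (arc (suc k)))
        (arc zero))
  ... | cs , len , cyc , cov =
    cs , len , cyc , ↭-trans cov (flat-extend As e (++-comm (lookup As e) A))

-- Positions in the cyclic word
toℕ-next : ∀ {m} .{{_ : NonZero m}} (i : Fin m) → toℕ (next i) ≡ suc (toℕ i) % m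
toℕ-next {suc m} i = toℕ-fromℕ< (m%n<n (suc (toℕ i)) (suc m))

lookup-middle : ∀ {w : Word} pre {x post} → w ≡ pre ++ x ∷ post →
                ∃ λ j → List.lookup w j ≡ x × toℕ j ≡ length pre
lookup-middle []        refl = zero , refl , refl
lookup-middle (_ ∷ pre) refl with lookup-middle pre refl
... | j , l , eq = suc j , l , cong suc eq

module Positions (w : Word) .{{_ : NonZero (length w)}} (start : Fin 4 → ℕ) where

  -- The position just after a token and the position at which it begins. A marker has width zero,
  -- so both agree for it, and passing through any number of markers does not change the position.
  Exit Entry : Token → ℕ → Set
  Exit  (side s) x = ∃ λ j → List.lookup w j ≡ s × x ≡ suc (toℕ j) % length w
  Exit  (mark k) x = x ≡ start k
  Entry (side s) x = ∃ λ j → List.lookup w j ≡ s × x ≡ toℕ j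
  Entry (mark k) x = x ≡ start k

  Meet : Rel Token 0ℓ
  Meet p q = ∃ λ x → Exit p x × Entry q x

  stretch-meet : ∀ pre xs {post p l} → w ≡ pre ++ xs ++ post → Exit p (length pre % length w) →
    start l ≡ length (pre ++ xs) % length w → ∀ {s t} → Neighbours (stretch p xs l) s t → Meet s t
  stretch-meet pre [] eq e ≡l (here head) =
    _ , e , trans (cong (λ ys → length ys % length w) (sym (++-identityʳ pre))) (sym ≡l)
  stretch-meet pre [] eq e ≡l (there (here ()))
  stretch-meet pre (x ∷ xs) {post} eq e ≡l nb with lookup-middle pre eq | nb
  ... | j , lj , ≡pre | here head = _ , e , j , lj ,
    trans (cong (_% length w) (sym ≡pre)) (m<n⇒m%n≡m (toℕ<n j))
  ... | j , lj , ≡pre | there nb′ = stretch-meet (pre ++ [ x ]) xs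
    (trans eq (sym (++-assoc pre [ x ] (xs ++ post))))
    (j , lj , cong (_% length w) (trans (length-++ pre) (trans (+-suc (length pre) 0)
      (cong suc (trans (+-identityʳ _) (sym ≡pre))))))
    (trans ≡l (cong (λ ys → length ys % length w) (sym (++-assoc pre [ x ] xs)))) nb′

  pass-meet : ∀ {R} → (∀ {p q} → R p q → Meet p q) → ∀ {p q} → Pass R p q → Meet p q
  pass-meet m (direct r)      = m r
  pass-meet m (through k r s) with pass-meet m r | pass-meet m s
  ... | x , e , refl | y , refl , e′ = x , e , e′

  meet⇒follows : ∀ {p q} → Meet (side p) (side q) → Follows w p q
  meet⇒follows (x , (j , j≡ , x≡) , (k , k≡ , x≡′)) = j , j≡ ,
    trans (cong (List.lookup w) (toℕ-injective (trans (toℕ-next j) (trans (sym x≡) x≡′)))) k≡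

pass⇒follows : ∀ {w} σ → .{{_ : NonZero (length w)}} → flat (lookup σ) ≡ w →
               ∀ {p q} → Pass (Adjacent σ) (side p) (side q) → Follows w p q
pass⇒follows {w} σ@(A ∷ B ∷ C ∷ D ∷ []) refl = meet⇒follows ∘ pass-meet λ where
    (0F , nb) → stretch-meet []             A refl (zero%n (length w)) refl nb
    (1F , nb) → stretch-meet A              B refl refl refl nb
    (2F , nb) → stretch-meet (A ++ B)       C {D ++ []} (sym (++-assoc A B _)) refl refl nb
    (3F , nb) → stretch-meet ((A ++ B) ++ C) D {[]} all refl
      -- The last segment ends at `length w`, which is position 0 of the first marker modulo the
      -- length.
      (trans (sym (n%n≡0 (length w))) (cong (λ ys → length ys % length w)
        (trans all (cong (((A ++ B) ++ C) ++_) (++-identityʳ D))))) nb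
  where
  offset : Fin 4 → ℕ
  offset 0F = 0
  offset 1F = length A % length w
  offset 2F = length (A ++ B) % length w
  offset 3F = length ((A ++ B) ++ C) % length w

  open Positions w offset

  all : w ≡ ((A ++ B) ++ C) ++ D ++ []
  all = trans (sym (++-assoc A B _)) (sym (++-assoc (A ++ B) C _))

  zero%n : ∀ n .{{_ : NonZero n}} → 0 % n ≡ 0
  zero%n (suc n) = refl

-- Two markers are adjacent only across an empty segment. Since segment 3 contains a side, no
-- passage wraps around from marker 3 to marker 0, and the indices of the markers passed increase
-- strictly.
no-loop : ∀ σ {s D} → lookup σ 3F ≡ s ∷ D → ∀ {k} → ¬ Pass (Adjacent σ) (mark k) (mark k)
no-loop σ {s} {D} σ₃ loop = <-irrefl refl (ascending loop)
  where
  step : ∀ k {i j} → Neighbours (segment σ k) (mark i) (mark j) → toℕ i < toℕ j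
  step k nb with lookup σ k in σk | stretch-source {xs = lookup σ k} nb
  step 0F nb | []    | refl , head = z<s
  step 1F nb | []    | refl , head = s<s z<s
  step 2F nb | []    | refl , head = s<s (s<s z<s)
  step 3F nb | []    | refl , head with trans (sym σk) σ₃
  ... | ()
  step k  nb | _ ∷ _ | refl , ()

  ascending : ∀ {i j} → Pass (Adjacent σ) (mark i) (mark j) → toℕ i < toℕ j
  ascending (direct (k , nb)) = step k nb
  ascending (through k r r′)  = <-trans (ascending r) (ascending r′)

-- Genus of a ladder word
bijective? : ∀ t → Dec (Bijective t)
bijective? t = map′ (uncurry bijective) (λ b → Bijective.target-source b , Bijective.source-target b)
  (all? (λ j → lookup t (source t j) ≟ j) ×-dec all? (λ k → source t (lookup t k) ≟ k))

-- The second component is the number of vertices that lose their last marker.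
across : Fin 4 → Fin 4 → Targets → Targets × ℕ
across i j t = if does (source t j ≟ i)
  then (t , 1)
  else ((t [ source t j ]≔ lookup t i) [ i ]≔ j , 0)

-- The side of a letter in K goes after marker 0, otherwise before marker 2; the inverse side goes
-- after marker 1 if the letter is in T, otherwise before marker 3.
move : Bool → Bool → Targets → Targets × ℕ
move true  true  t = swapTargets 0F 1F t , 0
move true  false t = across 0F 3F t
move false true  t = across 1F 2F t
move false false t = swapSources 2F 3F t , 0

after : Bool → Bool → Targets → Targets
after b e t = proj₁ (move b e t)

orbits : Targets → ℕ
orbits t = orbitCount (lookup t)

-- Half of what the vertices fall short of gaining one. That truncation and rounding lose nothing is
-- part of `ValidMoves`.
rise : Bool → Bool → Targets → ℕ
rise b e t = ⌊ (orbits t + 1) ∸ (proj₂ (move b e t) + orbits (after b e t)) /2⌋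

all-targets : {P : Targets → Set} → (∀ a b c d → P (a ∷ b ∷ c ∷ d ∷ [])) → ∀ t → P t
all-targets f (a ∷ b ∷ c ∷ d ∷ []) = f a b c d

all-targets? : {P : Targets → Set} → U.Decidable P → Dec (∀ t → P t)
all-targets? P? = map′ all-targets (λ f a b c d → f _)
  (all? λ a → all? λ b → all? λ c → all? λ d → P? (a ∷ b ∷ c ∷ d ∷ []))

all-choices? : {P : Bool → Bool → Set} → (∀ b e → Dec (P b e)) → Dec (∀ b e → P b e)
all-choices? {P} P? = map′ from (λ f → (f true true , f true false) , (f false true , f false false))
  ((P? true true ×-dec P? true false) ×-dec (P? false true ×-dec P? false false))
  where
  from : ((P true true × P true false) × (P false true × P false false)) → ∀ b e → P b e
  from ((p , q) , (r , s)) true  true  = p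
  from ((p , q) , (r , s)) true  false = q
  from ((p , q) , (r , s)) false true  = r
  from ((p , q) , (r , s)) false false = s

ValidMoves : Targets → Set
ValidMoves t = Bijective t → ∀ b e → Bijective (after b e t) ×
  (orbits t + 1 ≡ proj₂ (move b e t) + orbits (after b e t) + 2 * rise b e t)

validMoves? : U.Decidable ValidMoves
validMoves? t = bijective? t →-dec all-choices? λ b e → bijective? (after b e t) ×-dec
  ((orbits t + 1) ℕ.≟ (proj₂ (move b e t) + orbits (after b e t) + 2 * rise b e t))

abstract
  validMoves : ∀ t → ValidMoves t
  validMoves = from-yes (all-targets? validMoves?)

-- With b the new letter belongs to K, with e to T.
advance : Bool → Bool → Letter → Segments → Segments
advance true  true  x σ = prepend 1F (x ⁻) (prepend 0F (x ⁺) σ)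
advance true  false x σ = append  2F (x ⁻) (prepend 0F (x ⁺) σ)
advance false true  x σ = append  1F (x ⁺) (prepend 1F (x ⁻) σ)
advance false false x σ = append  2F (x ⁻) (append  1F (x ⁺) σ)

Traced : Segments → Targets → ℕ → Set
Traced σ = Tracing (Adjacent σ) (flat (lookup σ))

flat-prepend : ∀ i z σ → flat (lookup (prepend i z σ)) ↭ z ∷ flat (lookup σ)
flat-prepend i z σ = flat-extend σ i ↭-refl

flat-append : ∀ i z σ → flat (lookup (append i z σ)) ↭ z ∷ flat (lookup σ)
flat-append i z σ = flat-extend σ i (++-comm (lookup σ i) [ z ])

across-traced : ∀ σ σ₂ {R₁ t c z y i j} → Bijective t → Traced σ t c →
  inverse z ≡ y → inverse y ≡ z → flat (lookup σ₂) ↭ z ∷ y ∷ flat (lookup σ) →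
  After i z (Adjacent σ) R₁ → Before j y R₁ (Adjacent σ₂) →
  Traced σ₂ (proj₁ (across i j t)) (proj₂ (across i j t) + c)
across-traced σ σ₂ {t = t} {i = i} {j} bij T z⁻¹ y⁻¹ cov ins₁ ins₂ with source t j ≟ i
... | yes s≡i = insert-across-closed T bij z⁻¹ y⁻¹ cov ins₁ ins₂ s≡i
... | no  s≢i = insert-across-open   T bij z⁻¹ y⁻¹ cov ins₁ ins₂ s≢i

advance-traced : ∀ b e x σ {t c} → Bijective t → Traced σ t c →
                 Traced (advance b e x σ) (after b e t) (proj₂ (move b e t) + c)
advance-traced true true x σ bij T = insert-after-after T bij refl refl
  (↭-trans (flat-prepend 1F (x ⁻) σ₁) (↭-trans (↭-prep _ (flat-prepend 0F (x ⁺) σ)) (↭-swap _ _ ↭-refl)))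
  (λ ()) (prepend-after 0F (x ⁺) σ) (prepend-after 1F (x ⁻) σ₁)
  where σ₁ = prepend 0F (x ⁺) σ
advance-traced true false x σ bij T = across-traced σ (append 2F (x ⁻) σ₁) bij T refl refl
  (↭-trans (flat-append 2F (x ⁻) σ₁) (↭-trans (↭-prep _ (flat-prepend 0F (x ⁺) σ)) (↭-swap _ _ ↭-refl)))
  (prepend-after 0F (x ⁺) σ) (append-before 2F (x ⁻) σ₁)
  where σ₁ = prepend 0F (x ⁺) σ
advance-traced false true x σ bij T = across-traced σ (append 1F (x ⁺) σ₁) bij T refl refl
  (↭-trans (flat-append 1F (x ⁺) σ₁) (↭-trans (↭-prep _ (flat-prepend 1F (x ⁻) σ)) (↭-swap _ _ ↭-refl)))
  (prepend-after 1F (x ⁻) σ) (append-before 1F (x ⁺) σ₁)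
  where σ₁ = prepend 1F (x ⁻) σ
advance-traced false false x σ bij T = insert-before-before T bij refl refl
  (↭-trans (flat-append 2F (x ⁻) σ₁) (↭-trans (↭-prep _ (flat-append 1F (x ⁺) σ)) (↭-swap _ _ ↭-refl)))
  (λ ()) (append-before 1F (x ⁺) σ) (append-before 2F (x ⁻) σ₁)
  where σ₁ = append 1F (x ⁺) σ

-- Ladder words as iterated insertions

descending ascending : ∀ {n} → (Fin n → Side) → Subset n → Word
descending f K = map f (reverse (members K))
ascending  f K = map f (nonmembers K)

private
  filter-suc : ∀ {n} {P : Fin (suc n) → Set} {Q : Fin n → Set} (P? : U.Decidable P) (Q? : U.Decidable Q) →
    (∀ {k} → P (suc k) → Q k) → (∀ {k} → Q k → P (suc k)) →
    ∀ xs → filter P? (map suc xs) ≡ map suc (filter Q? xs)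
  filter-suc P? Q? to from []       = refl
  filter-suc P? Q? to from (x ∷ xs) with P? (suc x) | Q? x
  ... | yes p | yes q = cong (suc x ∷_) (filter-suc P? Q? to from xs)
  ... | no ¬p | no ¬q = filter-suc P? Q? to from xs
  ... | yes p | no ¬q = ⊥-elim (¬q (to p))
  ... | no ¬p | yes q = ⊥-elim (¬p (from q))

  members-suc : ∀ {n} b (K : Subset n) → filter (_∈? (b ∷ K)) (tabulate suc) ≡ map suc (members K)
  members-suc b K = trans (cong (filter (_∈? (b ∷ K))) (sym (map-tabulate (λ i → i) suc)))
    (filter-suc (_∈? (b ∷ K)) (_∈? K) drop-there there (allFin _))

  nonmembers-suc : ∀ {n} b (K : Subset n) →
    filter (¬? ∘ (_∈? (b ∷ K))) (tabulate suc) ≡ map suc (nonmembers K)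
  nonmembers-suc b K = trans (cong (filter (¬? ∘ (_∈? (b ∷ K)))) (sym (map-tabulate (λ i → i) suc)))
    (filter-suc (¬? ∘ (_∈? (b ∷ K))) (¬? ∘ (_∈? K)) (λ ¬p → ¬p ∘ there) (λ ¬q → ¬q ∘ drop-there) (allFin _))

  descending-suc : ∀ {n} (f : Fin (suc n) → Side) (ms : List (Fin n)) →
    map f (reverse (map suc ms)) ≡ map (f ∘ suc) (reverse ms)
  descending-suc f ms = trans (cong (map f) (sym (reverse-map suc ms))) (sym (map-∘ (reverse ms)))

descending-∷ : ∀ {n} (f : Fin (suc n) → Side) b K →
  descending f (b ∷ K) ≡ descending (f ∘ suc) K ++ (if b then [ f zero ] else [])
descending-∷ f true K = trans
  (cong (map f) (trans (unfold-reverse zero (filter (_∈? (true ∷ K)) (tabulate suc)))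
    (cong (λ ms → reverse ms ++ [ zero ]) (members-suc true K))))
  (trans (map-++ f (reverse (map suc (members K))) [ zero ])
    (cong (_++ [ f zero ]) (descending-suc f (members K))))
descending-∷ f false K = trans (cong (λ ms → map f (reverse ms)) (members-suc false K))
  (trans (descending-suc f (members K)) (sym (++-identityʳ _)))

ascending-∷ : ∀ {n} (f : Fin (suc n) → Side) b K →
  ascending f (b ∷ K) ≡ (if b then [] else [ f zero ]) ++ ascending (f ∘ suc) K
ascending-∷ f true  K = trans (cong (map f) (nonmembers-suc true K)) (sym (map-∘ (nonmembers K)))
ascending-∷ f false K = cong (f zero ∷_)
  (trans (cong (map f) (nonmembers-suc false K)) (sym (map-∘ (nonmembers K))))

final : ∀ {n} → (Fin n → Letter) → Subset n → Subset n → Segments → Segments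
final h K E (A ∷ B ∷ C ∷ D ∷ []) =
  (descending (_⁺ ∘ h) K ++ A) ∷
  (descending (_⁻ ∘ h) E ++ B ++ ascending (_⁺ ∘ h) K) ∷
  (C ++ ascending (_⁻ ∘ h) E) ∷ D ∷ []

-- In every block the letter of least index is the one next to the old segment, so it can be
-- inserted before all the others.
final-∷ : ∀ {n} (h : Fin (suc n) → Letter) b K e E σ →
          final h (b ∷ K) (e ∷ E) σ ≡ final (h ∘ suc) K E (advance b e (h zero) σ)
final-∷ h b K e E (A ∷ B ∷ C ∷ D ∷ [])
  rewrite descending-∷ (_⁺ ∘ h) b K | descending-∷ (_⁻ ∘ h) e E
        | ascending-∷ (_⁺ ∘ h) b K | ascending-∷ (_⁻ ∘ h) e E = regroup b e
  where
  d  = descending (_⁺ ∘ h ∘ suc) K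
  a  = ascending  (_⁺ ∘ h ∘ suc) K
  d′ = descending (_⁻ ∘ h ∘ suc) E
  a′ = ascending  (_⁻ ∘ h ∘ suc) E
  x  = h zero ⁺
  x⁻ = h zero ⁻

  congs : ∀ {A A′ B B′ C C′ : List Side} → A ≡ A′ → B ≡ B′ → C ≡ C′ →
          _≡_ {A = Segments} (A ∷ B ∷ C ∷ D ∷ []) (A′ ∷ B′ ∷ C′ ∷ D ∷ [])
  congs refl refl refl = refl

  regroup : ∀ b e → _≡_ {A = Segments}
    (((d ++ (if b then [ x ] else [])) ++ A) ∷
     ((d′ ++ (if e then [ x⁻ ] else [])) ++ B ++ (if b then [] else [ x ]) ++ a) ∷
     (C ++ (if e then [] else [ x⁻ ]) ++ a′) ∷ D ∷ [])
    (final (h ∘ suc) K E (advance b e (h zero) (A ∷ B ∷ C ∷ D ∷ [])))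
  regroup true  true  = congs (++-assoc d _ A) (++-assoc d′ _ _) refl
  regroup true  false = congs (++-assoc d _ A) (++-assoc d′ _ _) (sym (++-assoc C _ a′))
  regroup false true  = congs (++-assoc d _ A)
    (trans (++-assoc d′ _ _) (cong (λ ys → d′ ++ x⁻ ∷ ys) (sym (++-assoc B _ a)))) refl
  regroup false false = congs (++-assoc d _ A)
    (trans (++-assoc d′ _ _) (cong (d′ ++_) (sym (++-assoc B _ a)))) (sym (++-assoc C _ a′))

-- The genus gained by the remaining insertions.
run : ∀ {n} → Targets → Subset n → Subset n → ℕ
run t []      []      = 0
run t (b ∷ K) (e ∷ E) = rise b e t + run (after b e t) K E

-- The final equation is Euler's formula telescoped: each letter adds one to the vertices plus twice
-- the genus gained.
final-traced : ∀ {n} (h : Fin n → Letter) K E σ {t c} → Bijective t → Traced σ t c →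
  ∃ λ t′ → ∃ λ c′ → Bijective t′ × Traced (final h K E σ) t′ c′ ×
    c′ + orbits t′ + 2 * run t K E ≡ c + orbits t + n
final-traced h [] [] (A ∷ B ∷ C ∷ D ∷ []) {t} {c} bij T = t , c , bij ,
  subst (λ xs → Traced xs t c) (sym eq) T , refl
  where
  eq : final h [] [] (A ∷ B ∷ C ∷ D ∷ []) ≡ A ∷ B ∷ C ∷ D ∷ []
  eq rewrite ++-identityʳ B | ++-identityʳ C = refl
final-traced {suc n} h (b ∷ K) (e ∷ E) σ {t} {c} bij T =
  let bij₁ , eq₁ = validMoves t bij b e
      t′ , c′ , bij′ , T′ , eq = final-traced (h ∘ suc) K E (advance b e (h zero) σ) bij₁
                                   (advance-traced b e (h zero) σ bij T)
  in t′ , c′ , bij′ , subst (λ xs → Traced xs t′ c′) (sym (final-∷ h b K e E σ)) T′ ,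
     trans (arith₁ c′ (orbits t′) (rise b e t) (run (after b e t) K E)) (trans (cong (_+ 2 * rise b e t) eq)
       (trans (arith₂ (proj₂ (move b e t)) c (orbits (after b e t)) n (rise b e t))
         (trans (cong (λ m → m + c + n) (sym eq₁)) (arith₃ (orbits t) c n))))
  where
  arith₁ : ∀ c o r m → c + o + 2 * (r + m) ≡ c + o + 2 * m + 2 * r
  arith₁ = solve-∀
  arith₂ : ∀ m c o n r → m + c + o + n + 2 * r ≡ m + o + 2 * r + c + n
  arith₂ = solve-∀
  arith₃ : ∀ o c n → o + 1 + c + n ≡ c + o + suc n
  arith₃ = solve-∀

-- Read off from the word without rungs, which has genus 0. Markers 0 and 1 stand side by side
-- there, so the arc from 0 to 1 is empty.
start : Targets
start = 1F ∷ 0F ∷ 2F ∷ 3F ∷ []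

abstract
 start-bijective : Bijective start
 start-bijective = from-yes (bijective? start)

frame : Segments
frame = [] ∷ [ 𝐚 ⁺ ] ∷ (𝐚 ⁻ ∷ 𝐛 ⁺ ∷ []) ∷ [ 𝐛 ⁻ ] ∷ []

frame-traced : Traced frame start 0
frame-traced = record
  { arcs   = [] ∷ (𝐚 ⁺ ∷ 𝐛 ⁺ ∷ []) ∷ [ 𝐚 ⁻ ] ∷ [ 𝐛 ⁻ ] ∷ []
  ; arc    = λ where
      0F → 0F , here head
      1F → (1F , here head) , (2F , there (here head)) , 3F , there (here head)
      2F → (2F , here head) , 1F , there (here head)
      3F → (3F , here head) , 2F , there (there (here head))
  ; cycles = []
  ; cyclic = []
  ; covers = ↭-prep _ (↭-swap _ _ ↭-refl)
  ; count  = refl }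

ladder-word : ∀ {n} (K E : Subset n) → flat (lookup (final letter K E frame)) ≡ ladderWord K E
ladder-word K E = cong₂ _++_ (++-identityʳ (R₁ K)) (++-assoc (R₃ E) (𝐚 ⁺ ∷ R₂ K) _)

private
  nonempty : ∀ {xs : Word} {s} → s ∈ xs → NonZero (length xs)
  nonempty (here _)      = _
  nonempty (Any.there _) = _

  unique-ladder : ∀ {n} (K E : Subset n) → Unique (ladderWord K E)
  unique-ladder K E = unique-↭ (↭-sym (paired s)) (Unique.++⁺
    (Unique.map⁺ (cong proj₁) (unique s)) (Unique.map⁺ (cong proj₁) (unique s)) λ (p , q) → opposed p q)
    where
    s = ladder K E
    opposed : ∀ {v xs ys} → v ∈ map _⁺ xs → ¬ v ∈ map _⁻ ys
    opposed p q with ∈-map⁻ _⁺ p | ∈-map⁻ _⁻ q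
    ... | _ , _ , refl | _ , _ , ()

vertexCount-traced : ∀ {n} (K E : Subset n) {t c} → Bijective t → Traced (final letter K E frame) t c →
                     vertexCount (ladder K E) ≡ c + orbits t
vertexCount-traced K E {t} bij T = count
  (close {R = Adjacent σ} (no-loop σ refl) (λ k → k) (lookup t) (source t)
    (Bijective.target-source bij) (Bijective.source-target bij) arcs
    (λ k → pass-chain (lookup arcs k) (arc k)))
  where
  open Tracing T using (cycles; cyclic; covers; arcs; arc) renaming (count to |cycles|)
  σ = final letter K E frame

  count : (∃ λ cs → length cs ≡ orbits t × All (Cyclic (Pass (Adjacent σ))) cs ×
             concat (map sides cs) ↭ flat (lookup arcs)) → _
  count (cs , len , cyc , cov) = trans
    (vertexCount-cycles (unique-ladder K E)
      (pass⇒follows σ {{nonempty (∈-resp-↭ (↭-sym (paired (ladder K E))) (here refl))}} (ladder-word K E))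
      (cycles ++ cs) (All.++⁺ (All.map (λ {c} → pass-chain (proj₂ c)) cyclic) cyc) all-covered)
    (trans (length-++ cycles) (cong₂ _+_ |cycles| len))
    where
    all-covered : concat (map sides (cycles ++ cs)) ↭ ladderWord K E
    all-covered = ↭-trans (↭-reflexive (trans (cong concat (map-++ sides cycles cs))
        (sym (concat-++ (map sides cycles) (map sides cs)))))
      (↭-trans (++⁺ˡ (concat (map sides cycles)) cov) (↭-trans covers (↭-reflexive (ladder-word K E))))

vertexCount-run : ∀ {n} (K E : Subset n) → vertexCount (ladder K E) + 2 * run start K E ≡ 3 + n
vertexCount-run {n} K E =
  let t , c , bij , T , eq = final-traced letter K E frame start-bijective frame-traced
  in  trans (cong (_+ 2 * run start K E) (vertexCount-traced K E bij T)) eq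

hasGenus⇔run : ∀ {n i} (K E : Subset n) → HasGenus i (ladder K E) ⇔ run start K E ≡ i
hasGenus⇔run {n} {i} K E = mk⇔
  (λ genus → sym (*-cancelˡ-≡ i _ 2 (+-cancelˡ-≡ (v + 1) _ _ (trans genus (trans edges (sym euler))))))
  λ { refl → trans euler (sym edges) }
  where
  v = vertexCount (ladder K E)

  arith : ∀ v r → v + 1 + r ≡ v + r + 1
  arith = solve-∀

  arith′ : ∀ n → 3 + n + 1 ≡ n + 4
  arith′ = solve-∀

  arith″ : ∀ n → 2 + n + 2 ≡ n + 4
  arith″ = solve-∀

  euler : v + 1 + 2 * run start K E ≡ n + 4
  euler = trans (arith v _) (trans (cong (_+ 1) (vertexCount-run K E)) (arith′ n))

  edges : edgeCount (ladder K E) + 2 ≡ n + 4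
  edges = trans (cong (λ m → 2 + m + 2)
      (trans (length-map letter (allFin n)) (length-tabulate {n = n} (λ k → k))))
    (arith″ n)

-- Counting by genus
indicator : {P : Set} → Dec P → ℕ
indicator P? = if does P? then 1 else 0

indicator-cong : {P Q : Set} (P? : Dec P) (Q? : Dec Q) → (P → Q) → (Q → P) → indicator P? ≡ indicator Q?
indicator-cong (yes p) (yes q) to from = refl
indicator-cong (yes p) (no ¬q) to from with () ← ¬q (to p)
indicator-cong (no ¬p) (yes q) to from with () ← ¬p (from q)
indicator-cong (no ¬p) (no ¬q) to from = refl

∑ : List Elem → (Elem → ℕ) → ℕ
∑ xs f = sum (map f xs)

length-filter : {P : Elem → Set} (P? : U.Decidable P) (xs : List Elem) →
                length (filter P? xs) ≡ ∑ xs (indicator ∘ P?)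
length-filter P? []       = refl
length-filter P? (x ∷ xs) with P? x
... | yes _ = cong suc (length-filter P? xs)
... | no  _ = length-filter P? xs

∑-map : (g : Elem → Elem′) (xs : List Elem) {f : Elem′ → ℕ} → ∑ (map g xs) f ≡ ∑ xs (f ∘ g)
∑-map g xs = cong sum (sym (map-∘ xs))

∑-cong : (xs : List Elem) {f g : Elem → ℕ} → (∀ x → f x ≡ g x) → ∑ xs f ≡ ∑ xs g
∑-cong xs eq = cong sum (map-cong eq xs)

∑-++ : (xs ys : List Elem) {f : Elem → ℕ} → ∑ (xs ++ ys) f ≡ ∑ xs f + ∑ ys f
∑-++ xs ys {f} = trans (cong sum (map-++ f xs ys)) (sum-++ (map f xs) (map f ys))

∑-+ : (xs : List Elem) {f g : Elem → ℕ} → ∑ xs (λ x → f x + g x) ≡ ∑ xs f + ∑ xs g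
∑-+ []       = refl
∑-+ (x ∷ xs) {f} {g} = trans (cong ((f x + g x) +_) (∑-+ xs)) (swap (f x) (g x) _ _)
  where
  swap : ∀ a b c d → a + b + (c + d) ≡ a + c + (b + d)
  swap = solve-∀

∑-product : (xs : List Elem) (ys : List Elem′) {f : Elem × Elem′ → ℕ} →
            ∑ (cartesianProduct xs ys) f ≡ ∑ xs λ x → ∑ ys λ y → f (x , y)
∑-product []       ys = refl
∑-product (x ∷ xs) ys = trans (∑-++ (map (x ,_) ys) _) (cong₂ _+_ (∑-map (x ,_) ys) (∑-product xs ys))

∑-subsets : ∀ n {f : Subset (suc n) → ℕ} →
  ∑ (subsets (suc n)) f ≡ ∑ (subsets n) (f ∘ (true ∷_)) + ∑ (subsets n) (f ∘ (false ∷_))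
∑-subsets n = trans (∑-++ (map (true ∷_) (subsets n)) _)
  (cong₂ _+_ (∑-map (true ∷_) (subsets n)) (∑-map (false ∷_) (subsets n)))

-- Multiplication of a polynomial in x by a power of x.
delay : ℕ → (ℕ → ℕ) → ℕ → ℕ
delay zero    f i       = f i
delay (suc k) f zero    = 0
delay (suc k) f (suc i) = delay k f i

delay-cong : ∀ k {f g : ℕ → ℕ} → (∀ i → f i ≡ g i) → ∀ i → delay k f i ≡ delay k g i
delay-cong zero    eq i       = eq i
delay-cong (suc k) eq zero    = refl
delay-cong (suc k) eq (suc i) = delay-cong k eq i

∑-zero : (xs : List Elem) → ∑ xs (λ _ → 0) ≡ 0
∑-zero []       = refl
∑-zero (_ ∷ xs) = ∑-zero xs

∑-delay : ∀ k (xs : List Elem) {f : Elem → ℕ → ℕ} i →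
          ∑ xs (λ x → delay k (f x) i) ≡ delay k (λ i → ∑ xs λ x → f x i) i
∑-delay zero    xs i       = refl
∑-delay (suc k) xs zero    = ∑-zero xs
∑-delay (suc k) xs (suc i) = ∑-delay k xs i

indicator-delay : ∀ k m i → indicator (k + m ℕ.≟ i) ≡ delay k (λ i → indicator (m ℕ.≟ i)) i
indicator-delay zero    m i       = refl
indicator-delay (suc k) m zero    = refl
indicator-delay (suc k) m (suc i) = trans
  (indicator-cong (suc (k + m) ℕ.≟ suc i) (k + m ℕ.≟ i) (λ { refl → refl }) (cong suc)) (indicator-delay k m i)

-- The polynomial, by genus gained, of all choices for n further letters from state t: a row sum of
-- a power of the transfer matrix.
paths : Targets → ℕ → ℕ → ℕ
paths t zero    i = indicator (0 ℕ.≟ i)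
paths t (suc n) i = branch true true + branch true false + (branch false true + branch false false)
  where
  branch : Bool → Bool → ℕ
  branch b e = delay (rise b e t) (paths (after b e t) n) i

∑-run : ∀ n t i → (∑ (subsets n) λ K → ∑ (subsets n) λ E → indicator (run t K E ℕ.≟ i)) ≡ paths t n i
∑-run zero    t i = trans (+-identityʳ _) (+-identityʳ _)
∑-run (suc n) t i = trans (∑-subsets n) (cong₂ _+_ (halves true) (halves false))
  where
  quarter : ∀ b e → (∑ (subsets n) λ K → ∑ (subsets n) λ E → indicator (run t (b ∷ K) (e ∷ E) ℕ.≟ i))
                    ≡ delay (rise b e t) (paths (after b e t) n) i
  quarter b e = trans
    (∑-cong (subsets n) λ K → trans
      (∑-cong (subsets n) λ E → indicator-delay (rise b e t) (run (after b e t) K E) i)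
      (∑-delay (rise b e t) (subsets n) i))
    (trans (∑-delay (rise b e t) (subsets n) i) (delay-cong (rise b e t) (∑-run n (after b e t)) i))

  halves : ∀ b → (∑ (subsets n) λ K → ∑ (subsets (suc n)) λ E → indicator (run t (b ∷ K) E ℕ.≟ i))
                 ≡ delay (rise b true t) (paths (after b true t) n) i
                   + delay (rise b false t) (paths (after b false t) n) i
  halves b = trans (∑-cong (subsets n) λ K → ∑-subsets n)
    (trans (∑-+ (subsets n)) (cong₂ _+_ (quarter b true) (quarter b false)))

g₉-paths : ∀ n i → g₉ n i ≡ paths start n i
g₉-paths n i = begin
  length (filter (hasGenus? i) (𝒮₉ n))
    ≡⟨ length-filter (hasGenus? i) (𝒮₉ n) ⟩
  ∑ (𝒮₉ n) (indicator ∘ hasGenus? i)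
    ≡⟨ ∑-map (uncurry ladder) (cartesianProduct (subsets n) (subsets n)) ⟩
  ∑ (cartesianProduct (subsets n) (subsets n)) (λ (K , E) → indicator (hasGenus? i (ladder K E)))
    ≡⟨ ∑-product (subsets n) (subsets n) ⟩
  (∑ (subsets n) λ K → ∑ (subsets n) λ E → indicator (hasGenus? i (ladder K E)))
    ≡⟨ ∑-cong (subsets n) (λ K → ∑-cong (subsets n) λ E →
         indicator-cong (hasGenus? i (ladder K E)) (run start K E ℕ.≟ i)
           (Equivalence.to (hasGenus⇔run K E)) (Equivalence.from (hasGenus⇔run K E))) ⟩
  (∑ (subsets n) λ K → ∑ (subsets n) λ E → indicator (run start K E ℕ.≟ i))
    ≡⟨ ∑-run n start i ⟩
  paths start n i ∎
  where open ≡-Reasoning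

-- Equivalent states
module _ {A : Set} (_≟_ : DecidableEquality A) where

  extract : ∀ x (ys : List A) → Maybe (∃ λ zs → x ∷ zs ↭ ys)
  extract x []       = nothing
  extract x (y ∷ ys) with x ≟ y | extract x ys
  ... | yes refl | _                = just (ys , ↭-refl)
  ... | no _     | just (zs , p)    = just (y ∷ zs , ↭-trans (↭-swap x y ↭-refl) (↭-prep y p))
  ... | no _     | nothing          = nothing

  permutation? : ∀ (xs ys : List A) → Maybe (xs ↭ ys)
  permutation? []       []       = just ↭-refl
  permutation? []       (_ ∷ _)  = nothing
  permutation? (x ∷ xs) ys with extract x ys
  ... | nothing       = nothing
  ... | just (zs , p) with permutation? xs zs
  ...   | nothing = nothing
  ...   | just q  = just (↭-trans (↭-prep x q) p)

-- Representatives of the targets with the same path counts.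
canonical : Targets → Targets
canonical (0F ∷ 1F ∷ 3F ∷ 2F ∷ []) = 1F ∷ 0F ∷ 2F ∷ 3F ∷ []
canonical (1F ∷ 2F ∷ 0F ∷ 3F ∷ []) = 3F ∷ 0F ∷ 2F ∷ 1F ∷ []
canonical (3F ∷ 1F ∷ 0F ∷ 2F ∷ []) = 3F ∷ 0F ∷ 2F ∷ 1F ∷ []
canonical (0F ∷ 2F ∷ 3F ∷ 1F ∷ []) = 3F ∷ 0F ∷ 2F ∷ 1F ∷ []
canonical (0F ∷ 2F ∷ 1F ∷ 3F ∷ []) = 3F ∷ 1F ∷ 2F ∷ 0F ∷ []
canonical (2F ∷ 1F ∷ 0F ∷ 3F ∷ []) = 0F ∷ 3F ∷ 2F ∷ 1F ∷ []
canonical (1F ∷ 3F ∷ 0F ∷ 2F ∷ []) = 2F ∷ 0F ∷ 3F ∷ 1F ∷ []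
canonical (1F ∷ 2F ∷ 3F ∷ 0F ∷ []) = 3F ∷ 0F ∷ 1F ∷ 2F ∷ []
canonical (2F ∷ 1F ∷ 3F ∷ 0F ∷ []) = 1F ∷ 3F ∷ 2F ∷ 0F ∷ []
canonical (2F ∷ 0F ∷ 1F ∷ 3F ∷ []) = 1F ∷ 3F ∷ 2F ∷ 0F ∷ []
canonical (0F ∷ 3F ∷ 1F ∷ 2F ∷ []) = 1F ∷ 3F ∷ 2F ∷ 0F ∷ []
canonical t                        = t

successors : Targets → List (ℕ × Targets)
successors t = successor true true ∷ successor true false ∷ successor false true ∷ successor false false ∷ []
  where
  successor : Bool → Bool → ℕ × Targets
  successor b e = rise b e t , canonical (after b e t)

-- A bisimulation: it is enough that the two states have the same weighted successors up to order,
-- where successors are compared after `canonical` as well. Induction on the number of letters then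
-- gives equal path counts.
Twinned : Targets → Set
Twinned t = Bijective t → Bijective (canonical t) ×
  T (is-just (permutation? (≡-dec ℕ._≟_ (Vec.≡-dec _≟_)) (successors t) (successors (canonical t))))

twinned? : U.Decidable Twinned
twinned? t = bijective? t →-dec (bijective? (canonical t) ×-dec T? _)

abstract
  twinned : ∀ t → Twinned t
  twinned = from-yes (all-targets? twinned?)

successors-canonical : ∀ t → Bijective t → successors t ↭ successors (canonical t)
successors-canonical t bij = to-witness-T _ (proj₂ (twinned t bij))

paths-canonical : ∀ n t → Bijective t → ∀ i → paths t n i ≡ paths (canonical t) n i
paths-suc : ∀ n t → Bijective t → ∀ i →
  paths t (suc n) i ≡ ∑ (successors t) λ (r , u) → delay r (paths u n) i

paths-canonical zero    t bij i = refl
paths-canonical (suc n) t bij i = trans (paths-suc n t bij i)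
  (trans (sum-↭ (map⁺ (λ (r , u) → delay r (paths u n) i) (successors-canonical t bij)))
    (sym (paths-suc n (canonical t) (proj₁ (twinned t bij)) i)))

paths-suc n t bij i = trans
  (cong₂ _+_ (cong₂ _+_ (branch true true) (branch true false))
             (cong₂ _+_ (branch false true) (branch false false)))
  (regroup (path true true) (path true false) (path false true) (path false false))
  where
  path : Bool → Bool → ℕ
  path b e = delay (rise b e t) (paths (canonical (after b e t)) n) i

  branch : ∀ b e → delay (rise b e t) (paths (after b e t) n) i ≡ path b e
  branch b e = delay-cong (rise b e t) (paths-canonical n (after b e t) (proj₁ (validMoves t bij b e))) i

  regroup : ∀ a b c d → a + b + (c + d) ≡ a + (b + (c + (d + 0)))
  regroup = solve-∀

-- Generating functions
-- Sequences ℕ → ℕ are polynomials in x, and ∂ is multiplication by x.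
∂ : (ℕ → ℕ) → ℕ → ℕ
∂ = delay 1

δ : ℕ → ℕ
δ i = indicator (0 ℕ.≟ i)

t₀ t₁ t₂ t₃ t₄ t₅ t₆ t₇ t₈ t₉ t₁₀ t₁₁ t₁₂ : Targets
t₀ = start
t₁ = 0F ∷ 1F ∷ 2F ∷ 3F ∷ []
t₂ = 3F ∷ 0F ∷ 2F ∷ 1F ∷ []
t₃ = 1F ∷ 0F ∷ 3F ∷ 2F ∷ []
t₄ = 3F ∷ 1F ∷ 2F ∷ 0F ∷ []
t₅ = 0F ∷ 3F ∷ 2F ∷ 1F ∷ []
t₆ = 3F ∷ 2F ∷ 0F ∷ 1F ∷ []
t₇ = 2F ∷ 0F ∷ 3F ∷ 1F ∷ []
t₈ = 3F ∷ 0F ∷ 1F ∷ 2F ∷ []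
t₉ = 1F ∷ 3F ∷ 2F ∷ 0F ∷ []
t₁₀ = 3F ∷ 2F ∷ 1F ∷ 0F ∷ []
t₁₁ = 2F ∷ 3F ∷ 0F ∷ 1F ∷ []
t₁₂ = 2F ∷ 3F ∷ 1F ∷ 0F ∷ []

abstract
  f₀ f₁ f₂ f₃ f₄ f₅ f₆ f₇ f₈ f₉ f₁₀ f₁₁ f₁₂ : ℕ → ℕ → ℕ
  f₀ = paths t₀
  f₁ = paths t₁
  f₂ = paths t₂
  f₃ = paths t₃
  f₄ = paths t₄
  f₅ = paths t₅
  f₆ = paths t₆
  f₇ = paths t₇
  f₈ = paths t₈
  f₉ = paths t₉
  f₁₀ = paths t₁₀
  f₁₁ = paths t₁₁
  f₁₂ = paths t₁₂

  zero₀ : ∀ i → f₀ 0 i ≡ δ i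
  zero₀ i = refl
  zero₁ : ∀ i → f₁ 0 i ≡ δ i
  zero₁ i = refl
  zero₂ : ∀ i → f₂ 0 i ≡ δ i
  zero₂ i = refl
  zero₃ : ∀ i → f₃ 0 i ≡ δ i
  zero₃ i = refl
  zero₄ : ∀ i → f₄ 0 i ≡ δ i
  zero₄ i = refl
  zero₅ : ∀ i → f₅ 0 i ≡ δ i
  zero₅ i = refl
  zero₆ : ∀ i → f₆ 0 i ≡ δ i
  zero₆ i = refl
  zero₇ : ∀ i → f₇ 0 i ≡ δ i
  zero₇ i = refl
  zero₈ : ∀ i → f₈ 0 i ≡ δ i
  zero₈ i = refl
  zero₉ : ∀ i → f₉ 0 i ≡ δ i
  zero₉ i = refl
  zero₁₀ : ∀ i → f₁₀ 0 i ≡ δ i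
  zero₁₀ i = refl
  zero₁₁ : ∀ i → f₁₁ 0 i ≡ δ i
  zero₁₁ i = refl
  zero₁₂ : ∀ i → f₁₂ 0 i ≡ δ i
  zero₁₂ i = refl

  -- The rows of the transfer matrix. The summands belong, up to the identification of states, to a
  -- letter in K and T, in K only, in T only, and in neither; `∂` marks a gain of genus.
  suc₀ : ∀ n i → f₀ (suc n) i ≡ f₁ n i + (∂ (f₂ n) i + (∂ (f₂ n) i + (∂ (f₃ n) i + 0)))
  suc₀ n = paths-suc n t₀ (from-yes (bijective? t₀))
  suc₁ : ∀ n i → f₁ (suc n) i ≡ ∂ (f₀ n) i + (∂ (f₄ n) i + (∂ (f₄ n) i + (∂ (f₀ n) i + 0)))
  suc₁ n = paths-suc n t₁ (from-yes (bijective? t₁))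
  suc₂ : ∀ n i → f₂ (suc n) i ≡ f₅ n i + (f₂ n i + (∂ (f₆ n) i + (∂ (f₇ n) i + 0)))
  suc₂ n = paths-suc n t₂ (from-yes (bijective? t₂))
  suc₃ : ∀ n i → f₃ (suc n) i ≡ f₀ n i + (∂ (f₈ n) i + (∂ (f₈ n) i + (f₀ n i + 0)))
  suc₃ n = paths-suc n t₃ (from-yes (bijective? t₃))
  suc₄ : ∀ n i → f₄ (suc n) i ≡ ∂ (f₉ n) i + (f₄ n i + (∂ (f₁₀ n) i + (∂ (f₉ n) i + 0)))
  suc₄ n = paths-suc n t₄ (from-yes (bijective? t₄))
  suc₅ : ∀ n i → f₅ (suc n) i ≡ ∂ (f₂ n) i + (∂ (f₂ n) i + (∂ (f₂ n) i + (∂ (f₂ n) i + 0)))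
  suc₅ n = paths-suc n t₅ (from-yes (bijective? t₅))
  suc₆ : ∀ n i → f₆ (suc n) i ≡ f₁₁ n i + (f₆ n i + (f₆ n i + (f₁₁ n i + 0)))
  suc₆ n = paths-suc n t₆ (from-yes (bijective? t₆))
  suc₇ : ∀ n i → f₇ (suc n) i ≡ f₂ n i + (f₂ n i + (f₂ n i + (f₂ n i + 0)))
  suc₇ n = paths-suc n t₇ (from-yes (bijective? t₇))
  suc₈ : ∀ n i → f₈ (suc n) i ≡ f₉ n i + (f₈ n i + (f₁₀ n i + (f₉ n i + 0)))
  suc₈ n = paths-suc n t₈ (from-yes (bijective? t₈))
  suc₉ : ∀ n i → f₉ (suc n) i ≡ f₄ n i + (f₄ n i + (∂ (f₈ n) i + (∂ (f₈ n) i + 0)))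
  suc₉ n = paths-suc n t₉ (from-yes (bijective? t₉))
  suc₁₀ : ∀ n i → f₁₀ (suc n) i ≡ ∂ (f₁₂ n) i + (f₁₀ n i + (f₁₀ n i + (∂ (f₁₂ n) i + 0)))
  suc₁₀ n = paths-suc n t₁₀ (from-yes (bijective? t₁₀))
  suc₁₁ : ∀ n i → f₁₁ (suc n) i ≡ ∂ (f₆ n) i + (∂ (f₆ n) i + (∂ (f₆ n) i + (∂ (f₆ n) i + 0)))
  suc₁₁ n = paths-suc n t₁₁ (from-yes (bijective? t₁₁))
  suc₁₂ : ∀ n i → f₁₂ (suc n) i ≡ f₁₀ n i + (f₁₀ n i + (f₁₀ n i + (f₁₀ n i + 0)))
  suc₁₂ n = paths-suc n t₁₂ (from-yes (bijective? t₁₂))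

  g₉-f₀ : ∀ n i → g₉ n i ≡ f₀ n i
  g₉-f₀ = g₉-paths

-- The recurrence X (2 + n) = a X (1 + n) + 8 x X n + h n of polynomials in x.
Recurrence : ℕ → (h X : ℕ → ℕ → ℕ) → Set
Recurrence a h X = ∀ n i → X (2 + n) i ≡ a * X (1 + n) i + 8 * ∂ (X n) i + h n i

recurrence-unique : ∀ {a h X Y} → Recurrence a h X → Recurrence a h Y →
  (∀ i → X 0 i ≡ Y 0 i) → (∀ i → X 1 i ≡ Y 1 i) → ∀ n i → X n i ≡ Y n i
recurrence-unique {a} {h} {X} {Y} recX recY eq₀ eq₁ n = proj₁ (both n)
  where
  both : ∀ n → (∀ i → X n i ≡ Y n i) × (∀ i → X (1 + n) i ≡ Y (1 + n) i)
  both zero    = eq₀ , eq₁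
  both (suc n) = proj₂ (both n) , λ i → trans (recX n i) (trans
    (cong₂ (λ x y → a * x + 8 * y + h n i) (proj₂ (both n) i) (delay-cong 1 (proj₁ (both n)) i))
    (sym (recY n i)))

-- The coefficients of U and W.
u w : ℕ → ℕ → ℕ
u zero          i = δ i
u (suc zero)    i = 2 * δ i
u (suc (suc n)) i = 2 * u (suc n) i + 8 * ∂ (u n) i + 0
w zero          i = δ i
w (suc zero)    i = δ i
w (suc (suc n)) i = 1 * w (suc n) i + 8 * ∂ (w n) i + 0

-- Solving the transfer matrix block by block

none : ℕ → ℕ → ℕ
none _ _ = 0

∂suc₁₂ : ∀ n i → ∂ (f₁₂ (suc n)) i ≡ ∂ (f₁₀ n) i + (∂ (f₁₀ n) i + (∂ (f₁₀ n) i + (∂ (f₁₀ n) i + 0)))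
∂suc₁₂ n zero    = refl
∂suc₁₂ n (suc i) = suc₁₂ n i

∂suc₇ : ∀ n i → ∂ (f₇ (suc n)) i ≡ ∂ (f₂ n) i + (∂ (f₂ n) i + (∂ (f₂ n) i + (∂ (f₂ n) i + 0)))
∂suc₇ n zero    = refl
∂suc₇ n (suc i) = suc₇ n i

∂suc₈ : ∀ n i → ∂ (f₈ (suc n)) i ≡ ∂ (f₉ n) i + (∂ (f₈ n) i + (∂ (f₁₀ n) i + (∂ (f₉ n) i + 0)))
∂suc₈ n zero    = refl
∂suc₈ n (suc i) = suc₈ n i

-- The blocks are (6, 11) and (10, 12), both closed; (2, 5, 7), which leads to 6; (4, 8, 9), which
-- leads to 10; and (0, 1, 3), which leads to 2, 4 and 8. Elimination inside a block yields a
-- recurrence of second order.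
f₆-recurrence : Recurrence 2 none f₆
f₆-recurrence n i = trans (suc₆ (suc n) i)
  (trans (cong (λ z → z + (f₆ (suc n) i + (f₆ (suc n) i + (z + 0)))) (suc₁₁ n i))
    (arith (f₆ (suc n) i) (∂ (f₆ n) i)))
  where
  arith : ∀ a b → (b + (b + (b + (b + 0)))) + (a + (a + ((b + (b + (b + (b + 0)))) + 0))) ≡ 2 * a + 8 * b + 0
  arith = solve-∀

f₁₂-recurrence : Recurrence 2 none f₁₂
f₁₂-recurrence n i rewrite suc₁₂ (suc n) i | suc₁₀ n i | suc₁₂ n i = arith (f₁₀ n i) (∂ (f₁₂ n) i)
  where
  arith : ∀ a b → let c = b + (a + (a + (b + 0))) in
    c + (c + (c + (c + 0))) ≡ 2 * (a + (a + (a + (a + 0)))) + 8 * b + 0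
  arith = solve-∀

f₁₀-recurrence : Recurrence 2 none f₁₀
f₁₀-recurrence n i rewrite suc₁₀ (suc n) i | ∂suc₁₂ n i = arith (f₁₀ (suc n) i) (∂ (f₁₀ n) i)
  where
  arith : ∀ a b → let c = b + (b + (b + (b + 0))) in c + (a + (a + (c + 0))) ≡ 2 * a + 8 * b + 0
  arith = solve-∀

f₂-recurrence : Recurrence 1 (λ n → ∂ (f₆ (suc n))) f₂
f₂-recurrence n i rewrite suc₂ (suc n) i | suc₅ n i | ∂suc₇ n i =
  arith (f₂ (suc n) i) (∂ (f₂ n) i) (∂ (f₆ (suc n)) i)
  where
  arith : ∀ a b c → let d = b + (b + (b + (b + 0))) in d + (a + (c + (d + 0))) ≡ 1 * a + 8 * b + c
  arith = solve-∀

f₉-recurrence : Recurrence 1 (λ n → ∂ (f₁₂ (suc n))) f₉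
f₉-recurrence n i rewrite suc₉ (suc n) i | suc₄ n i | ∂suc₈ n i | suc₉ n i | ∂suc₁₂ n i =
  arith (f₄ n i) (∂ (f₈ n) i) (∂ (f₉ n) i) (∂ (f₁₀ n) i)
  where
  arith : ∀ a b c d → let e = c + (a + (d + (c + 0))); g = c + (b + (d + (c + 0))) in
    e + (e + (g + (g + 0))) ≡ 1 * (a + (a + (b + (b + 0)))) + 8 * c + (d + (d + (d + (d + 0))))
  arith = solve-∀

-- Subtracts a known equation from the goal. Linear combinations of identities are used in this form
-- throughout.
cancel-by : ∀ {a b l r} → a ≡ b → l + b ≡ r + a → l ≡ r
cancel-by {a} {l = l} {r} refl eq = +-cancelʳ-≡ a l r eq

f₁₂≡f₆ : ∀ n i → f₁₂ n i ≡ f₆ n i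
f₁₂≡f₆ = recurrence-unique {2} {none} f₁₂-recurrence f₆-recurrence
  (λ i → trans (zero₁₂ i) (sym (zero₆ i))) one
  where
  one : ∀ i → f₁₂ 1 i ≡ f₆ 1 i
  one i rewrite suc₁₂ 0 i | suc₆ 0 i | zero₁₀ i | zero₆ i | zero₁₁ i = refl

∂f₁₂≡∂f₆ : ∀ n i → ∂ (f₁₂ n) i ≡ ∂ (f₆ n) i
∂f₁₂≡∂f₆ n = delay-cong 1 (f₁₂≡f₆ n)

-- These states are not merged by `canonical`; the sequences agree because the recurrences have
-- equal inhomogeneous terms, by `f₁₂≡f₆`, and equal initial values.
f₉≡f₂ : ∀ n i → f₉ n i ≡ f₂ n i
f₉≡f₂ = recurrence-unique {1} {λ n → ∂ (f₆ (suc n))}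
  (λ n i → trans (f₉-recurrence n i) (cong (1 * f₉ (1 + n) i + 8 * ∂ (f₉ n) i +_) (∂f₁₂≡∂f₆ (suc n) i)))
  f₂-recurrence (λ i → trans (zero₉ i) (sym (zero₂ i))) one
  where
  one : ∀ i → f₉ 1 i ≡ f₂ 1 i
  one zero    rewrite suc₉ 0 0 | suc₂ 0 0 | zero₄ 0 | zero₅ 0 | zero₂ 0 = refl
  one (suc i) rewrite suc₉ 0 (suc i) | suc₂ 0 (suc i) | zero₄ (suc i) | zero₅ (suc i) | zero₂ (suc i)
                    | zero₈ i | zero₆ i | zero₇ i = refl

-- As a generating function, (1 + 2T) U.
f₆-closed : ∀ n i → f₆ (1 + n) i ≡ u (1 + n) i + 2 * u n i
f₆-closed = recurrence-unique {2} {none} (λ n → f₆-recurrence (suc n)) closed zeroth first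
  where
  arith : ∀ a b c d → 2 * a + 8 * c + 0 + 2 * (2 * b + 8 * d + 0) ≡ 2 * (a + 2 * b) + 8 * (c + 2 * d) + 0
  arith = solve-∀
  closed : Recurrence 2 none (λ n i → u (1 + n) i + 2 * u n i)
  closed n zero    = arith (u (2 + n) 0) (u (1 + n) 0) 0 0
  closed n (suc i) = arith (u (2 + n) (suc i)) (u (1 + n) (suc i)) (u (1 + n) i) (u n i)

  zeroth : ∀ i → f₆ 1 i ≡ u 1 i + 2 * u 0 i
  zeroth i rewrite suc₆ 0 i | zero₆ i | zero₁₁ i = value (δ i)
    where
    value : ∀ d → d + (d + (d + (d + 0))) ≡ 2 * d + 2 * d
    value = solve-∀
  first : ∀ i → f₆ 2 i ≡ u 2 i + 2 * u 1 i
  first i = trans (f₆-recurrence 0 i) (trans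
    (cong₂ (λ a b → 2 * a + 8 * b + 0) (zeroth i) (delay-cong 1 zero₆ i))
    (value (δ i) (∂ δ i)))
    where
    value : ∀ d e → 2 * (2 * d + 2 * d) + 8 * e + 0 ≡ 2 * (2 * d) + 8 * e + 0 + 2 * (2 * d)
    value = solve-∀

-- As a generating function, (1 + 2xT) U.
f₁₀-closed : ∀ n i → f₁₀ (1 + n) i ≡ u (1 + n) i + 2 * ∂ (u n) i
f₁₀-closed = recurrence-unique {2} {none} (λ n → f₁₀-recurrence (suc n)) closed zeroth first
  where
  arith : ∀ a b c d → 2 * a + 8 * c + 0 + 2 * (2 * b + 8 * d + 0) ≡ 2 * (a + 2 * b) + 8 * (c + 2 * d) + 0
  arith = solve-∀
  constant : ∀ a → 2 * a + 8 * 0 + 0 + 2 * 0 ≡ 2 * (a + 2 * 0) + 8 * 0 + 0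
  constant = solve-∀
  closed : Recurrence 2 none (λ n i → u (1 + n) i + 2 * ∂ (u n) i)
  closed n zero    = constant (u (2 + n) 0)
  closed n (suc i) = arith (u (2 + n) (suc i)) (u (1 + n) i) (u (1 + n) i) (∂ (u n) i)

  zeroth : ∀ i → f₁₀ 1 i ≡ u 1 i + 2 * ∂ (u 0) i
  zeroth i rewrite suc₁₀ 0 i | delay-cong 1 zero₁₂ i | zero₁₀ i = value (δ i) (∂ δ i)
    where
    value : ∀ d e → e + (d + (d + (e + 0))) ≡ 2 * d + 2 * e
    value = solve-∀
  first : ∀ i → f₁₀ 2 i ≡ u 2 i + 2 * ∂ (u 1) i
  first i = trans (f₁₀-recurrence 0 i) (trans
    (cong₂ (λ a b → 2 * a + 8 * b + 0) (zeroth i) (delay-cong 1 zero₁₀ i)) (value i))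
    where
    value′ : ∀ d e → 2 * (2 * d + 2 * e) + 8 * e + 0 ≡ 2 * (2 * d) + 8 * e + 0 + 2 * (2 * e)
    value′ = solve-∀
    value : ∀ i → 2 * (2 * δ i + 2 * ∂ δ i) + 8 * ∂ δ i + 0 ≡ u 2 i + 2 * ∂ (u 1) i
    value zero    = refl
    value (suc i) = value′ (δ (suc i)) (δ i)

f₂-one : ∀ i → f₂ 1 i ≡ 2 * δ i + 2 * ∂ δ i
f₂-one i rewrite suc₂ 0 i | zero₅ i | zero₂ i | delay-cong 1 zero₆ i | delay-cong 1 zero₇ i =
  value (δ i) (∂ δ i)
  where
  value : ∀ d e → d + (d + (e + (e + 0))) ≡ 2 * d + 2 * e
  value = solve-∀

-- As a generating function, x (1 + 2T) U + (1 - x) (1 + T) W. The first term is x times that of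
-- `f₆`, a particular solution of the recurrence; the second solves the homogeneous one.
f₂-closed : ∀ n i → f₂ (1 + n) i + ∂ (w (1 + n)) i + ∂ (w n) i
                    ≡ ∂ (u (1 + n)) i + 2 * ∂ (u n) i + w (1 + n) i + w n i
f₂-closed = recurrence-unique {1} {λ n → ∂ (f₆ (2 + n))}
  {λ n i → f₂ (1 + n) i + ∂ (w (1 + n)) i + ∂ (w n) i} left right zeroth first
  where
  left : Recurrence 1 (λ n → ∂ (f₆ (2 + n))) (λ n i → f₂ (1 + n) i + ∂ (w (1 + n)) i + ∂ (w n) i)
  left n zero    = trans (cong (λ z → z + 0 + 0) (f₂-recurrence (suc n) 0)) (arith (f₂ (2 + n) 0))
    where
    arith : ∀ a → 1 * a + 8 * 0 + 0 + 0 + 0 ≡ 1 * (a + 0 + 0) + 8 * 0 + 0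
    arith = solve-∀
  left n (suc i) = trans (cong (λ z → z + w (3 + n) i + w (2 + n) i) (f₂-recurrence (suc n) (suc i)))
    (arith (f₂ (2 + n) (suc i)) (w (2 + n) i) (w (1 + n) i) (f₂ (1 + n) i)
           (∂ (w (1 + n)) i) (∂ (w n) i) (f₆ (2 + n) i))
    where
    arith : ∀ a b c d e g h → 1 * a + 8 * d + h + (1 * b + 8 * e + 0) + (1 * c + 8 * g + 0)
                              ≡ 1 * (a + b + c) + 8 * (d + e + g) + h
    arith = solve-∀

  right : Recurrence 1 (λ n → ∂ (f₆ (2 + n))) (λ n i → ∂ (u (1 + n)) i + 2 * ∂ (u n) i + w (1 + n) i + w n i)
  right n zero    = arith (w (2 + n) 0) (w (1 + n) 0)
    where
    arith : ∀ b c → 0 + 2 * 0 + (1 * b + 8 * 0 + 0) + (1 * c + 8 * 0 + 0) ≡ 1 * (0 + 2 * 0 + b + c) + 8 * 0 + 0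
    arith = solve-∀
  right n (suc i) = trans
    (arith (u (2 + n) i) (u (1 + n) i) (∂ (u (1 + n)) i) (∂ (u n) i)
           (w (2 + n) (suc i)) (w (1 + n) (suc i)) (w (1 + n) i) (w n i))
    (cong (1 * (u (2 + n) i + 2 * u (1 + n) i + w (2 + n) (suc i) + w (1 + n) (suc i))
           + 8 * (∂ (u (1 + n)) i + 2 * ∂ (u n) i + w (1 + n) i + w n i) +_) (sym (f₆-closed (suc n) i)))
    where
    arith : ∀ a b c d e f g h →
      2 * a + 8 * c + 0 + 2 * (2 * b + 8 * d + 0) + (1 * e + 8 * g + 0) + (1 * f + 8 * h + 0)
      ≡ 1 * (a + 2 * b + e + f) + 8 * (c + 2 * d + g + h) + (a + 2 * b)
    arith = solve-∀

  zeroth : ∀ i → f₂ 1 i + ∂ (w 1) i + ∂ (w 0) i ≡ ∂ (u 1) i + 2 * ∂ (u 0) i + w 1 i + w 0 i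
  zeroth zero    = cong (λ z → z + 0 + 0) (f₂-one 0)
  zeroth (suc i) = trans (cong (λ z → z + δ i + δ i) (f₂-one (suc i))) (value (δ (suc i)) (δ i))
    where
    value : ∀ d e → 2 * d + 2 * e + e + e ≡ 2 * e + 2 * e + d + d
    value = solve-∀

  first : ∀ i → f₂ 2 i + ∂ (w 2) i + ∂ (w 1) i ≡ ∂ (u 2) i + 2 * ∂ (u 1) i + w 2 i + w 1 i
  first zero    rewrite f₂-recurrence 0 0 | f₂-one 0 = refl
  first (suc i) rewrite f₂-recurrence 0 (suc i) | f₂-one (suc i) | zero₂ i | f₆-closed 0 i =
    value (δ (suc i)) (δ i) (∂ δ i)
    where
    value : ∀ d e g → 1 * (2 * d + 2 * e) + 8 * e + (2 * e + 2 * e) + (1 * e + 8 * g + 0) + e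
                      ≡ 2 * (2 * e) + 8 * g + 0 + 2 * (2 * e) + (1 * d + 8 * e + 0) + d
    value = solve-∀

-- The row of `f₄` and x times the row of `f₈` differ only in their diagonal terms, so the
-- difference of `f₄` and x `f₈` keeps its initial value 1 - x.
f₄-f₈ : ∀ n i → f₄ n i + ∂ δ i ≡ ∂ (f₈ n) i + δ i
f₄-f₈ zero    i = trans (cong (_+ ∂ δ i) (zero₄ i))
  (trans (swap (δ i) (∂ δ i)) (cong (_+ δ i) (sym (delay-cong 1 zero₈ i))))
  where
  swap : ∀ a b → a + b ≡ b + a
  swap = solve-∀
f₄-f₈ (suc n) i = cancel-by (f₄-f₈ n i) (trans
  (cong₂ (λ y z → y + ∂ δ i + z) (suc₄ n i) refl)
  (trans (arith (∂ (f₉ n) i) (f₄ n i) (∂ (f₁₀ n) i) (∂ (f₈ n) i) (δ i) (∂ δ i))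
    (cong (λ z → z + δ i + (f₄ n i + ∂ δ i)) (sym (∂suc₈ n i)))))
  where
  arith : ∀ a b c d e g → a + (b + (c + (a + 0))) + g + (d + e) ≡ a + (d + (c + (a + 0))) + e + (b + g)
  arith = solve-∀

-- The generating function of `f₈` is that of `f₁₀` plus 2 (1 - x) T (1 + T) W / (1 - T).
-- Multiplying by 2x splits the fraction: 4xT (1 + T) W / (1 - T) = (1 + 4xT) W - 1 / (1 - T), so
-- that only w and constants appear.
f₈-closed : ∀ n i → 2 * ∂ (f₈ (1 + n)) i + ∂ (w (1 + n)) i + 4 * ∂ (∂ (w n)) i + δ i
                    ≡ 2 * ∂ (f₁₀ (1 + n)) i + w (1 + n) i + 4 * ∂ (w n) i + ∂ δ i
f₈-closed zero zero    = refl
f₈-closed zero (suc i) rewrite suc₈ 0 i | zero₉ i | zero₈ i | zero₁₀ i | f₁₀-closed 0 i =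
  value (δ (suc i)) (δ i) (∂ δ i)
  where
  value : ∀ c d e → 2 * (d + (d + (d + (d + 0)))) + d + 4 * e + c ≡ 2 * (2 * d + 2 * e) + c + 4 * d + d
  value = solve-∀
f₈-closed (suc n) zero    = trans (f₈-closed n zero) (arith (w (1 + n) 0))
  where
  arith : ∀ a → 2 * 0 + a + 4 * 0 + 0 ≡ 2 * 0 + (1 * a + 8 * 0 + 0) + 4 * 0 + 0
  arith = solve-∀
f₈-closed (suc n) (suc i) = cancel-by
  -- Twice the row of `f₈` contains `f₉`, that is `f₂`, four times.
  (cong₂ (λ y z → y + 4 * z) (f₈-closed n (suc i)) (f₂-closed n i))
  (arith (f₂ (1 + n) i) (f₈ (1 + n) i) (u (1 + n) i) (∂ (u n) i) (∂ (u (1 + n)) i)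
         (w (1 + n) i) (∂ (w n) i) (∂ (w (1 + n)) i) (w (1 + n) (suc i)) (w n i) (δ i)
         (suc₈ (suc n) i) (f₉≡f₂ (suc n) i) (f₁₀-closed n i) (f₁₀-closed (suc n) i))
  where
  ring : ∀ f₂′ f₈′ u′ ∂u ∂u′ w′ ∂w ∂w′ w′s w d →
    2 * (f₂′ + (f₈′ + (u′ + 2 * ∂u + (f₂′ + 0)))) + (1 * w′ + 8 * ∂w + 0) + 4 * ∂w′ + 0
      + (2 * (u′ + 2 * ∂u) + w′s + 4 * w + d + 4 * (∂u′ + 2 * ∂u + w′ + w))
    ≡ 2 * (2 * u′ + 8 * ∂u + 0 + 2 * ∂u′) + (1 * w′s + 8 * w + 0) + 4 * w′ + d
      + (2 * f₈′ + w′ + 4 * ∂w + 0 + 4 * (f₂′ + ∂w′ + ∂w))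
  ring = solve-∀

  arith : ∀ {f₈″ f₉′ f₁₀′ f₁₀″} f₂′ f₈′ u′ ∂u ∂u′ w′ ∂w ∂w′ w′s w d →
    f₈″ ≡ f₉′ + (f₈′ + (f₁₀′ + (f₉′ + 0))) → f₉′ ≡ f₂′ → f₁₀′ ≡ u′ + 2 * ∂u →
    f₁₀″ ≡ 2 * u′ + 8 * ∂u + 0 + 2 * ∂u′ →
    2 * f₈″ + (1 * w′ + 8 * ∂w + 0) + 4 * ∂w′ + 0
      + (2 * f₁₀′ + w′s + 4 * w + d + 4 * (∂u′ + 2 * ∂u + w′ + w))
    ≡ 2 * f₁₀″ + (1 * w′s + 8 * w + 0) + 4 * w′ + d
      + (2 * f₈′ + w′ + 4 * ∂w + 0 + 4 * (f₂′ + ∂w′ + ∂w))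
  arith f₂′ f₈′ u′ ∂u ∂u′ w′ ∂w ∂w′ w′s w d refl refl refl refl = ring f₂′ f₈′ u′ ∂u ∂u′ w′ ∂w ∂w′ w′s w d

∂suc₃ : ∀ n i → ∂ (f₃ (suc n)) i ≡ ∂ (f₀ n) i + (∂ (∂ (f₈ n)) i + (∂ (∂ (f₈ n)) i + (∂ (f₀ n) i + 0)))
∂suc₃ n zero    = refl
∂suc₃ n (suc i) = suc₃ n i

∂f₄-f₈ : ∀ n i → ∂ (f₄ n) i + ∂ (∂ δ) i ≡ ∂ (∂ (f₈ n)) i + ∂ δ i
∂f₄-f₈ n zero    = refl
∂f₄-f₈ n (suc i) = f₄-f₈ n i

f₀-recurrence : ∀ n i → f₀ (2 + n) i + 2 * ∂ (∂ δ) i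
  ≡ 4 * ∂ (f₀ n) i + 4 * ∂ (∂ (f₈ n)) i + 2 * ∂ δ i + 2 * ∂ (f₂ (1 + n)) i
f₀-recurrence n i = begin
  f₀ (2 + n) i + 2 * ∂ (∂ δ) i
    ≡⟨ cong (_+ 2 * ∂ (∂ δ) i) (suc₀ (suc n) i) ⟩
  f₁ (1 + n) i + (q + (q + (∂ (f₃ (1 + n)) i + 0))) + 2 * ∂ (∂ δ) i
    ≡⟨ cong₂ (λ y z → y + (q + (q + (z + 0))) + 2 * ∂ (∂ δ) i) (suc₁ n i) (∂suc₃ n i) ⟩
  _ ≡⟨ arith (∂ (f₀ n) i) (∂ (f₄ n) i) q (∂ (∂ (f₈ n)) i) (∂ (∂ δ) i) ⟩
  4 * ∂ (f₀ n) i + 2 * (∂ (f₄ n) i + ∂ (∂ δ) i) + 2 * ∂ (∂ (f₈ n)) i + 2 * q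
    ≡⟨ cong (λ y → 4 * ∂ (f₀ n) i + 2 * y + 2 * ∂ (∂ (f₈ n)) i + 2 * q) (∂f₄-f₈ n i) ⟩
  _ ≡⟨ arith′ (∂ (f₀ n) i) (∂ (∂ (f₈ n)) i) (∂ δ i) q ⟩
  4 * ∂ (f₀ n) i + 4 * ∂ (∂ (f₈ n)) i + 2 * ∂ δ i + 2 * q ∎
  where
  open ≡-Reasoning
  q = ∂ (f₂ (1 + n)) i
  arith : ∀ a b q c d → a + (b + (b + (a + 0))) + (q + (q + (a + (c + (c + (a + 0))) + 0))) + 2 * d
                        ≡ 4 * a + 2 * (b + d) + 2 * c + 2 * q
  arith = solve-∀
  arith′ : ∀ a c e q → 4 * a + 2 * (c + e) + 2 * c + 2 * q ≡ 4 * a + 4 * c + 2 * e + 2 * q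
  arith′ = solve-∀

∂u-recurrence : ∀ n i → ∂ (u (2 + n)) i ≡ 2 * ∂ (u (1 + n)) i + 8 * ∂ (∂ (u n)) i
∂u-recurrence n zero    = refl
∂u-recurrence n (suc i) = +-identityʳ _

∂w-recurrence : ∀ n i → ∂ (w (2 + n)) i ≡ ∂ (w (1 + n)) i + 8 * ∂ (∂ (w n)) i
∂w-recurrence n zero    = refl
∂w-recurrence n (suc i) = arith (w (1 + n) i) (∂ (w n) i)
  where
  arith : ∀ a b → 1 * a + 8 * b + 0 ≡ a + 8 * b
  arith = solve-∀

∂f₁₀-closed : ∀ n i → ∂ (f₁₀ (1 + n)) i ≡ ∂ (u (1 + n)) i + 2 * ∂ (∂ (u n)) i
∂f₁₀-closed n zero    = refl
∂f₁₀-closed n (suc i) = f₁₀-closed n i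

-- c⁺ - c⁻ is the coefficient of (1 + (1 - 3x) T) / (1 - 4xT²).
c⁺ c⁻ : ℕ → ℕ → ℕ
c⁺ zero          i = δ i
c⁺ (suc zero)    i = δ i
c⁺ (suc (suc n)) i = 4 * ∂ (c⁺ n) i
c⁻ zero          i = 0
c⁻ (suc zero)    i = 3 * ∂ δ i
c⁻ (suc (suc n)) i = 4 * ∂ (c⁻ n) i

f₀-closed : ∀ n i → f₀ (1 + n) i + 6 * ∂ (∂ (w n)) i + c⁻ (1 + n) i
                    ≡ 6 * ∂ (∂ (u n)) i + 6 * ∂ (w n) i + c⁺ (1 + n) i
f₀-closed zero i rewrite suc₀ 0 i | zero₁ i | delay-cong 1 zero₂ i | delay-cong 1 zero₃ i =
  value (δ i) (∂ δ i) (∂ (∂ δ) i)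
  where
  value : ∀ d e g → d + (e + (e + (e + 0))) + 6 * g + 3 * e ≡ 6 * g + 6 * e + d
  value = solve-∀
f₀-closed (suc zero) zero    = trans (drop (f₀ 2 0)) (f₀-recurrence 0 0)
  where
  drop : ∀ a → a + 6 * 0 + 4 * 0 ≡ a + 2 * 0
  drop = solve-∀
f₀-closed (suc zero) (suc i) = cancel-by (f₀-recurrence 0 (suc i))
  (arith (f₀ 2 (suc i)) (δ i) (∂ δ i) (zero₀ i) (delay-cong 1 zero₈ i) (f₂-one i) (∂u₁ i))
  where
  ∂u₁ : ∀ i → ∂ (u 1) i ≡ 2 * ∂ δ i
  ∂u₁ zero    = refl
  ∂u₁ (suc i) = refl

  ring : ∀ f d e → f + 6 * e + 4 * 0 + (4 * d + 4 * e + 2 * d + 2 * (2 * d + 2 * e))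
                   ≡ 6 * (2 * e) + 6 * d + 4 * d + (f + 2 * e)
  ring = solve-∀

  arith : ∀ {f₀′ f₈′ f₂′ u′} f d e → f₀′ ≡ d → f₈′ ≡ e → f₂′ ≡ 2 * d + 2 * e → u′ ≡ 2 * e →
    f + 6 * e + 4 * 0 + (4 * f₀′ + 4 * f₈′ + 2 * d + 2 * f₂′) ≡ 6 * u′ + 6 * d + 4 * d + (f + 2 * e)
  arith f d e refl refl refl refl = ring f d e

f₀-closed (suc (suc n)) zero    = trans (drop (f₀ (3 + n) 0)) (f₀-recurrence (1 + n) 0)
  where
  drop : ∀ a → a + 6 * 0 + 4 * 0 ≡ a + 2 * 0
  drop = solve-∀
f₀-closed (suc (suc n)) (suc i) = cancel-by
  -- The weights are the coefficients in `f₀-recurrence`: 4 for `f₀`, 2 for `f₂`, and 4 for `f₈`, of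
  -- which `f₈-closed` already supplies a factor 2.
  (cong₂ _+_ (cong₂ (λ y z → y + 4 * z) (f₀-recurrence (1 + n) (suc i)) (f₀-closed n i))
             (cong₂ (λ y z → 2 * y + 2 * z) (f₈-closed n i) (f₂-closed (1 + n) i)))
  (arith (f₀ (3 + n) (suc i)) (f₀ (1 + n) i) (∂ (f₈ (1 + n)) i) (f₂ (2 + n) i) (c⁺ (1 + n) i) (c⁻ (1 + n) i)
         (∂ (u (1 + n)) i) (∂ (∂ (u n)) i) (w (1 + n) i) (∂ (w n) i) (∂ (w (1 + n)) i) (∂ (∂ (w n)) i)
         (δ i) (∂ δ i)
         (∂f₁₀-closed n i) (∂u-recurrence n i) (∂w-recurrence n i))
  where
  ring : ∀ f₀″ f₀′ f₈′ f₂″ c⁺ c⁻ ∂u′ ∂∂u w′ ∂w ∂w′ ∂∂w d e →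
    f₀″ + 6 * (∂w′ + 8 * ∂∂w) + 4 * c⁻
      + (4 * f₀′ + 4 * f₈′ + 2 * d + 2 * f₂″ + 4 * (6 * ∂∂u + 6 * ∂w + c⁺)
         + (2 * (2 * (∂u′ + 2 * ∂∂u) + w′ + 4 * ∂w + e)
            + 2 * (2 * ∂u′ + 8 * ∂∂u + 2 * ∂u′ + (1 * w′ + 8 * ∂w + 0) + w′)))
    ≡ 6 * (2 * ∂u′ + 8 * ∂∂u) + 6 * (1 * w′ + 8 * ∂w + 0) + 4 * c⁺
      + (f₀″ + 2 * e + 4 * (f₀′ + 6 * ∂∂w + c⁻)
         + (2 * (2 * f₈′ + ∂w′ + 4 * ∂∂w + d) + 2 * (f₂″ + (∂w′ + 8 * ∂∂w) + ∂w′)))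
  ring = solve-∀

  arith : ∀ {f₁₀′ u″ w″} f₀″ f₀′ f₈′ f₂″ c⁺ c⁻ ∂u′ ∂∂u w′ ∂w ∂w′ ∂∂w d e →
    f₁₀′ ≡ ∂u′ + 2 * ∂∂u → u″ ≡ 2 * ∂u′ + 8 * ∂∂u → w″ ≡ ∂w′ + 8 * ∂∂w →
    f₀″ + 6 * w″ + 4 * c⁻
      + (4 * f₀′ + 4 * f₈′ + 2 * d + 2 * f₂″ + 4 * (6 * ∂∂u + 6 * ∂w + c⁺)
         + (2 * (2 * f₁₀′ + w′ + 4 * ∂w + e) + 2 * (u″ + 2 * ∂u′ + (1 * w′ + 8 * ∂w + 0) + w′)))
    ≡ 6 * u″ + 6 * (1 * w′ + 8 * ∂w + 0) + 4 * c⁺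
      + (f₀″ + 2 * e + 4 * (f₀′ + 6 * ∂∂w + c⁻)
         + (2 * (2 * f₈′ + ∂w′ + 4 * ∂∂w + d) + 2 * (f₂″ + w″ + ∂w′)))
  arith f₀″ f₀′ f₈′ f₂″ c⁺ c⁻ ∂u′ ∂∂u w′ ∂w ∂w′ ∂∂w d e refl refl refl =
    ring f₀″ f₀′ f₈′ f₂″ c⁺ c⁻ ∂u′ ∂∂u w′ ∂w ∂w′ ∂∂w d e

-- Coefficients
double : ℕ → ℕ
double zero    = zero
double (suc j) = suc (suc (double j))

-- binomial r j is (r + j) C j.
binomial : ℕ → ℕ → ℕ
binomial zero    j       = 1
binomial (suc r) zero    = 1
binomial (suc r) (suc j) = binomial r (suc j) + binomial (suc r) j

u-zero : ∀ n i → n < double i → u n i ≡ 0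
u-zero zero          (suc i) _ = refl
u-zero (suc zero)    (suc i) _ = refl
u-zero (suc (suc n)) (suc i) (s≤s (s≤s lt)) =
  cong₂ (λ a b → 2 * a + 8 * b + 0) (u-zero (suc n) (suc i) (m<n⇒m<1+n (s<s lt))) (u-zero n i lt)

w-zero : ∀ n i → n < double i → w n i ≡ 0
w-zero zero          (suc i) _ = refl
w-zero (suc zero)    (suc i) _ = refl
w-zero (suc (suc n)) (suc i) (s≤s (s≤s lt)) =
  cong₂ (λ a b → 1 * a + 8 * b + 0) (w-zero (suc n) (suc i) (m<n⇒m<1+n (s<s lt))) (w-zero n i lt)

binomial-zero : ∀ r → binomial r 0 ≡ 1
binomial-zero zero    = refl
binomial-zero (suc r) = refl

-- Expanding U as a geometric series, the coefficient collects the arrangements of r factors 2T and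
-- j factors 8xT²; the recurrence becomes Pascal's rule.
u-value : ∀ r j → u (double j + r) j ≡ 2 ^ r * 8 ^ j * binomial r j
u-value r zero = trans (initial r) (trans (tidy (2 ^ r)) (cong (2 ^ r * 1 *_) (sym (binomial-zero r))))
  where
  tidy : ∀ a → a ≡ a * 1 * 1
  tidy = solve-∀
  twice : ∀ a → 2 * a + 8 * 0 + 0 ≡ 2 * a
  twice = solve-∀
  initial : ∀ r → u r 0 ≡ 2 ^ r
  initial zero          = refl
  initial (suc zero)    = refl
  initial (suc (suc r)) = trans (twice (u (suc r) 0)) (cong (2 *_) (initial (suc r)))
u-value zero (suc j) = trans
  (cong₂ (λ a b → 2 * a + 8 * b + 0)
    (u-zero _ (suc j) (s<s (s≤s (≤-reflexive (+-identityʳ (double j)))))) (u-value zero j))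
  (tidy (8 ^ j))
  where
  tidy : ∀ a → 2 * 0 + 8 * (1 * a * 1) + 0 ≡ 1 * (8 * a) * 1
  tidy = solve-∀
u-value (suc r) (suc j) = trans
  (cong₂ (λ a b → 2 * a + 8 * b + 0)
    (trans (cong (λ k → u (suc k) (suc j)) (+-suc (double j) r)) (u-value r (suc j))) (u-value (suc r) j))
  (tidy (2 ^ r) (8 ^ j) (binomial r (suc j)) (binomial (suc r) j))
  where
  tidy : ∀ a b c d → 2 * (a * (8 * b) * c) + 8 * (2 * a * b * d) + 0 ≡ 2 * a * (8 * b) * (c + d)
  tidy = solve-∀

w-value : ∀ r j → w (double j + r) j ≡ 8 ^ j * binomial r j
w-value r zero = trans (initial r) (trans (sym (*-identityˡ 1)) (cong (1 *_) (sym (binomial-zero r))))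
  where
  once : ∀ a → 1 * a + 8 * 0 + 0 ≡ a
  once = solve-∀
  initial : ∀ r → w r 0 ≡ 1
  initial zero          = refl
  initial (suc zero)    = refl
  initial (suc (suc r)) = trans (once (w (suc r) 0)) (initial (suc r))
w-value zero (suc j) = trans
  (cong₂ (λ a b → 1 * a + 8 * b + 0)
    (w-zero _ (suc j) (s<s (s≤s (≤-reflexive (+-identityʳ (double j)))))) (w-value zero j))
  (tidy (8 ^ j))
  where
  tidy : ∀ a → 1 * 0 + 8 * (a * 1) + 0 ≡ 8 * a * 1
  tidy = solve-∀
w-value (suc r) (suc j) = trans
  (cong₂ (λ a b → 1 * a + 8 * b + 0)
    (trans (cong (λ k → w (suc k) (suc j)) (+-suc (double j) r)) (w-value r (suc j))) (w-value (suc r) j))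
  (tidy (8 ^ j) (binomial r (suc j)) (binomial (suc r) j))
  where
  tidy : ∀ b c d → 1 * (8 * b * c) + 8 * (b * d) + 0 ≡ 8 * b * (c + d)
  tidy = solve-∀

c⁺-peel : ∀ j n i → c⁺ (double j + n) (j + i) ≡ 4 ^ j * c⁺ n i
c⁺-peel zero    n i = sym (*-identityˡ (c⁺ n i))
c⁺-peel (suc j) n i = trans (cong (4 *_) (c⁺-peel j n i)) (sym (*-assoc 4 (4 ^ j) (c⁺ n i)))

c⁻-peel : ∀ j n i → c⁻ (double j + n) (j + i) ≡ 4 ^ j * c⁻ n i
c⁻-peel zero    n i = sym (*-identityˡ (c⁻ n i))
c⁻-peel (suc j) n i = trans (cong (4 *_) (c⁻-peel j n i)) (sym (*-assoc 4 (4 ^ j) (c⁻ n i)))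

-- The factor 2 ^ r - 1: U contributes 2 ^ r, and the negative part of (1 - x) W takes away 1.
mersenne : ℕ → ℕ
mersenne zero    = 0
mersenne (suc r) = 1 + 2 * mersenne r

2^-mersenne : ∀ r → 2 ^ r ≡ 1 + mersenne r
2^-mersenne zero    = refl
2^-mersenne (suc r) = trans (cong (2 *_) (2^-mersenne r)) (tidy (mersenne r))
  where
  tidy : ∀ a → 2 * (1 + a) ≡ 1 + (1 + 2 * a)
  tidy = solve-∀

-- (r + j ∸ 1) C (j + 1), the term of W one genus higher.
binomial₂ : ℕ → ℕ → ℕ
binomial₂ zero          j = 0
binomial₂ (suc zero)    j = 0
binomial₂ (suc (suc r)) j = binomial r (suc j)

y : ℕ → ℕ → ℕ
y r j = mersenne r * binomial r j + 8 * binomial₂ r j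

w-value₂ : ∀ r j → w (double j + r) (suc j) ≡ 8 ^ suc j * binomial₂ r j
w-value₂ zero j = trans (w-zero _ (suc j) (s≤s (m≤n⇒m≤1+n (≤-reflexive (+-identityʳ (double j))))))
  (sym (*-zeroʳ (8 ^ suc j)))
w-value₂ (suc zero) j = trans
  (w-zero _ (suc j) (≤-reflexive (cong suc (trans (+-suc (double j) 0) (cong suc (+-identityʳ _))))))
  (sym (*-zeroʳ (8 ^ suc j)))
w-value₂ (suc (suc r)) j = trans
  (cong (λ n → w n (suc j)) (trans (+-suc (double j) (suc r)) (cong suc (+-suc (double j) r))))
  (w-value r (suc j))

-- Coordinates along which the coefficients are single binomial expressions. For fixed n, raising
-- the genus by one leads from (2 + s, j) to (s, 1 + j).
G : ℕ → ℕ → ℕ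
G r j = f₀ (1 + (double j + r)) (2 + j)

G-value : ∀ r j → G r j + 4 ^ j * c⁻ (1 + r) 2 ≡ 6 * (8 ^ j * y r j) + 4 ^ j * c⁺ (1 + r) 2
G-value r j = cancel-by (cong (6 *_) (w-value r j)) (begin
  G r j + 4 ^ j * c⁻ (1 + r) 2 + 6 * (8 ^ j * b)
    ≡⟨ cong₂ (λ a c → G r j + a + 6 * c) (sym (peel⁻)) (sym (w-value r j)) ⟩
  G r j + c⁻ (1 + m) (2 + j) + 6 * w m j
    ≡⟨ swap (G r j) (c⁻ (1 + m) (2 + j)) (6 * w m j) ⟩
  G r j + 6 * w m j + c⁻ (1 + m) (2 + j)
    ≡⟨ f₀-closed m (2 + j) ⟩
  6 * u m j + 6 * w m (1 + j) + c⁺ (1 + m) (2 + j)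
    ≡⟨ cong₂ _+_ (cong₂ (λ a c → 6 * a + 6 * c)
         (trans (u-value r j) (cong (λ a → a * 8 ^ j * b) (2^-mersenne r))) (w-value₂ r j)) peel⁺ ⟩
  6 * ((1 + mersenne r) * 8 ^ j * b) + 6 * (8 * 8 ^ j * binomial₂ r j) + 4 ^ j * c⁺ (1 + r) 2
    ≡⟨ tidy (mersenne r) (8 ^ j) b (binomial₂ r j) (4 ^ j * c⁺ (1 + r) 2) ⟩
  6 * (8 ^ j * y r j) + 4 ^ j * c⁺ (1 + r) 2 + 6 * (8 ^ j * b)
    ≡⟨ cong (λ a → 6 * (8 ^ j * y r j) + 4 ^ j * c⁺ (1 + r) 2 + 6 * a) (sym (w-value r j)) ⟩
  6 * (8 ^ j * y r j) + 4 ^ j * c⁺ (1 + r) 2 + 6 * w m j ∎)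
  where
  open ≡-Reasoning
  m = double j + r
  b = binomial r j
  peel⁻ : c⁻ (1 + m) (2 + j) ≡ 4 ^ j * c⁻ (1 + r) 2
  peel⁻ = trans (cong₂ c⁻ (sym (+-suc (double j) r)) (+-comm 2 j)) (c⁻-peel j (1 + r) 2)
  peel⁺ : c⁺ (1 + m) (2 + j) ≡ 4 ^ j * c⁺ (1 + r) 2
  peel⁺ = trans (cong₂ c⁺ (sym (+-suc (double j) r)) (+-comm 2 j)) (c⁺-peel j (1 + r) 2)
  swap : ∀ a b c → a + b + c ≡ a + c + b
  swap = solve-∀
  tidy : ∀ q e b b₂ c →
    6 * ((1 + q) * e * b) + 6 * (8 * e * b₂) + c ≡ 6 * (e * (q * b + 8 * b₂)) + c + 6 * (e * b)
  tidy = solve-∀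

-- The absorption identities, proved together because Pascal's rule leads from each to the other.
binomial-sucˡ : ∀ r j → binomial (suc r) j * suc r ≡ binomial r j * (r + suc j)
binomial-sucʳ : ∀ r j → binomial r (suc j) * suc j ≡ binomial r j * (r + suc j)

binomial-sucˡ r zero    = trans (*-identityˡ (suc r))
  (trans (sym (+-comm r 1)) (trans (sym (*-identityˡ (r + 1))) (cong (_* (r + 1)) (sym (binomial-zero r)))))
binomial-sucˡ r (suc j) = trans (*-distribʳ-+ (suc r) (binomial r (suc j)) (binomial (suc r) j))
  (trans (cong (binomial r (suc j) * suc r +_) (trans (binomial-sucˡ r j) (sym (binomial-sucʳ r j))))
    (tidy (binomial r (suc j)) r j))
  where
  tidy : ∀ b r j → b * (1 + r) + b * (1 + j) ≡ b * (r + (2 + j))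
  tidy = solve-∀

binomial-sucʳ zero    j       = refl
binomial-sucʳ (suc r) zero    = trans (*-identityʳ (binomial r 1 + 1))
  (trans (cong (_+ 1) (trans (sym (*-identityʳ (binomial r 1))) (binomial-sucʳ r zero)))
  (trans (cong (λ b → b * (r + 1) + 1) (binomial-zero r)) (tidy r)))
  where
  tidy : ∀ r → 1 * (r + 1) + 1 ≡ 1 * (1 + r + 1)
  tidy = solve-∀
binomial-sucʳ (suc r) (suc j) = trans
  (tidy (binomial r (2 + j)) (binomial (suc r) (suc j)) j)
  (trans (cong (_+ binomial (suc r) (suc j) * (2 + j))
      (trans (binomial-sucʳ r (suc j)) (sym (binomial-sucˡ r (suc j)))))
    (tidy′ (binomial (suc r) (suc j)) r j))
  where
  tidy : ∀ a b j → (a + b) * (2 + j) ≡ a * (2 + j) + b * (2 + j)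
  tidy = solve-∀
  tidy′ : ∀ b r j → b * (1 + r) + b * (2 + j) ≡ b * (1 + r + (2 + j))
  tidy′ = solve-∀

binomial₂-value : ∀ s j → binomial s j * (s * pred s) ≡ binomial₂ s j * ((s + j) * suc j)
binomial₂-value zero          j = *-zeroʳ (binomial zero j)
binomial₂-value (suc zero)    j = *-zeroʳ (binomial 1 j)
binomial₂-value (suc (suc r)) j = begin
  binomial (2 + r) j * ((2 + r) * suc r)         ≡⟨ tidy₁ (binomial (2 + r) j) r ⟩
  binomial (2 + r) j * (2 + r) * suc r           ≡⟨ cong (_* suc r) (binomial-sucˡ (suc r) j) ⟩
  binomial (suc r) j * (suc r + suc j) * suc r   ≡⟨ tidy₂ (binomial (suc r) j) r j ⟩
  binomial (suc r) j * suc r * (2 + r + j)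
    ≡⟨ cong (_* (2 + r + j)) (trans (binomial-sucˡ r j) (sym (binomial-sucʳ r j))) ⟩
  binomial r (suc j) * suc j * (2 + r + j)       ≡⟨ tidy₃ (binomial r (suc j)) r j ⟩
  binomial r (suc j) * ((2 + r + j) * suc j)     ∎
  where
  open ≡-Reasoning
  tidy₁ : ∀ b r → b * ((2 + r) * (1 + r)) ≡ b * (2 + r) * (1 + r)
  tidy₁ = solve-∀
  tidy₂ : ∀ b r j → b * (1 + r + (1 + j)) * (1 + r) ≡ b * (1 + r) * (2 + r + j)
  tidy₂ = solve-∀
  tidy₃ : ∀ b r j → b * (1 + j) * (2 + r + j) ≡ b * ((2 + r + j) * (1 + j))
  tidy₃ = solve-∀

-- Ratios of coefficients
binomial-positive : ∀ r j → 0 < binomial r j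
binomial-positive zero    j       = z<s
binomial-positive (suc r) zero    = z<s
binomial-positive (suc r) (suc j) = ≤-trans (binomial-positive r (suc j)) (m≤m+n _ _)

-- After multiplication by X Y′ both sides of the comparison of y (2 + s) j
-- with 8 y s (1 + j) are multiples of one binomial coefficient.
module Ratio (s j : ℕ) where

  -- By `binomial₂-value`, b X = b₂ Y and b₂ X′ = b₂′ Y′. To leading order in Q the comparison is
  -- between Y and 2X.
  Q X Y X′ Y′ b b₂ b₂′ : ℕ
  Q   = mersenne s
  X   = (2 + s) * suc s
  Y   = (2 + s + j) * suc j
  X′  = s * pred s
  Y′  = (s + suc j) * suc (suc j)
  b   = binomial (2 + s) j
  b₂  = binomial s (suc j)
  b₂′ = binomial₂ s (suc j)

  scaled : y (2 + s) j * (X * Y′) ≡ b₂ * (Y′ * ((3 + 4 * Q) * Y + 8 * X))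
  scaled = trans (tidy Q b b₂ X Y′)
    (trans (cong (λ a → ((3 + 4 * Q) * a + 8 * b₂ * X) * Y′) (binomial₂-value (2 + s) j)) (tidy′ Q b₂ X Y Y′))
    where
    tidy : ∀ q b b₂ x y′ →
      ((1 + 2 * (1 + 2 * q)) * b + 8 * b₂) * (x * y′) ≡ ((3 + 4 * q) * (b * x) + 8 * b₂ * x) * y′
    tidy = solve-∀
    tidy′ : ∀ q b₂ x y y′ → ((3 + 4 * q) * (b₂ * y) + 8 * b₂ * x) * y′ ≡ b₂ * (y′ * ((3 + 4 * q) * y + 8 * x))
    tidy′ = solve-∀

  scaled′ : 8 * y s (suc j) * (X * Y′) ≡ b₂ * (X * (8 * Q * Y′ + 64 * X′))
  scaled′ = trans (tidy Q b₂ b₂′ X Y′)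
    (trans (cong (λ a → (8 * Q * b₂ * Y′ + 64 * a) * X) (sym (binomial₂-value s (suc j)))) (tidy′ Q b₂ X X′ Y′))
    where
    tidy : ∀ q b b₂ x y′ → 8 * (q * b + 8 * b₂) * (x * y′) ≡ (8 * q * b * y′ + 64 * (b₂ * y′)) * x
    tidy = solve-∀
    tidy′ : ∀ q b x x′ y′ → (8 * q * b * y′ + 64 * (b * x′)) * x ≡ b * (x * (8 * q * y′ + 64 * x′))
    tidy′ = solve-∀

  private
    instance
      b₂-nonZero : NonZero b₂
      b₂-nonZero = >-nonZero (binomial-positive s (suc j))

  rising-if : Y′ * ((3 + 4 * Q) * Y + 8 * X) < X * (8 * Q * Y′ + 64 * X′) → y (2 + s) j < 8 * y s (suc j)
  rising-if lt = *-cancelʳ-< (X * Y′) (y (2 + s) j) (8 * y s (suc j))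
    (subst₂ _<_ (sym scaled) (sym scaled′) (*-monoʳ-< b₂ lt))

  falling-if : X * (8 * Q * Y′ + 64 * X′) < Y′ * ((3 + 4 * Q) * Y + 8 * X) → 8 * y s (suc j) < y (2 + s) j
  falling-if lt = *-cancelʳ-< (X * Y′) (8 * y s (suc j)) (y (2 + s) j)
    (subst₂ _<_ (sym scaled′) (sym scaled) (*-monoʳ-< b₂ lt))

  -- For j ≤ s the leading terms differ by 4Q (2X - Y), which is at least 8Q (1 + s). The lower
  -- terms on the left are at most 3 · 2X + 8X = 14X, whence the constant 14.
  rising : j ≤ s → 14 * (2 + s) < 8 * Q → y (2 + s) j < 8 * y s (suc j)
  rising j≤s large = rising-if (begin-strict
    Y′ * ((3 + 4 * Q) * Y + 8 * X)   <⟨ *-monoʳ-< Y′ {{y′}} bracket ⟩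
    Y′ * (8 * Q * X)                 ≡⟨ tidy₄ Q X Y′ ⟩
    X * (8 * Q * Y′)                 ≤⟨ *-monoʳ-≤ X (m≤m+n (8 * Q * Y′) (64 * X′)) ⟩
    X * (8 * Q * Y′ + 64 * X′)       ∎)
    where
    open ≤-Reasoning
    tidy₀ : ∀ s → (2 + s + s) * (1 + s) + 2 * (1 + s) ≡ 2 * ((2 + s) * (1 + s))
    tidy₀ = solve-∀
    tidy₁ : ∀ q x y → (3 + 4 * q) * y + 8 * x ≡ 4 * q * y + (3 * y + 8 * x)
    tidy₁ = solve-∀
    tidy₂ : ∀ s → 3 * (2 * ((2 + s) * (1 + s))) + 8 * ((2 + s) * (1 + s)) ≡ 14 * (2 + s) * (1 + s)
    tidy₂ = solve-∀
    tidy₃ : ∀ q y s → 4 * q * y + 8 * q * (1 + s) ≡ 4 * q * (y + 2 * (1 + s))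
    tidy₃ = solve-∀
    tidy₄ : ∀ q x y′ → y′ * (8 * q * x) ≡ x * (8 * q * y′)
    tidy₄ = solve-∀
    tidy₅ : ∀ q x → 4 * q * (2 * x) ≡ 8 * q * x
    tidy₅ = solve-∀

    y′ : NonZero Y′
    y′ = >-nonZero (subst (0 <_) (cong (_* suc (suc j)) (sym (+-suc s j))) z<s)

    gap : Y + 2 * suc s ≤ 2 * X
    gap = begin
      Y + 2 * suc s
        ≤⟨ +-monoˡ-≤ (2 * suc s) (*-mono-≤ (+-monoʳ-≤ (2 + s) j≤s) (s≤s j≤s)) ⟩
      (2 + s + s) * suc s + 2 * suc s     ≡⟨ tidy₀ s ⟩
      2 * X                               ∎

    bracket : (3 + 4 * Q) * Y + 8 * X < 8 * Q * X
    bracket = begin-strict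
      (3 + 4 * Q) * Y + 8 * X              ≡⟨ tidy₁ Q X Y ⟩
      4 * Q * Y + (3 * Y + 8 * X)          ≤⟨ +-monoʳ-≤ (4 * Q * Y) (+-monoˡ-≤ (8 * X)
                                                (*-monoʳ-≤ 3 (≤-trans (m≤m+n Y (2 * suc s)) gap))) ⟩
      4 * Q * Y + (3 * (2 * X) + 8 * X)    ≡⟨ cong (4 * Q * Y +_) (tidy₂ s) ⟩
      4 * Q * Y + 14 * (2 + s) * suc s     <⟨ +-monoʳ-< (4 * Q * Y) (*-monoˡ-< (suc s) large) ⟩
      4 * Q * Y + 8 * Q * suc s            ≡⟨ tidy₃ Q Y s ⟩
      4 * Q * (Y + 2 * suc s)              ≤⟨ *-monoʳ-≤ (4 * Q) gap ⟩
      4 * Q * (2 * X)                      ≡⟨ tidy₅ Q X ⟩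
      8 * Q * X                            ∎

  -- Here Y is at least 2X + (2 + s), which leaves 14X + (3 + 4Q) (2 + s) over the leading term. To
  -- match it, 64X′ is split as 14 · 2X′ + 2 · 18X′: the first part is bounded by 2X′ ≤ Z, the
  -- second by the hypothesis, where Z is Y′ at j = s + 1.
  falling : suc s ≤ j → 18 * X′ < (3 + s) * (3 + 4 * Q) → 8 * y s (suc j) < y (2 + s) j
  falling s<j large = falling-if (begin-strict
    X * (8 * Q * Y′ + 64 * X′)                               ≡⟨ tidy₀ Q X X′ Y′ ⟩
    Y′ * (8 * Q * X) + (14 * X * (2 * X′) + 2 * X * (18 * X′))
      <⟨ +-monoʳ-< (Y′ * (8 * Q * X)) (+-mono-≤-< (*-monoʳ-≤ (14 * X) 2X′≤Z) (*-monoʳ-< (2 * X) large)) ⟩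
    Y′ * (8 * Q * X) + (14 * X * Z + 2 * X * ((3 + s) * (3 + 4 * Q)))
      ≡⟨ cong (Y′ * (8 * Q * X) +_) (tidy₁ Q s) ⟩
    Y′ * (8 * Q * X) + Z * (14 * X + (3 + 4 * Q) * (2 + s))
      ≤⟨ +-monoʳ-≤ (Y′ * (8 * Q * X)) (*-monoˡ-≤ (14 * X + (3 + 4 * Q) * (2 + s)) Z≤Y′) ⟩
    Y′ * (8 * Q * X) + Y′ * (14 * X + (3 + 4 * Q) * (2 + s)) ≡⟨ tidy₂ Q X Y′ s ⟩
    Y′ * ((3 + 4 * Q) * (2 * X + (2 + s)) + 8 * X)
      ≤⟨ *-monoʳ-≤ Y′ (+-monoˡ-≤ (8 * X) (*-monoʳ-≤ (3 + 4 * Q) gap)) ⟩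
    Y′ * ((3 + 4 * Q) * Y + 8 * X)                           ∎)
    where
    open ≤-Reasoning
    Z : ℕ
    Z = (s + (2 + s)) * (3 + s)

    tidy₀ : ∀ q x x′ y′ →
      x * (8 * q * y′ + 64 * x′) ≡ y′ * (8 * q * x) + (14 * x * (2 * x′) + 2 * x * (18 * x′))
    tidy₀ = solve-∀
    tidy₁ : ∀ q s → let x = (2 + s) * (1 + s); z = (s + (2 + s)) * (3 + s) in
      14 * x * z + 2 * x * ((3 + s) * (3 + 4 * q)) ≡ z * (14 * x + (3 + 4 * q) * (2 + s))
    tidy₁ = solve-∀
    tidy₂ : ∀ q x y′ s → y′ * (8 * q * x) + y′ * (14 * x + (3 + 4 * q) * (2 + s))
                         ≡ y′ * ((3 + 4 * q) * (2 * x + (2 + s)) + 8 * x)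
    tidy₂ = solve-∀
    tidy₃ : ∀ s → 2 * ((2 + s) * (1 + s)) + (2 + s) ≡ (2 + s + (1 + s)) * (2 + s)
    tidy₃ = solve-∀
    tidy₄ : ∀ s → 2 * (s * s) + (8 * s + 6) ≡ (s + (2 + s)) * (3 + s)
    tidy₄ = solve-∀

    gap : 2 * X + (2 + s) ≤ Y
    gap = begin
      2 * X + (2 + s)                 ≡⟨ tidy₃ s ⟩
      (2 + s + suc s) * (2 + s)       ≤⟨ *-mono-≤ (+-monoʳ-≤ (2 + s) s<j) (s≤s s<j) ⟩
      Y                               ∎

    Z≤Y′ : Z ≤ Y′
    Z≤Y′ = *-mono-≤ (+-monoʳ-≤ s (s≤s s<j)) (s≤s (s≤s s<j))

    2X′≤Z : 2 * X′ ≤ Z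
    2X′≤Z = begin
      2 * (s * pred s)         ≤⟨ *-monoʳ-≤ 2 (*-monoʳ-≤ s pred[n]≤n) ⟩
      2 * (s * s)              ≤⟨ m≤m+n _ (8 * s + 6) ⟩
      2 * (s * s) + (8 * s + 6) ≡⟨ tidy₄ s ⟩
      Z                        ∎

rising-bound : ∀ k → 14 * (2 + (5 + k)) < 8 * mersenne (5 + k)
rising-bound zero    = from-yes (14 * 7 <? 8 * 31)
rising-bound (suc k) = begin-strict
  14 * (2 + (6 + k))                             ≡⟨ tidy k ⟩
  14 * (2 + (5 + k)) + 14                        <⟨ +-monoˡ-< 14 (rising-bound k) ⟩
  8 * m + 14                                     ≤⟨ +-monoʳ-≤ (8 * m) (m≤m+n 14 2) ⟩
  8 * m + (8 + 8 * 1)                            ≤⟨ +-monoʳ-≤ (8 * m) (+-monoʳ-≤ 8 (*-monoʳ-≤ 8 positive)) ⟩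
  8 * m + (8 + 8 * m)                            ≡⟨ tidy′ m ⟩
  8 * (1 + 2 * m)                                ∎
  where
  open ≤-Reasoning
  m = mersenne (5 + k)
  positive : 1 ≤ m
  positive = s≤s z≤n
  tidy : ∀ k → 14 * (2 + (6 + k)) ≡ 14 * (2 + (5 + k)) + 14
  tidy = solve-∀
  tidy′ : ∀ m → 8 * m + (8 + 8 * m) ≡ 8 * (1 + 2 * m)
  tidy′ = solve-∀

falling-bound : ∀ s → 18 * (s * pred s) < (3 + s) * (3 + 4 * mersenne s)
falling-bound 0 = from-yes (0 <? 9)
falling-bound 1 = from-yes (0 <? 28)
falling-bound 2 = from-yes (36 <? 75)
falling-bound 3 = from-yes (108 <? 186)
falling-bound (suc (suc (suc (suc k)))) = begin-strict
  18 * ((4 + k) * (3 + k))                       <⟨ m<m+n _ z<s ⟩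
  18 * ((4 + k) * (3 + k)) + (225 + 63 * k)      ≡⟨ tidy k ⟩
  (7 + k) * (63 + 18 * k)                        ≤⟨ *-monoʳ-≤ (7 + k) (bound k) ⟩
  (7 + k) * (3 + 4 * mersenne (4 + k))           ∎
  where
  open ≤-Reasoning
  tidy : ∀ k → 18 * ((4 + k) * (3 + k)) + (225 + 63 * k) ≡ (7 + k) * (63 + 18 * k)
  tidy = solve-∀
  double-bound : ∀ k → 63 + 18 * (1 + k) + (46 + 18 * k) ≡ 2 * (63 + 18 * k) + 1
  double-bound = solve-∀
  next-mersenne : ∀ m → 2 * (3 + 4 * m) + 1 ≡ 3 + 4 * (1 + 2 * m)
  next-mersenne = solve-∀
  bound : ∀ k → 63 + 18 * k ≤ 3 + 4 * mersenne (4 + k)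
  bound zero    = ≤-refl
  bound (suc k) = begin
    63 + 18 * (1 + k)                     ≤⟨ m≤m+n _ (46 + 18 * k) ⟩
    63 + 18 * (1 + k) + (46 + 18 * k)     ≡⟨ double-bound k ⟩
    2 * (63 + 18 * k) + 1                 ≤⟨ +-monoˡ-≤ 1 (*-monoʳ-≤ 2 (bound k)) ⟩
    2 * (3 + 4 * mersenne (4 + k)) + 1    ≡⟨ next-mersenne (mersenne (4 + k)) ⟩
    3 + 4 * mersenne (5 + k)              ∎

-- Monotonicity
c⁻-constant : ∀ n → c⁻ n 0 ≡ 0
c⁻-constant zero          = refl
c⁻-constant (suc zero)    = refl
c⁻-constant (suc (suc n)) = refl

c⁻-quadratic : ∀ n → c⁻ (4 + n) 2 ≡ 0
c⁻-quadratic n = cong (λ a → 4 * (4 * a)) (c⁻-constant n)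

c⁺-quadratic : ∀ n → c⁺ n 2 ≤ 16
c⁺-quadratic 0 = z≤n
c⁺-quadratic 1 = z≤n
c⁺-quadratic 2 = z≤n
c⁺-quadratic 3 = z≤n
c⁺-quadratic 4 = ≤-refl
c⁺-quadratic 5 = ≤-refl
c⁺-quadratic (suc (suc (suc (suc (suc (suc n)))))) = z≤n

-- The corrections die out as r grows, the negative one from r = 3 on and the positive one from r =
-- 5 on. Hence the lower bound starts at 3 and equality at 5, while the excess is always at most 16
-- · 4 ^ j.
G-lower : ∀ k j → 6 * (8 ^ j * y (3 + k) j) ≤ G (3 + k) j
G-lower k j = begin
  6 * (8 ^ j * y (3 + k) j)                            ≤⟨ m≤m+n _ _ ⟩
  6 * (8 ^ j * y (3 + k) j) + 4 ^ j * c⁺ (4 + k) 2     ≡⟨ G-value (3 + k) j ⟨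
  G (3 + k) j + 4 ^ j * c⁻ (4 + k) 2                   ≡⟨ cong (λ a → G (3 + k) j + 4 ^ j * a) (c⁻-quadratic k) ⟩
  G (3 + k) j + 4 ^ j * 0                              ≡⟨ cong (G (3 + k) j +_) (*-zeroʳ (4 ^ j)) ⟩
  G (3 + k) j + 0                                      ≡⟨ +-identityʳ _ ⟩
  G (3 + k) j                                          ∎
  where open ≤-Reasoning

G-upper : ∀ r j → G r j ≤ 6 * (8 ^ j * y r j) + 4 ^ j * 16
G-upper r j = begin
  G r j                                           ≤⟨ m≤m+n _ _ ⟩
  G r j + 4 ^ j * c⁻ (1 + r) 2                    ≡⟨ G-value r j ⟩
  6 * (8 ^ j * y r j) + 4 ^ j * c⁺ (1 + r) 2
    ≤⟨ +-monoʳ-≤ (6 * (8 ^ j * y r j)) (*-monoʳ-≤ (4 ^ j) (c⁺-quadratic (1 + r))) ⟩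
  6 * (8 ^ j * y r j) + 4 ^ j * 16                ∎
  where open ≤-Reasoning

G-exact : ∀ k j → G (5 + k) j ≡ 6 * (8 ^ j * y (5 + k) j)
G-exact k j = ≤-antisym (begin
  G (5 + k) j                                          ≤⟨ m≤m+n _ _ ⟩
  G (5 + k) j + 4 ^ j * c⁻ (6 + k) 2                   ≡⟨ G-value (5 + k) j ⟩
  6 * (8 ^ j * y (5 + k) j) + 4 ^ j * 0                ≡⟨ cong (6 * (8 ^ j * y (5 + k) j) +_) (*-zeroʳ (4 ^ j)) ⟩
  6 * (8 ^ j * y (5 + k) j) + 0                        ≡⟨ +-identityʳ _ ⟩
  6 * (8 ^ j * y (5 + k) j)                            ∎) (G-lower (2 + k) j)
  where open ≤-Reasoning

8^-nonZero : ∀ j → NonZero (8 ^ j)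
8^-nonZero j = m^n≢0 8 j

at-least : ∀ (P : ℕ → Set) c → (∀ k → P (c + k)) → ∀ {n} → c ≤ n → P n
at-least P c f {n} c≤n = subst P (m+[n∸m]≡n c≤n) (f (n ∸ c))

G-rising : ∀ k j → j ≤ 5 + k → G (7 + k) j < G (5 + k) (1 + j)
G-rising k j j≤s = begin-strict
  G (7 + k) j                             ≡⟨ G-exact (2 + k) j ⟩
  6 * (8 ^ j * y (7 + k) j)               <⟨ *-monoʳ-< 6 (*-monoʳ-< (8 ^ j) {{8^-nonZero j}}
                                               (Ratio.rising (5 + k) j j≤s (rising-bound k))) ⟩
  6 * (8 ^ j * (8 * y (5 + k) (1 + j)))   ≡⟨ tidy (8 ^ j) (y (5 + k) (1 + j)) ⟩
  6 * (8 ^ (1 + j) * y (5 + k) (1 + j))   ≡⟨ G-exact k (1 + j) ⟨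
  G (5 + k) (1 + j)                       ∎
  where
  open ≤-Reasoning
  tidy : ∀ e y → 6 * (e * (8 * y)) ≡ 6 * (8 * e * y)
  tidy = solve-∀

power-bound : ∀ k → 64 * 4 ^ (5 + k) < 6 * 8 ^ (5 + k)
power-bound zero    = from-yes (64 * 4 ^ 5 <? 6 * 8 ^ 5)
power-bound (suc k) = begin-strict
  64 * (4 * a)        ≡⟨ tidy 64 a ⟩
  4 * (64 * a)        <⟨ *-monoʳ-< 4 (power-bound k) ⟩
  4 * (6 * b)         ≤⟨ m≤m+n _ (4 * (6 * b)) ⟩
  4 * (6 * b) + 4 * (6 * b)   ≡⟨ tidy′ b ⟩
  6 * (8 * b)         ∎
  where
  open ≤-Reasoning
  a = 4 ^ (5 + k)
  b = 8 ^ (5 + k)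
  tidy : ∀ c a → c * (4 * a) ≡ 4 * (c * a)
  tidy = solve-∀
  tidy′ : ∀ b → 4 * (6 * b) + 4 * (6 * b) ≡ 6 * (8 * b)
  tidy′ = solve-∀

-- By integrality the strict inequality for y leaves a gap of at least one, hence of 6 · 8 ^ j
-- between the coefficients, and this absorbs the correction 16 · 4 ^ (1 + j).
G-falling : ∀ k j → 5 ≤ j → 2 + k ≤ j → G (1 + k) (1 + j) < G (3 + k) j
G-falling k j 5≤j s<j = begin-strict
  G (1 + k) (1 + j)                                      ≤⟨ G-upper (1 + k) (1 + j) ⟩
  6 * (8 ^ (1 + j) * y (1 + k) (1 + j)) + 4 ^ (1 + j) * 16 ≡⟨ tidy (8 ^ j) (4 ^ j) (y (1 + k) (1 + j)) ⟩
  6 * (8 ^ j * (8 * y (1 + k) (1 + j))) + 64 * 4 ^ j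
    <⟨ +-monoʳ-< (6 * (8 ^ j * (8 * y (1 + k) (1 + j))))
         (at-least (λ j → 64 * 4 ^ j < 6 * 8 ^ j) 5 power-bound 5≤j) ⟩
  6 * (8 ^ j * (8 * y (1 + k) (1 + j))) + 6 * 8 ^ j      ≡⟨ tidy′ (8 ^ j) (8 * y (1 + k) (1 + j)) ⟩
  6 * (8 ^ j * suc (8 * y (1 + k) (1 + j)))
    ≤⟨ *-monoʳ-≤ 6 (*-monoʳ-≤ (8 ^ j)
         (Ratio.falling (1 + k) j s<j (falling-bound (1 + k)))) ⟩
  6 * (8 ^ j * y (3 + k) j)                              ≤⟨ G-lower k j ⟩
  G (3 + k) j                                            ∎
  where
  open ≤-Reasoning
  tidy : ∀ e f y → 6 * (8 * e * y) + 4 * f * 16 ≡ 6 * (e * (8 * y)) + 64 * f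
  tidy = solve-∀
  tidy′ : ∀ e y → 6 * (e * y) + 6 * e ≡ 6 * (e * (1 + y))
  tidy′ = solve-∀

double≡ : ∀ j → double j ≡ j + j
double≡ zero    = refl
double≡ (suc j) = cong suc (trans (cong suc (double≡ j)) (sym (+-suc j j)))

half-< : ∀ n i → ⌊ n /2⌋ < i → n < double i
half-< zero          (suc i) lt = z<s
half-< (suc zero)    (suc i) lt = s<s z<s
half-< (suc (suc n)) (suc i) lt = s<s (s<s (half-< n i (s≤s⁻¹ lt)))

≤-half : ∀ i n → double i ≤ n → i ≤ ⌊ n /2⌋
≤-half i n le = ≮⇒≥ λ lt → <⇒≱ (half-< n i lt) le

half-≤ : ∀ i n → i ≤ ⌊ n /2⌋ → double i ≤ n
half-≤ zero    n             le = z≤n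
half-≤ (suc i) (suc (suc n)) le = s≤s (s≤s (half-≤ i n (s≤s⁻¹ le)))

half-parity : ∀ n → n ≡ double ⌊ n /2⌋ ⊎ n ≡ suc (double ⌊ n /2⌋)
half-parity zero          = inj₁ refl
half-parity (suc zero)    = inj₂ refl
half-parity (suc (suc n)) with half-parity n
... | inj₁ eq = inj₁ (cong (λ k → suc (suc k)) eq)
... | inj₂ eq = inj₂ (cong (λ k → suc (suc k)) eq)

c⁺-zero : ∀ n i → n < double i → c⁺ n i ≡ 0
c⁺-zero zero          (suc i) _ = refl
c⁺-zero (suc zero)    (suc i) _ = refl
c⁺-zero (suc (suc n)) (suc i) (s≤s (s≤s lt)) = cong (4 *_) (c⁺-zero n i lt)

f₀-constant : ∀ m → f₀ (2 + m) 0 ≡ 0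
f₀-constant m = m+n≡0⇒m≡0 _ (m+n≡0⇒m≡0 _ (f₀-closed (1 + m) 0))

f₀-linear : ∀ m → f₀ (2 + m) 1 ≡ 6 + c⁺ (2 + m) 1
f₀-linear m = begin
  f₀ (2 + m) 1                                    ≡⟨ +-identityʳ _ ⟨
  f₀ (2 + m) 1 + 6 * 0                            ≡⟨ +-identityʳ _ ⟨
  f₀ (2 + m) 1 + 6 * 0 + 4 * 0                    ≡⟨ cong (λ a → f₀ (2 + m) 1 + 6 * 0 + 4 * a) (c⁻-constant m) ⟨
  f₀ (2 + m) 1 + 6 * 0 + c⁻ (2 + m) 1             ≡⟨ f₀-closed (1 + m) 1 ⟩
  6 * 0 + 6 * w (1 + m) 0 + c⁺ (2 + m) 1          ≡⟨ cong (λ a → 6 * 0 + 6 * a + c⁺ (2 + m) 1)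
                                                       (w-value (1 + m) 0) ⟩
  6 + c⁺ (2 + m) 1                                ∎
  where open ≡-Reasoning

-- In the boundary case m = 2j both U and W still contribute, but they cancel since `mersenne 0`
-- vanishes.
f₀-beyond : ∀ m j → m ≤ double j → f₀ (1 + m) (2 + j) ≡ 0
f₀-beyond m j m≤2j with m≤n⇒m<n∨m≡n m≤2j
... | inj₁ lt   = m+n≡0⇒m≡0 _ (m+n≡0⇒m≡0 _ (trans (f₀-closed m (2 + j))
  (cong₂ _+_ (cong₂ (λ a b → 6 * a + 6 * b) (u-zero m j lt) (w-zero m (1 + j) (m<n⇒m<1+n (m<n⇒m<1+n lt))))
             (c⁺-zero (1 + m) (2 + j) (s<s (m<n⇒m<1+n (m<n⇒m<1+n (m<n⇒m<1+n lt))))))))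
... | inj₂ refl = subst (λ n → f₀ (1 + n) (2 + j) ≡ 0) (+-identityʳ (double j))
  (m+n≡0⇒m≡0 _ (trans (G-value 0 j) (vanish (8 ^ j) (4 ^ j))))
  where
  vanish : ∀ a b → 6 * (a * 0) + b * 0 ≡ 0
  vanish = solve-∀

-- Unimodality
maxGenus : ℕ → ℕ
maxGenus n = suc ⌊ n /2⌋

f₀-min : ∀ m → 0 < f₀ (2 + m) 1
f₀-min m = subst (0 <_) (sym (f₀-linear m)) z<s

G-positive₁ : ∀ j → 0 < G 1 j
G-positive₁ j = n≢0⇒n>0 λ G≡0 → <⇒≢
  (>-nonZero⁻¹ (6 * (8 ^ j * y 1 j))
    {{m*n≢0 6 _ {{_}} {{m*n≢0 (8 ^ j) _ {{8^-nonZero j}} {{y-nonZero}}}}}})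
  (sym (m+n≡0⇒m≡0 (6 * (8 ^ j * y 1 j)) (trans (sym (G-value 1 j))
    (trans (cong (_+ 4 ^ j * 0) G≡0) (*-zeroʳ (4 ^ j))))))
  where
  y-nonZero : NonZero (y 1 j)
  y-nonZero = >-nonZero (≤-trans (binomial-positive 1 j) (≤-trans (m≤m+n _ _) (m≤m+n _ _)))

-- At r = 2 the negative correction is 12 · 4 ^ j; the second term of y alone outweighs it with 48 ·
-- 8 ^ j.
G-positive₂ : ∀ j → 0 < G 2 j
G-positive₂ j = n≢0⇒n>0 λ G≡0 → <⇒≢ (begin-strict
  4 ^ j * 12                             ≤⟨ *-monoˡ-≤ 12 (^-monoˡ-≤ j (m≤m+n 4 4)) ⟩
  8 ^ j * 12                             <⟨ *-monoʳ-< (8 ^ j) {{8^-nonZero j}} (from-yes (12 <? 6 * 8)) ⟩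
  8 ^ j * (6 * 8)
    ≤⟨ *-monoʳ-≤ (8 ^ j) (*-monoʳ-≤ 6 (≤-trans
         (*-monoʳ-≤ 8 (binomial-positive 0 (1 + j))) (m≤n+m _ (3 * binomial 2 j)))) ⟩
  8 ^ j * (6 * y 2 j)                    ≡⟨ tidy (8 ^ j) (y 2 j) ⟩
  6 * (8 ^ j * y 2 j)                    ≤⟨ m≤m+n _ _ ⟩
  6 * (8 ^ j * y 2 j) + 4 ^ j * 0        ∎)
  (trans (cong (_+ 4 ^ j * 12) (sym G≡0)) (G-value 2 j))
  where
  open ≤-Reasoning
  tidy : ∀ a b → a * (6 * b) ≡ 6 * (a * b)
  tidy = solve-∀

f₀-max : ∀ n → 2 ≤ n → 0 < f₀ n (maxGenus n)
f₀-max n 2≤n with ⌊ n /2⌋ | ≤-half 1 n 2≤n | half-parity n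
... | suc j | _ | inj₁ refl = subst (λ m → 0 < f₀ (1 + m) (2 + j)) (+-comm (double j) 1) (G-positive₁ j)
... | suc j | _ | inj₂ refl = subst (λ m → 0 < f₀ (1 + m) (2 + j)) (+-comm (double j) 2) (G-positive₂ j)

f₀-range : ∀ n → 2 ≤ n → ∀ i → 0 < f₀ n i → 1 ≤ i × i ≤ maxGenus n
f₀-range (suc (suc m)) _ zero          pos = ⊥-elim (<⇒≢ pos (sym (f₀-constant m)))
f₀-range (suc zero)    (s≤s ()) zero
f₀-range n             _ (suc zero)    pos = ≤-refl , s≤s z≤n
f₀-range (suc m)       _ (suc (suc j)) pos = s≤s z≤n , ≮⇒≥ λ N<i →
  <⇒≢ pos (sym (f₀-beyond m j (s≤s⁻¹ (s≤s⁻¹ (half-< (suc m) (suc j) (s≤s⁻¹ N<i))))))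

genus-range : ∀ n → 2 ≤ n → GenusRange (𝒮₉ n) 1 (maxGenus n)
genus-range n@(suc (suc m)) 2≤n = record
  { min-attained = subst (0 <_) (sym (g₉-f₀ n 1)) (f₀-min m)
  ; max-attained = subst (0 <_) (sym (g₉-f₀ n (maxGenus n))) (f₀-max n 2≤n)
  ; bounds       = λ i pos → f₀-range n 2≤n i (subst (0 <_) (g₉-f₀ n i) pos) }
genus-range (suc zero) (s≤s ())

-- All inequalities are strict, which yields a single mode, and the quantifiers are bounded, which
-- makes the property decidable.
record StrictPeak (α : ℕ → ℕ) (q N p : ℕ) : Set where
  constructor strictPeak
  field
    q≤p     : q ≤ p
    p≤N     : p ≤ N
    rising  : ∀ {i} → i < p → q ≤ i → α i < α (suc i)
    falling : ∀ {i} → i < N → p ≤ i → α (suc i) < α i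

strictPeak⇒peak : ∀ {α β q N p} → (∀ i → α i ≡ β i) → StrictPeak β q N p → Peak α q N p
strictPeak⇒peak {α} {β} {q} {N} {p} eq s = record
  { q≤l        = q≤p
  ; l≤m        = ≤-refl
  ; m≤N        = p≤N
  ; increasing = λ i q≤i i+1<p → <⇒≤ (up (<-trans (n<1+n i) i+1<p) q≤i)
  ; rise       = λ { i q≤i refl → up (n<1+n i) q≤i }
  ; plateau    = λ i p≤i i<p → ⊥-elim (<⇒≱ i<p p≤i)
  ; fall       = λ p<N → down p<N ≤-refl
  ; decreasing = λ i p<i i<N → <⇒≤ (down i<N (<⇒≤ p<i)) }
  where
  open StrictPeak s
  up : ∀ {i} → i < p → q ≤ i → α i < α (suc i)
  up {i} i<p q≤i = subst₂ _<_ (sym (eq i)) (sym (eq (suc i))) (rising i<p q≤i)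
  down : ∀ {i} → i < N → p ≤ i → α (suc i) < α i
  down {i} i<N p≤i = subst₂ _<_ (sym (eq (suc i))) (sym (eq i)) (falling i<N p≤i)

strictPeak? : ∀ α q N p → Dec (StrictPeak α q N p)
strictPeak? α q N p with q ≤? p | p ≤? N | allUpTo? (λ i → (q ≤? i) →-dec (α i <? α (suc i))) p
                       | allUpTo? (λ i → (p ≤? i) →-dec (α (suc i) <? α i)) N
... | yes a | yes b | yes c | yes d = yes (strictPeak a b c d)
... | no ¬a | _     | _     | _     = no λ s → ¬a (StrictPeak.q≤p s)
... | _     | no ¬b | _     | _     = no λ s → ¬b (StrictPeak.p≤N s)
... | _     | _     | no ¬c | _     = no λ s → ¬c (StrictPeak.rising s)
... | _     | _     | _     | no ¬d = no λ s → ¬d (StrictPeak.falling s)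

-- The form in which small cases are evaluated, instead of enumerating the 4 ^ n pairs. The
-- subtraction is exact by `f₀-closed`.
closedForm : ℕ → ℕ → ℕ
closedForm m i = (6 * ∂ (∂ (u m)) i + 6 * ∂ (w m) i + c⁺ (1 + m) i) ∸ (6 * ∂ (∂ (w m)) i + c⁻ (1 + m) i)

f₀-closedForm : ∀ m i → f₀ (1 + m) i ≡ closedForm m i
f₀-closedForm m i = sym (trans
  (cong (_∸ (6 * ∂ (∂ (w m)) i + c⁻ (1 + m) i)) (trans (sym (f₀-closed m i)) (+-assoc (f₀ (1 + m) i) _ _)))
  (m+n∸n≡m (f₀ (1 + m) i) (6 * ∂ (∂ (w m)) i + c⁻ (1 + m) i)))

SmallPeak : ℕ → Set
SmallPeak m = 1 ≤ m → StrictPeak (closedForm m) 1 (maxGenus (1 + m)) (p₉ (1 + m))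

smallPeak? : U.Decidable SmallPeak
smallPeak? m = (1 ≤? m) →-dec strictPeak? (closedForm m) 1 (maxGenus (1 + m)) (p₉ (1 + m))

abstract
  small-peaks : ∀ {m} → m < 15 → SmallPeak m
  small-peaks = from-yes (allUpTo? smallPeak? 15)

f₀-first-rise : ∀ k → f₀ (6 + k) 1 < f₀ (6 + k) 2
f₀-first-rise k = begin-strict
  f₀ (6 + k) 1          ≡⟨ f₀-linear (4 + k) ⟩
  6                     <⟨ m<m+n 6 z<s ⟩
  6 * (1 * 8)           ≤⟨ *-monoʳ-≤ 6 (*-monoʳ-≤ 1 (≤-trans (*-monoʳ-≤ 8 (binomial-positive (3 + k) 1))
                             (m≤n+m _ (mersenne (5 + k) * binomial (5 + k) 0)))) ⟩
  6 * (1 * y (5 + k) 0) ≡⟨ G-exact k 0 ⟨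
  f₀ (6 + k) 2          ∎
  where open ≤-Reasoning

G-rising-at : ∀ s j {m} → 5 ≤ s → j ≤ s → double j + (2 + s) ≡ m →
              f₀ (1 + m) (2 + j) < f₀ (1 + m) (3 + j)
G-rising-at s j 5≤s j≤s refl = subst (λ a → G (2 + s) j < f₀ (1 + a) (3 + j))
  (sym (trans (+-suc (double j) (1 + s)) (cong suc (+-suc (double j) s))))
  (at-least (λ s → j ≤ s → G (2 + s) j < G s (1 + j)) 5 (λ k → G-rising k j) 5≤s j≤s)

G-falling-at : ∀ k j {m} → 5 ≤ j → 2 + k ≤ j → double j + (3 + k) ≡ m →
               f₀ (1 + m) (3 + j) < f₀ (1 + m) (2 + j)
G-falling-at k j 5≤j s<j refl = subst (λ a → f₀ (1 + a) (3 + j) < G (3 + k) j)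
  (sym (trans (+-suc (double j) (2 + k)) (cong suc (+-suc (double j) (1 + k)))))
  (G-falling k j 5≤j s<j)

-- Write m = 2j + 2 + s. The condition j ≤ s of `G-rising` amounts to 3 (j + 1) ≤ 1 + m, that is j <
-- P, and the condition s < j of `G-falling` to P ≤ j. The two ranges meet at genus 2 + P.
module Large (m P : ℕ) (15≤m : 15 ≤ m) (3P≤n : 3 * P ≤ 1 + m) (n≤3P+2 : 1 + m ≤ 2 + 3 * P) where

  open ≤-Reasoning

  private
    at-least-5 : ∀ {a} → 13 ≤ 3 * a → 5 ≤ a
    at-least-5 {a} 13≤3a = ≮⇒≥ λ a<5 → <⇒≱ (s≤s (*-monoʳ-≤ 3 (s≤s⁻¹ a<5))) 13≤3a

    5≤P : 5 ≤ P
    5≤P = at-least-5 (+-cancelˡ-≤ 2 13 (3 * P) (≤-trans 15≤m (≤-trans (n≤1+n m) n≤3P+2)))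

  p≤max : 2 + P ≤ maxGenus (1 + m)
  p≤max = s≤s (≤-half (1 + P) (1 + m) (begin
    2 + double P     ≡⟨ cong (2 +_) (double≡ P) ⟩
    2 + (P + P)      ≤⟨ +-monoˡ-≤ (P + P) (≤-trans (m≤m+n 2 3) 5≤P) ⟩
    P + (P + P)      ≡⟨ cong (λ a → P + (P + a)) (+-identityʳ P) ⟨
    3 * P            ≤⟨ 3P≤n ⟩
    1 + m            ∎))

  rising : ∀ {i} → i < 2 + P → 1 ≤ i → f₀ (1 + m) i < f₀ (1 + m) (suc i)
  rising {suc zero}    _   _ =
    at-least (λ m → f₀ (1 + m) 1 < f₀ (1 + m) 2) 5 f₀-first-rise (≤-trans (m≤m+n 5 10) 15≤m)
  rising {suc (suc j)} j<P _ =
    G-rising-at (j + t) j 5≤s (m≤m+n j t) (trans (sym (+-assoc (double j) (2 + j) t)) eq)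
    where
    tidy : ∀ j → 1 + (j + j + (2 + j)) ≡ 3 * (1 + j)
    tidy = solve-∀
    tidy′ : ∀ j t → j + j + (2 + j) + t ≡ 2 + (3 * j + t)
    tidy′ = solve-∀

    3j+2≤m : double j + (2 + j) ≤ m
    3j+2≤m = s≤s⁻¹ (begin
      1 + (double j + (2 + j))   ≡⟨ cong (λ a → 1 + (a + (2 + j))) (double≡ j) ⟩
      1 + (j + j + (2 + j))      ≡⟨ tidy j ⟩
      3 * (1 + j)                ≤⟨ *-monoʳ-≤ 3 (s≤s⁻¹ (s≤s⁻¹ j<P)) ⟩
      3 * P                      ≤⟨ 3P≤n ⟩
      1 + m                      ∎)

    t : ℕ
    t = m ∸ (double j + (2 + j))

    eq : double j + (2 + j) + t ≡ m
    eq = m+[n∸m]≡n 3j+2≤m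

    -- With s = j + t one has m ≤ 2 + 3s, so 15 ≤ m puts s into the range of `G-exact`; 14 would
    -- only give s ≥ 4.
    5≤s : 5 ≤ j + t
    5≤s = at-least-5 (+-cancelˡ-≤ 2 13 (3 * (j + t)) (begin
      15                        ≤⟨ 15≤m ⟩
      m                         ≡⟨ eq ⟨
      double j + (2 + j) + t    ≡⟨ cong (λ a → a + (2 + j) + t) (double≡ j) ⟩
      j + j + (2 + j) + t       ≡⟨ tidy′ j t ⟩
      2 + (3 * j + t)           ≤⟨ +-monoʳ-≤ 2 (+-monoʳ-≤ (3 * j) (m≤n*m t 3)) ⟩
      2 + (3 * j + 3 * t)       ≡⟨ cong (2 +_) (*-distribˡ-+ 3 j t) ⟨
      2 + 3 * (j + t)           ∎))

  falling : ∀ {i} → i < maxGenus (1 + m) → 2 + P ≤ i → f₀ (1 + m) (suc i) < f₀ (1 + m) i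
  falling {suc zero}    _   (s≤s ())
  falling {suc (suc j)} i<N P≤j =
    G-falling-at k j (≤-trans 5≤P P≤j′) s<j (trans (sym (+-assoc (double j) 3 k)) eq)
    where
    P≤j′ : P ≤ j
    P≤j′ = s≤s⁻¹ (s≤s⁻¹ P≤j)

    2j+3≤m : double j + 3 ≤ m
    2j+3≤m = ≤-trans (≤-reflexive (+-comm (double j) 3)) (s≤s⁻¹ (half-≤ (2 + j) (1 + m) (s≤s⁻¹ i<N)))

    k : ℕ
    k = m ∸ (double j + 3)

    eq : double j + 3 + k ≡ m
    eq = m+[n∸m]≡n 2j+3≤m

    tidy : ∀ j k → 2 + (j + j) + (2 + k) ≡ 1 + (j + j + 3 + k)
    tidy = solve-∀
    tidy′ : ∀ j → 2 + 3 * j ≡ 2 + (j + j) + j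
    tidy′ = solve-∀

    s<j : 2 + k ≤ j
    s<j = +-cancelˡ-≤ (2 + (j + j)) (2 + k) j (begin
      2 + (j + j) + (2 + k)      ≡⟨ tidy j k ⟩
      1 + (j + j + 3 + k)        ≡⟨ cong (λ a → 1 + (a + 3 + k)) (double≡ j) ⟨
      1 + (double j + 3 + k)     ≡⟨ cong suc eq ⟩
      1 + m                      ≤⟨ n≤3P+2 ⟩
      2 + 3 * P                  ≤⟨ +-monoʳ-≤ 2 (*-monoʳ-≤ 3 P≤j′) ⟩
      2 + 3 * j                  ≡⟨ tidy′ j ⟩
      2 + (j + j) + j            ∎)

  large-peak : StrictPeak (f₀ (1 + m)) 1 (maxGenus (1 + m)) (2 + P)
  large-peak = strictPeak (s≤s z≤n) p≤max rising falling

large-peaks : ∀ {m} → 15 ≤ m → StrictPeak (f₀ (1 + m)) 1 (maxGenus (1 + m)) (2 + (1 + m) / 3)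
large-peaks {m} 15≤m = Large.large-peak m P 15≤m
  (≤-trans (≤-reflexive (*-comm 3 P)) (m/n*n≤m (1 + m) 3))
  (begin
    1 + m                  ≡⟨ m≡m%n+[m/n]*n (1 + m) 3 ⟩
    (1 + m) % 3 + P * 3    ≤⟨ +-monoˡ-≤ (P * 3) (s≤s⁻¹ (m%n<n (1 + m) 3)) ⟩
    2 + P * 3              ≡⟨ cong (2 +_) (*-comm P 3) ⟩
    2 + 3 * P              ∎)
  where
  open ≤-Reasoning
  P : ℕ
  P = (1 + m) / 3

p₉-large : ∀ k → 2 + (16 + k) / 3 ≡ p₉ (16 + k)
p₉-large k = +-comm 2 ((16 + k) / 3)

private
  peak-at : ∀ m → 1 ≤ m → Dec (m < 15) → Peak (g₉ (1 + m)) 1 (maxGenus (1 + m)) (p₉ (1 + m))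
  peak-at m 1≤m (yes m<15) = strictPeak⇒peak
    (λ i → trans (g₉-f₀ (1 + m) i) (f₀-closedForm m i)) (small-peaks m<15 1≤m)
  peak-at m 1≤m (no  m≮15) = strictPeak⇒peak (g₉-f₀ (1 + m))
    (subst (StrictPeak (f₀ (1 + m)) 1 (maxGenus (1 + m)))
      (at-least (λ m → 2 + (1 + m) / 3 ≡ p₉ (1 + m)) 15 p₉-large (≮⇒≥ m≮15)) (large-peaks (≮⇒≥ m≮15)))

peak₉ : ∀ n → 2 ≤ n → Peak (g₉ n) 1 (maxGenus n) (p₉ n)
peak₉ (suc m) 2≤n = peak-at m (s≤s⁻¹ 2≤n) (m <? 15)

theorem3p15 : (n : ℕ) → 2 ≤ n →
    ∃₂ λ q N → GenusRange (𝒮₉ n) q N × Unimodal (g₉ n) q N × Peak (g₉ n) q N (p₉ n)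
theorem3p15 n 2≤n = 1 , maxGenus n , genus-range n 2≤n , (p₉ n , p₉ n , peak₉ n 2≤n) , peak₉ n 2≤n
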